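{- Let $W$ be an irreducible $T$-module with endpoint $r$ and diameter $d=D-2r$. Let $u\in E_rW$, $u^*\in E_r^*W$, $u^{\varepsilon}\in E_r^{\varepsilon}W$ be nonzero vectors. Consider the $(d+1)\times(d+1)$ tridiagonal matrix $$B=\begin{pmatrix}0&d&&&&0\\1&0&d-1&&&\\&2&\cdot&\cdot&&\\&&\cdot&\cdot&\cdot&\\&&&\cdot&\cdot&1\\0&&&&d&0\end{pmatrix},$$ i.e. $B_{i,i-1}=i$ for $1\le i\le d$, $B_{i,i+1}=d-i$ for $0\le i\le d-1$, and all other entries are $0$. Then the following hold. (i) $B$ represents $A$ with respect to the bases $E^*_ru,\ldots,E^*_{r+d}u$ and $E^{\varepsilon}_ru,\ldots,E^{\varepsilon}_{r+d}u$ of $W$. (ii) $B$ represents $A^*$ with respect to the bases $E^{\varepsilon}_ru^*,\ldots,E^{\varepsilon}_{r+d}u^*$ and $E_ru^*,\ldots,E_{r+d}u^*$ of $W$. (iii) $B$ represents $A^{\varepsilon}$ with respect to the bases $E_ru^{\varepsilon},\ldots,E_{r+d}u^{\varepsilon}$ and $E^*_ru^{\varepsilon},\ldots,E^*_{r+d}u^{\varepsilon}$ of $W$.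
   Context: Let $D$ be a positive integer and let $Q_D$ be the $D$-cube: the graph with vertex set $X=\{0,1\}^D$, two vertices being adjacent iff they differ in exactly one coordinate; $\partial$ denotes path-length distance. $\mathrm{Mat}_X(\mathbb{C})$ is the algebra of complex matrices with rows and columns indexed by $X$, acting on $V=\mathbb{C}^X$ (column vectors) by left multiplication. Write $\mathbf{i}^2=-1$. Let $A$ be the adjacency matrix of $Q_D$. Fix $x=(0,0,\ldots,0)\in X$. Let $A^*$ be the diagonal matrix in $\mathrm{Mat}_X(\mathbb{C})$ with $(y,y)$-entry $D-2\partial(x,y)$ for $y\in X$, and let $A^{\varepsilon}=-\mathbf{i}(AA^*-A^*A)/2$. Let $T$ be the subalgebra of $\mathrm{Mat}_X(\mathbb{C})$ generated by $A$ and $A^*$. The eigenvalues of $A$ are $\theta_i=D-2i$ $(0\le i\le D)$. For $0\le i\le D$: $E_i=\prod_{0\le j\le D,\,j\ne i}\frac{A-\theta_jI}{\theta_i-\theta_j}$ is the primitive idempotent of $A$ for $\theta_i$ (the orthogonal projection onto the $\theta_i$-eigenspace of $A$); $E_i^*$ is the diagonal matrix with $(y,y)$-entry $1$ if $\partial(x,y)=i$ and $0$ otherwise; and $E_i^{\varepsilon}=P^{ -1}E_iP$, where $P=P_1^{\otimes D}$ (Kronecker power, $P_{yz}=\prod_{k=1}^D(P_1)_{y_kz_k}$, invertible) with $P_1=\begin{pmatrix}1&1\\-\mathbf{i}&\mathbf{i}\end{pmatrix}$, rows and columns indexed by $0,1$ in that order. ($E_i^*$ and $E_i^{\varepsilon}$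 are the primitive idempotents of $A^*$ and $A^{\varepsilon}$ for the eigenvalue $D-2i$.) A $T$-module is a subspace $W\subseteq V$ with $BW\subseteq W$ for all $B\in T$; it is irreducible if $W\ne0$ and it contains no $T$-modules other than $0$ and $W$. The endpoint of an irreducible $T$-module $W$ is $r=\min\{i\mid 0\le i\le D,\ E_i^*W\neq0\}$ (it is known that also $r=\min\{i\mid E_iW\ne0\}$), and its diameter is $d=|\{i\mid 0\le i\le D,\ E_i^*W\ne0\}|-1$; it is known that $d=D-2r$ and $0\le r\le D/2$. For nonzero $u\in E_rW$, $u^*\in E^*_rW$, $u^{\varepsilon}\in E^{\varepsilon}_rW$, each of the six sequences $(E^*_{r+i}u)_{i=0}^d$, $(E^{\varepsilon}_{r+i}u)_{i=0}^d$, $(E^{\varepsilon}_{r+i}u^*)_{i=0}^d$, $(E_{r+i}u^*)_{i=0}^d$, $(E_{r+i}u^{\varepsilon})_{i=0}^d$, $(E^*_{r+i}u^{\varepsilon})_{i=0}^d$ is a basis of $W$. Convention: a $(d+1)\times(d+1)$ matrix $B$ (rows and columns indexed $0,\ldots,d$) represents $Y\in T$ with respect to a basis $v_0,\ldots,v_d$ of $W$ if $Yv_j=\sum_{i=0}^dB_{ij}v_i$ for $0\le j\le d$. -}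

module Defs where

open import Algebra.Bundles using (AbelianGroup; CommutativeRing)
open import Data.Bool.Base using (if_then_else_)
open import Data.Fin.Base using (Fin; zero; suc; toℕ)
open import Data.Fin.Patterns using (0F; 1F)
import Data.Fin.Properties as Fin
import Data.Fin.Subset as Subset
open import Data.Integer.Base as ℤ using (+_; _⊖_)
import Data.Integer.Properties as ℤ
open import Data.List.Base as List using (List; upTo)
open import Data.Nat.Base as ℕ using (ℕ; zero; suc)
import Data.Nat.Properties as ℕ
open import Data.Product.Base using (∃; ∃-syntax; _×_; _,_; proj₁)
open import Data.Rational.Base as ℚ using (ℚ; 0ℚ; 1ℚ; ½)
open import Data.Rational.Literals using (fromℤ)
import Data.Rational.Properties as ℚ
open import Data.Rational.Solver using (module +-*-Solver)
open import Data.Sum.Base using (_⊎_)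
open import Data.Vec.Base as Vec using (Vec; []; _∷_; replicate)
import Data.Vec.Properties as Vec
open import Function.Bundles using (_⇔_)
open import Level using (0ℓ)
open import Relation.Binary.PropositionalEquality
  using (_≡_; _≢_; _≗_; refl; sym; trans; cong; subst)
open import Relation.Nullary using (¬_; yes; no; does)
open import Relation.Unary using (Pred; _∈_; _⊆_)
import Algebra.Properties.Group as GroupProperties
import Algebra.Properties.Monoid.Sum as MonoidSum

infix 4 _∼_

-- For Cauchy sequences, s ∼ t says that s and t have the same limit; and
-- s ∼ s is the Cauchy condition itself.
record _∼_ (s t : ℕ → ℚ) : Set where
  constructor close
  field
    modulus : ∀ ε → 0ℚ ℚ.< ε →
              ∃[ N ] ∀ m n → N ℕ.≤ m → N ℕ.≤ n → ℚ.∣ s m ℚ.- t n ∣ ℚ.< ε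

open _∼_ public

private
  half-pos : ∀ {ε} → 0ℚ ℚ.< ε → 0ℚ ℚ.< ½ ℚ.* ε
  half-pos {ε} ε>0 =
    ℚ.positive⁻¹ (½ ℚ.* ε) {{ℚ.pos*pos⇒pos ½ ε {{ℚ.positive ε>0}}}}

  half+half : ∀ ε → ½ ℚ.* ε ℚ.+ ½ ℚ.* ε ≡ ε
  half+half = solve 1 (λ ε → con ½ :* ε :+ con ½ :* ε := ε) refl
    where open +-*-Solver

  ∣p-q∣≡∣q-p∣ : ∀ p q → ℚ.∣ p ℚ.- q ∣ ≡ ℚ.∣ q ℚ.- p ∣
  ∣p-q∣≡∣q-p∣ p q = trans (cong ℚ.∣_∣ (lemma p q)) (ℚ.∣-p∣≡∣p∣ (q ℚ.- p))
    where
    open +-*-Solver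
    lemma : ∀ p q → p ℚ.- q ≡ ℚ.- (q ℚ.- p)
    lemma = solve 2 (λ p q → p :- q := :- (q :- p)) refl

  ∣p+q∣<ε : ∀ {ε} p q → ℚ.∣ p ∣ ℚ.< ½ ℚ.* ε → ℚ.∣ q ∣ ℚ.< ½ ℚ.* ε →
            ℚ.∣ p ℚ.+ q ∣ ℚ.< ε
  ∣p+q∣<ε {ε} p q p< q< = subst (ℚ.∣ p ℚ.+ q ∣ ℚ.<_) (half+half ε)
    (ℚ.≤-<-trans (ℚ.∣p+q∣≤∣p∣+∣q∣ p q) (ℚ.+-mono-< p< q<))

  ∣p*q∣<M*δ : ∀ {M δ} p q → 0ℚ ℚ.< M → ℚ.∣ p ∣ ℚ.< M → ℚ.∣ q ∣ ℚ.< δ →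
              ℚ.∣ p ℚ.* q ∣ ℚ.< M ℚ.* δ
  ∣p*q∣<M*δ {M} {δ} p q M>0 p< q< = subst (ℚ._< M ℚ.* δ) (sym (ℚ.∣p*q∣≡∣p∣*∣q∣ p q))
    (ℚ.≤-<-trans
      (ℚ.*-monoʳ-≤-nonNeg ℚ.∣ q ∣ {{ℚ.nonNegative (ℚ.0≤∣p∣ q)}} (ℚ.<⇒≤ p<))
      (ℚ.*-monoʳ-<-pos M {{ℚ.positive M>0}} q<))

∼-sym : ∀ {s t} → s ∼ t → t ∼ s
∼-sym {s} {t} s∼t .modulus ε ε>0 with N , p ← modulus s∼t ε ε>0 =
  N , λ m n N≤m N≤n → subst (ℚ._< ε) (∣p-q∣≡∣q-p∣ (s n) (t m)) (p n m N≤n N≤m)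

∼-trans : ∀ {s t w} → s ∼ t → t ∼ w → s ∼ w
∼-trans {s} {t} {w} s∼t t∼w .modulus ε ε>0
  with N , p ← modulus s∼t (½ ℚ.* ε) (half-pos ε>0) | M , q ← modulus t∼w (½ ℚ.* ε) (half-pos ε>0) =
  N ℕ.+ M , λ m n ≤m ≤n →
    subst (λ z → ℚ.∣ z ∣ ℚ.< ε) (lemma (s m) (t m) (w n))
      (∣p+q∣<ε (s m ℚ.- t m) (t m ℚ.- w n)
        (p m m (ℕ.m+n≤o⇒m≤o N ≤m) (ℕ.m+n≤o⇒m≤o N ≤m))
        (q m n (ℕ.m+n≤o⇒n≤o N ≤m) (ℕ.m+n≤o⇒n≤o N ≤n)))
  where
  open +-*-Solver
  lemma : ∀ a b c → (a ℚ.- b) ℚ.+ (b ℚ.- c) ≡ a ℚ.- c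
  lemma = solve 3 (λ a b c → (a :- b) :+ (b :- c) := a :- c) refl

∼-resp-≗ : ∀ {s t} → s ∼ s → s ≗ t → s ∼ t
∼-resp-≗ {s} {t} s∼s s≗t .modulus ε ε>0 with N , p ← modulus s∼s ε ε>0 =
  N , λ m n ≤m ≤n → subst (λ z → ℚ.∣ s m ℚ.- z ∣ ℚ.< ε) (s≗t n) (p m n ≤m ≤n)

∼-const : ∀ q → (λ _ → q) ∼ (λ _ → q)
∼-const q .modulus ε ε>0 = 0 , λ _ _ _ _ → subst (λ z → ℚ.∣ z ∣ ℚ.< ε) (sym (ℚ.+-inverseʳ q)) ε>0

∼-+ : ∀ {s s′ t t′} → s ∼ s′ → t ∼ t′ → (λ n → s n ℚ.+ t n) ∼ (λ n → s′ n ℚ.+ t′ n)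
∼-+ {s} {s′} {t} {t′} s∼s′ t∼t′ .modulus ε ε>0
  with N , p ← modulus s∼s′ (½ ℚ.* ε) (half-pos ε>0) | M , q ← modulus t∼t′ (½ ℚ.* ε) (half-pos ε>0) =
  N ℕ.+ M , λ m n ≤m ≤n →
    subst (λ z → ℚ.∣ z ∣ ℚ.< ε) (lemma (s m) (s′ n) (t m) (t′ n))
      (∣p+q∣<ε (s m ℚ.- s′ n) (t m ℚ.- t′ n)
        (p m n (ℕ.m+n≤o⇒m≤o N ≤m) (ℕ.m+n≤o⇒m≤o N ≤n))
        (q m n (ℕ.m+n≤o⇒n≤o N ≤m) (ℕ.m+n≤o⇒n≤o N ≤n)))
  where
  open +-*-Solver
  lemma : ∀ a b c d → (a ℚ.- b) ℚ.+ (c ℚ.- d) ≡ (a ℚ.+ c) ℚ.- (b ℚ.+ d)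
  lemma = solve 4 (λ a b c d → (a :- b) :+ (c :- d) := (a :+ c) :- (b :+ d)) refl

∼-neg : ∀ {s t} → s ∼ t → (λ n → ℚ.- s n) ∼ (λ n → ℚ.- t n)
∼-neg {s} {t} s∼t .modulus ε ε>0 with N , p ← modulus s∼t ε ε>0 =
  N , λ m n ≤m ≤n → subst (ℚ._< ε)
    (trans (sym (ℚ.∣-p∣≡∣p∣ (s m ℚ.- t n))) (cong ℚ.∣_∣ (lemma (s m) (t n)))) (p m n ≤m ≤n)
  where
  open +-*-Solver
  lemma : ∀ a b → ℚ.- (a ℚ.- b) ≡ (ℚ.- a) ℚ.- (ℚ.- b)
  lemma = solve 2 (λ a b → :- (a :- b) := (:- a) :- (:- b)) refl

private
  bounded : ∀ {s t} → s ∼ t → ∃[ M ] 0ℚ ℚ.< M × ∃[ N ] ∀ n → N ℕ.≤ n → ℚ.∣ s n ∣ ℚ.< M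
  bounded {s} {t} s∼t with N , p ← modulus s∼t 1ℚ (ℚ.positive⁻¹ 1ℚ) =
    1ℚ ℚ.+ ℚ.∣ t N ∣ ,
    ℚ.+-mono-<-≤ (ℚ.positive⁻¹ 1ℚ) (ℚ.0≤∣p∣ (t N)) ,
    N , λ n ≤n → ℚ.≤-<-trans
      (subst (λ z → ℚ.∣ z ∣ ℚ.≤ ℚ.∣ s n ℚ.- t N ∣ ℚ.+ ℚ.∣ t N ∣) (lemma (s n) (t N))
        (ℚ.∣p+q∣≤∣p∣+∣q∣ (s n ℚ.- t N) (t N)))
      (ℚ.+-monoˡ-< ℚ.∣ t N ∣ (p n N ≤n ℕ.≤-refl))
    where
    open +-*-Solver
    lemma : ∀ a b → (a ℚ.- b) ℚ.+ b ≡ a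
    lemma = solve 2 (λ a b → (a :- b) :+ b := a) refl

  shrink : ∀ {M ε} → 0ℚ ℚ.< M → 0ℚ ℚ.< ε → ∃[ δ ] 0ℚ ℚ.< δ × M ℚ.* δ ≡ ½ ℚ.* ε
  shrink {M} {ε} M>0 ε>0 =
    ℚ.1/ M ℚ.* (½ ℚ.* ε) ,
    ℚ.positive⁻¹ _ {{ℚ.pos*pos⇒pos (ℚ.1/ M) {{ℚ.1/pos⇒pos M}} (½ ℚ.* ε)
      {{ℚ.positive (half-pos ε>0)}}}} ,
    trans (sym (ℚ.*-assoc M (ℚ.1/ M) (½ ℚ.* ε)))
      (trans (cong (ℚ._* (½ ℚ.* ε)) (ℚ.*-inverseʳ M)) (ℚ.*-identityˡ (½ ℚ.* ε)))
    where
    instance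
      M-pos = ℚ.positive M>0
      M-nonZero = ℚ.pos⇒nonZero M

private
  *-close : ∀ {M M′ δ δ′ ε} a a′ b b′ → 0ℚ ℚ.< M → 0ℚ ℚ.< M′ →
            M ℚ.* δ ≡ ½ ℚ.* ε → M′ ℚ.* δ′ ≡ ½ ℚ.* ε →
            ℚ.∣ a ∣ ℚ.< M → ℚ.∣ b′ ∣ ℚ.< M′ →
            ℚ.∣ b ℚ.- b′ ∣ ℚ.< δ → ℚ.∣ a ℚ.- a′ ∣ ℚ.< δ′ →
            ℚ.∣ a ℚ.* b ℚ.- a′ ℚ.* b′ ∣ ℚ.< ε
  *-close {ε = ε} a a′ b b′ M>0 M′>0 Mδ≡ M′δ′≡ a<M b′<M′ b-b′<δ a-a′<δ′ =
    subst (λ z → ℚ.∣ z ∣ ℚ.< ε) (lemma a a′ b b′)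
      (∣p+q∣<ε (a ℚ.* (b ℚ.- b′)) (b′ ℚ.* (a ℚ.- a′))
        (subst (ℚ.∣ a ℚ.* (b ℚ.- b′) ∣ ℚ.<_) Mδ≡ (∣p*q∣<M*δ a (b ℚ.- b′) M>0 a<M b-b′<δ))
        (subst (ℚ.∣ b′ ℚ.* (a ℚ.- a′) ∣ ℚ.<_) M′δ′≡
          (∣p*q∣<M*δ b′ (a ℚ.- a′) M′>0 b′<M′ a-a′<δ′)))
    where
    open +-*-Solver
    lemma : ∀ a b c d → a ℚ.* (c ℚ.- d) ℚ.+ d ℚ.* (a ℚ.- b) ≡ a ℚ.* c ℚ.- b ℚ.* d
    lemma = solve 4 (λ a b c d → a :* (c :- d) :+ d :* (a :- b) := a :* c :- b :* d) refl

∼-* : ∀ {s s′ t t′} → s ∼ s′ → t ∼ t′ → (λ n → s n ℚ.* t n) ∼ (λ n → s′ n ℚ.* t′ n)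
∼-* {s} {s′} {t} {t′} s∼s′ t∼t′ .modulus ε ε>0 =
  let M  , M>0  , N₁ , s<M   = bounded s∼s′
      M′ , M′>0 , N₂ , t′<M′ = bounded (∼-sym t∼t′)
      δ  , δ>0  , Mδ≡   = shrink M>0 ε>0
      δ′ , δ′>0 , M′δ′≡ = shrink M′>0 ε>0
      N₃ , p = modulus t∼t′ δ δ>0
      N₄ , q = modulus s∼s′ δ′ δ′>0
  in (N₁ ℕ.+ N₂) ℕ.+ (N₃ ℕ.+ N₄) , λ m n ≤m ≤n →
    let N₁₂≤m = ℕ.m+n≤o⇒m≤o (N₁ ℕ.+ N₂) ≤m
        N₁₂≤n = ℕ.m+n≤o⇒m≤o (N₁ ℕ.+ N₂) ≤n
        N₃₄≤m = ℕ.m+n≤o⇒n≤o (N₁ ℕ.+ N₂) ≤m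
        N₃₄≤n = ℕ.m+n≤o⇒n≤o (N₁ ℕ.+ N₂) ≤n
    in *-close {M} {M′} {δ} {δ′} {ε} (s m) (s′ n) (t m) (t′ n) M>0 M′>0 Mδ≡ M′δ′≡
         (s<M m (ℕ.m+n≤o⇒m≤o N₁ N₁₂≤m))
         (t′<M′ n (ℕ.m+n≤o⇒n≤o N₁ N₁₂≤n))
         (p m n (ℕ.m+n≤o⇒m≤o N₃ N₃₄≤m) (ℕ.m+n≤o⇒m≤o N₃ N₃₄≤n))
         (q m n (ℕ.m+n≤o⇒n≤o N₃ N₃₄≤m) (ℕ.m+n≤o⇒n≤o N₃ N₃₄≤n))

record ℝ : Set where
  no-eta-equality
  field
    seq    : ℕ → ℚ
    cauchy : seq ∼ seq

open ℝ public

infix 4 _≈ᴿ_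

record _≈ᴿ_ (x y : ℝ) : Set where
  constructor mk
  field same-limit : seq x ∼ seq y

open _≈ᴿ_ public

fromℚᴿ : ℚ → ℝ
fromℚᴿ q .seq _  = q
fromℚᴿ q .cauchy = ∼-const q

infixl 6 _+ᴿ_
infixl 7 _*ᴿ_
infix  8 -ᴿ_

_+ᴿ_ _*ᴿ_ : ℝ → ℝ → ℝ
(x +ᴿ y) .seq n  = seq x n ℚ.+ seq y n
(x +ᴿ y) .cauchy = ∼-+ (cauchy x) (cauchy y)
(x *ᴿ y) .seq n  = seq x n ℚ.* seq y n
(x *ᴿ y) .cauchy = ∼-* (cauchy x) (cauchy y)

-ᴿ_ : ℝ → ℝ
(-ᴿ x) .seq n  = ℚ.- seq x n
(-ᴿ x) .cauchy = ∼-neg (cauchy x)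

≈ᴿ-pointwise : ∀ {x y} → seq x ≗ seq y → x ≈ᴿ y
≈ᴿ-pointwise {x} p = mk (∼-resp-≗ (cauchy x) p)

ℝ-commutativeRing : CommutativeRing 0ℓ 0ℓ
ℝ-commutativeRing = record
  { Carrier = ℝ
  ; _≈_ = _≈ᴿ_
  ; _+_ = _+ᴿ_
  ; _*_ = _*ᴿ_
  ; -_  = -ᴿ_
  ; 0#  = fromℚᴿ 0ℚ
  ; 1#  = fromℚᴿ 1ℚ
  ; isCommutativeRing = record
    { isRing = record
      { +-isAbelianGroup = record
        { isGroup = record
          { isMonoid = record
            { isSemigroup = record
              { isMagma = record
                { isEquivalence = record
                  { refl  = λ {x} → mk (cauchy x)
                  ; sym   = λ p → mk (∼-sym (same-limit p))
                  ; trans = λ p q → mk (∼-trans (same-limit p) (same-limit q))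
                  }
                ; ∙-cong = λ p q → mk (∼-+ (same-limit p) (same-limit q))
                }
              ; assoc = λ x y z → ≈ᴿ-pointwise λ n → ℚ.+-assoc (seq x n) (seq y n) (seq z n)
              }
            ; identity = (λ x → ≈ᴿ-pointwise λ n → ℚ.+-identityˡ (seq x n))
                       , (λ x → ≈ᴿ-pointwise λ n → ℚ.+-identityʳ (seq x n))
            }
          ; inverse = (λ x → ≈ᴿ-pointwise λ n → ℚ.+-inverseˡ (seq x n))
                    , (λ x → ≈ᴿ-pointwise λ n → ℚ.+-inverseʳ (seq x n))
          ; ⁻¹-cong = λ p → mk (∼-neg (same-limit p))
          }
        ; comm = λ x y → ≈ᴿ-pointwise λ n → ℚ.+-comm (seq x n) (seq y n)
        }
      ; *-cong = λ p q → mk (∼-* (same-limit p) (same-limit q))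
      ; *-assoc = λ x y z → ≈ᴿ-pointwise λ n → ℚ.*-assoc (seq x n) (seq y n) (seq z n)
      ; *-identity = (λ x → ≈ᴿ-pointwise λ n → ℚ.*-identityˡ (seq x n))
                   , (λ x → ≈ᴿ-pointwise λ n → ℚ.*-identityʳ (seq x n))
      ; distrib = (λ x y z → ≈ᴿ-pointwise λ n → ℚ.*-distribˡ-+ (seq x n) (seq y n) (seq z n))
                , (λ x y z → ≈ᴿ-pointwise λ n → ℚ.*-distribʳ-+ (seq x n) (seq y n) (seq z n))
      }
    ; *-comm = λ x y → ≈ᴿ-pointwise λ n → ℚ.*-comm (seq x n) (seq y n)
    }
  }

record ℂ : Set where
  no-eta-equality
  field re im : ℝ

open ℂ public

infix 4 _≈_

record _≈_ (z w : ℂ) : Set where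
  constructor _,_
  field
    re-≈ : re z ≈ᴿ re w
    im-≈ : im z ≈ᴿ im w

open _≈_ public

fromℚ : ℚ → ℂ
fromℚ q .re = fromℚᴿ q
fromℚ q .im = fromℚᴿ 0ℚ

fromℕ : ℕ → ℂ
fromℕ n = fromℚ (fromℤ (+ n))

𝐢 : ℂ
𝐢 .re = fromℚᴿ 0ℚ
𝐢 .im = fromℚᴿ 1ℚ

infixl 6 _+_
infixl 7 _*_
infix  8 -_

_+_ _*_ : ℂ → ℂ → ℂ
(z + w) .re = re z +ᴿ re w
(z + w) .im = im z +ᴿ im w
(z * w) .re = re z *ᴿ re w +ᴿ -ᴿ (im z *ᴿ im w)
(z * w) .im = re z *ᴿ im w +ᴿ im z *ᴿ re w

-_ : ℂ → ℂ
(- z) .re = -ᴿ re z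
(- z) .im = -ᴿ im z

private
  open +-*-Solver

  assoc-re : ∀ a b c d e f →
    (a ℚ.* c ℚ.+ ℚ.- (b ℚ.* d)) ℚ.* e ℚ.+ ℚ.- ((a ℚ.* d ℚ.+ b ℚ.* c) ℚ.* f)
      ≡ a ℚ.* (c ℚ.* e ℚ.+ ℚ.- (d ℚ.* f)) ℚ.+ ℚ.- (b ℚ.* (c ℚ.* f ℚ.+ d ℚ.* e))
  assoc-re = solve 6 (λ a b c d e f →
    (a :* c :+ :- (b :* d)) :* e :+ :- ((a :* d :+ b :* c) :* f)
      := a :* (c :* e :+ :- (d :* f)) :+ :- (b :* (c :* f :+ d :* e))) refl

  assoc-im : ∀ a b c d e f →
    (a ℚ.* c ℚ.+ ℚ.- (b ℚ.* d)) ℚ.* f ℚ.+ (a ℚ.* d ℚ.+ b ℚ.* c) ℚ.* e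
      ≡ a ℚ.* (c ℚ.* f ℚ.+ d ℚ.* e) ℚ.+ b ℚ.* (c ℚ.* e ℚ.+ ℚ.- (d ℚ.* f))
  assoc-im = solve 6 (λ a b c d e f →
    (a :* c :+ :- (b :* d)) :* f :+ (a :* d :+ b :* c) :* e
      := a :* (c :* f :+ d :* e) :+ b :* (c :* e :+ :- (d :* f))) refl

  distrib-re : ∀ a b c d e f →
    a ℚ.* (c ℚ.+ e) ℚ.+ ℚ.- (b ℚ.* (d ℚ.+ f))
      ≡ (a ℚ.* c ℚ.+ ℚ.- (b ℚ.* d)) ℚ.+ (a ℚ.* e ℚ.+ ℚ.- (b ℚ.* f))
  distrib-re = solve 6 (λ a b c d e f →
    a :* (c :+ e) :+ :- (b :* (d :+ f)) := (a :* c :+ :- (b :* d)) :+ (a :* e :+ :- (b :* f))) refl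

  distrib-im : ∀ a b c d e f →
    a ℚ.* (d ℚ.+ f) ℚ.+ b ℚ.* (c ℚ.+ e)
      ≡ (a ℚ.* d ℚ.+ b ℚ.* c) ℚ.+ (a ℚ.* f ℚ.+ b ℚ.* e)
  distrib-im = solve 6 (λ a b c d e f →
    a :* (d :+ f) :+ b :* (c :+ e) := (a :* d :+ b :* c) :+ (a :* f :+ b :* e)) refl

  comm-re : ∀ a b c d → a ℚ.* c ℚ.+ ℚ.- (b ℚ.* d) ≡ c ℚ.* a ℚ.+ ℚ.- (d ℚ.* b)
  comm-re = solve 4 (λ a b c d → a :* c :+ :- (b :* d) := c :* a :+ :- (d :* b)) refl

  comm-im : ∀ a b c d → a ℚ.* d ℚ.+ b ℚ.* c ≡ c ℚ.* b ℚ.+ d ℚ.* a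
  comm-im = solve 4 (λ a b c d → a :* d :+ b :* c := c :* b :+ d :* a) refl

  identity-re : ∀ a b → 1ℚ ℚ.* a ℚ.+ ℚ.- (0ℚ ℚ.* b) ≡ a
  identity-re = solve 2 (λ a b → con 1ℚ :* a :+ :- (con 0ℚ :* b) := a) refl

  identity-im : ∀ a b → 1ℚ ℚ.* b ℚ.+ 0ℚ ℚ.* a ≡ b
  identity-im = solve 2 (λ a b → con 1ℚ :* b :+ con 0ℚ :* a := b) refl

  module R = CommutativeRing ℝ-commutativeRing

  *-comm : ∀ z w → z * w ≈ w * z
  *-comm z w =
    ≈ᴿ-pointwise (λ n → comm-re (seq (re z) n) (seq (im z) n) (seq (re w) n) (seq (im w) n)) ,
    ≈ᴿ-pointwise (λ n → comm-im (seq (re z) n) (seq (im z) n) (seq (re w) n) (seq (im w) n))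

  *-identityˡ : ∀ z → fromℚ 1ℚ * z ≈ z
  *-identityˡ z =
    ≈ᴿ-pointwise (λ n → identity-re (seq (re z) n) (seq (im z) n)) ,
    ≈ᴿ-pointwise (λ n → identity-im (seq (re z) n) (seq (im z) n))

  *-assoc : ∀ z w v → (z * w) * v ≈ z * (w * v)
  *-assoc z w v =
    ≈ᴿ-pointwise (λ n → assoc-re (seq (re z) n) (seq (im z) n) (seq (re w) n) (seq (im w) n)
      (seq (re v) n) (seq (im v) n)) ,
    ≈ᴿ-pointwise (λ n → assoc-im (seq (re z) n) (seq (im z) n) (seq (re w) n) (seq (im w) n)
      (seq (re v) n) (seq (im v) n))

  *-distribˡ-+ : ∀ z w v → z * (w + v) ≈ z * w + z * v
  *-distribˡ-+ z w v =
    ≈ᴿ-pointwise (λ n → distrib-re (seq (re z) n) (seq (im z) n) (seq (re w) n) (seq (im w) n)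
      (seq (re v) n) (seq (im v) n)) ,
    ≈ᴿ-pointwise (λ n → distrib-im (seq (re z) n) (seq (im z) n) (seq (re w) n) (seq (im w) n)
      (seq (re v) n) (seq (im v) n))

  ≈-trans : ∀ {z w v} → z ≈ w → w ≈ v → z ≈ v
  ≈-trans (p , p′) (q , q′) = R.trans p q , R.trans p′ q′

  +-cong : ∀ {z z′ w w′} → z ≈ z′ → w ≈ w′ → z + w ≈ z′ + w′
  +-cong (p , p′) (q , q′) = R.+-cong p q , R.+-cong p′ q′

  *-cong : ∀ {z z′ w w′} → z ≈ z′ → w ≈ w′ → z * w ≈ z′ * w′
  *-cong (p , p′) (q , q′) =
    R.+-cong (R.*-cong p q) (R.-‿cong (R.*-cong p′ q′)) ,
    R.+-cong (R.*-cong p q′) (R.*-cong p′ q)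

ℂ-commutativeRing : CommutativeRing 0ℓ 0ℓ
ℂ-commutativeRing = record
  { Carrier = ℂ
  ; _≈_ = _≈_
  ; _+_ = _+_
  ; _*_ = _*_
  ; -_  = -_
  ; 0#  = fromℚ 0ℚ
  ; 1#  = fromℚ 1ℚ
  ; isCommutativeRing = record
    { isRing = record
      { +-isAbelianGroup = record
        { isGroup = record
          { isMonoid = record
            { isSemigroup = record
              { isMagma = record
                { isEquivalence = record
                  { refl  = R.refl , R.refl
                  ; sym   = λ (p , p′) → R.sym p , R.sym p′
                  ; trans = ≈-trans
                  }
                ; ∙-cong = +-cong
                }
              ; assoc = λ z w v → R.+-assoc (re z) (re w) (re v) , R.+-assoc (im z) (im w) (im v)
              }
            ; identity = (λ z → R.+-identityˡ (re z) , R.+-identityˡ (im z))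
                       , (λ z → R.+-identityʳ (re z) , R.+-identityʳ (im z))
            }
          ; inverse = (λ z → R.-‿inverseˡ (re z) , R.-‿inverseˡ (im z))
                    , (λ z → R.-‿inverseʳ (re z) , R.-‿inverseʳ (im z))
          ; ⁻¹-cong = λ (p , p′) → R.-‿cong p , R.-‿cong p′
          }
        ; comm = λ z w → R.+-comm (re z) (re w) , R.+-comm (im z) (im w)
        }
      ; *-cong = *-cong
      ; *-assoc = *-assoc
      ; *-identity = *-identityˡ , λ z → ≈-trans (*-comm z (fromℚ 1ℚ)) (*-identityˡ z)
      ; distrib = *-distribˡ-+ , λ z w v → ≈-trans (*-comm (w + v) z)
          (≈-trans (*-distribˡ-+ z w v) (+-cong (*-comm z w) (*-comm z v)))
      }
    ; *-comm = *-comm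
    }
  }

open MonoidSum (CommutativeRing.+-monoid ℂ-commutativeRing) public using (sum)

private
  variable
    D n : ℕ

X : ℕ → Set
X D = Vec (Fin 2) D

𝟎 : X D
𝟎 = replicate _ 0F

#differences : X D → X D → ℕ
#differences []      []      = 0
#differences (a ∷ y) (b ∷ z) =
  (if does (a Fin.≟ b) then 0 else 1) ℕ.+ #differences y z

Adjacent : X D → X D → Set
Adjacent y z = #differences y z ≡ 1

data Walk {D} : X D → X D → ℕ → Set where
  []  : ∀ {y} → Walk y y 0
  _∷_ : ∀ {y z w n} → Adjacent y z → Walk z w n → Walk y w (suc n)

IsDistance : X D → X D → ℕ → Set
IsDistance y z n = Walk y z n × (∀ {m} → Walk y z m → n ℕ.≤ m)

private
  #differences-refl : (y : X D) → #differences y y ≡ 0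
  #differences-refl []       = refl
  #differences-refl (0F ∷ y) = #differences-refl y
  #differences-refl (1F ∷ y) = #differences-refl y

  #differences-triangle : (y z w : X D) →
    #differences y w ℕ.≤ #differences y z ℕ.+ #differences z w
  #differences-triangle []       []       []       = ℕ.z≤n
  #differences-triangle (a ∷ y) (b ∷ z) (c ∷ w) = step a b c (#differences-triangle y z w)
    where
    step : ∀ (a b c : Fin 2) {k l m} → m ℕ.≤ k ℕ.+ l →
      (if does (a Fin.≟ c) then 0 else 1) ℕ.+ m ℕ.≤
      ((if does (a Fin.≟ b) then 0 else 1) ℕ.+ k) ℕ.+ ((if does (b Fin.≟ c) then 0 else 1) ℕ.+ l)
    step 0F 0F 0F p = p
    step 1F 1F 1F p = p
    step 0F 1F 1F p = ℕ.s≤s p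
    step 1F 0F 0F p = ℕ.s≤s p
    step 0F 0F 1F {k} {l} {m} p = subst (suc m ℕ.≤_) (sym (ℕ.+-suc k l)) (ℕ.s≤s p)
    step 1F 1F 0F {k} {l} {m} p = subst (suc m ℕ.≤_) (sym (ℕ.+-suc k l)) (ℕ.s≤s p)
    step 0F 1F 0F {k} {l} p = ℕ.m≤n⇒m≤1+n (ℕ.≤-trans p (ℕ.+-monoʳ-≤ k (ℕ.n≤1+n l)))
    step 1F 0F 1F {k} {l} p = ℕ.m≤n⇒m≤1+n (ℕ.≤-trans p (ℕ.+-monoʳ-≤ k (ℕ.n≤1+n l)))

  prepend : ∀ (a : Fin 2) {y z : X D} {n} → Walk y z n → Walk (a ∷ y) (a ∷ z) n
  prepend a  []      = []
  prepend 0F (p ∷ w) = p ∷ prepend 0F w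
  prepend 1F (p ∷ w) = p ∷ prepend 1F w

  shortest : (y z : X D) → Walk y z (#differences y z)
  shortest []       []       = []
  shortest (0F ∷ y) (0F ∷ z) = prepend 0F (shortest y z)
  shortest (1F ∷ y) (1F ∷ z) = prepend 1F (shortest y z)
  shortest (0F ∷ y) (1F ∷ z) = cong suc (#differences-refl y) ∷ prepend 1F (shortest y z)
  shortest (1F ∷ y) (0F ∷ z) = cong suc (#differences-refl y) ∷ prepend 0F (shortest y z)

  minimal : ∀ {y z : X D} {m} → Walk y z m → #differences y z ℕ.≤ m
  minimal {y = y} [] = ℕ.≤-reflexive (#differences-refl y)
  minimal {y = y} (_∷_ {z = z} {w = w} {n = n} p q) = ℕ.≤-trans (#differences-triangle y z w)
    (subst (λ k → k ℕ.+ #differences z w ℕ.≤ suc n) (sym p) (ℕ.s≤s (minimal q)))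

distance : (y z : X D) → ∃ (IsDistance y z)
distance y z = #differences y z , shortest y z , minimal

∂ : X D → X D → ℕ
∂ y z = proj₁ (distance y z)

V : ℕ → Set
V D = X D → ℂ

Mat : ℕ → Set
Mat D = X D → X D → ℂ

infix 4 _≈ᵥ_ _≈ₘ_

_≈ᵥ_ : V D → V D → Set
v ≈ᵥ w = ∀ y → v y ≈ w y

_≈ₘ_ : Mat D → Mat D → Set
M ≈ₘ N = ∀ y z → M y z ≈ N y z

∑ˣ : (X D → ℂ) → ℂ
∑ˣ {zero}  f = f []
∑ˣ {suc D} f = sum (λ a → ∑ˣ (λ y → f (a ∷ y)))

infixl 6 _+ᵥ_ _+ₘ_ _-ₘ_
infixl 7 _*ₘ_
infixr 7 _∙ᵥ_ _∙ₘ_ _⊛_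

0ᵥ : V D
0ᵥ _ = fromℕ 0

_+ᵥ_ : V D → V D → V D
(v +ᵥ w) y = v y + w y

_∙ᵥ_ : ℂ → V D → V D
(c ∙ᵥ v) y = c * v y

_+ₘ_ _-ₘ_ _*ₘ_ : Mat D → Mat D → Mat D
(M +ₘ N) y z = M y z + N y z
(M -ₘ N) y z = M y z + - N y z
(M *ₘ N) y z = ∑ˣ (λ x → M y x * N x z)

_∙ₘ_ : ℂ → Mat D → Mat D
(c ∙ₘ M) y z = c * M y z

_⊛_ : Mat D → V D → V D
(M ⊛ v) y = ∑ˣ (λ z → M y z * v z)

diagonal : (X D → ℂ) → Mat D
diagonal f y z = if does (Vec.≡-dec Fin._≟_ y z) then f y else fromℕ 0

I : Mat D
I = diagonal (λ _ → fromℕ 1)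

∏ : List (Mat D) → Mat D
∏ = List.foldr _*ₘ_ I

-- The D-th Kronecker power: (M ^⊗) y z = ∏ₖ M yₖ zₖ.
_^⊗ : (Fin 2 → Fin 2 → ℂ) → Mat D
(M ^⊗) []      []      = fromℕ 1
(M ^⊗) (a ∷ y) (b ∷ z) = M a b * (M ^⊗) y z

A : Mat D
A y z = if does (#differences y z ℕ.≟ 1) then fromℕ 1 else fromℕ 0

A* : Mat D
A* {D} = diagonal (λ y → fromℚ (fromℤ (D ⊖ 2 ℕ.* ∂ 𝟎 y)))

Aᵋ : Mat D
Aᵋ = (- 𝐢 * fromℚ ½) ∙ₘ (A *ₘ A* -ₘ A* *ₘ A)

data GeneratedBy (S : Pred (Mat D) 0ℓ) : Pred (Mat D) 0ℓ where
  generator : ∀ {M} → M ∈ S → M ∈ GeneratedBy S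
  unit      : I ∈ GeneratedBy S
  sums      : ∀ {M N} → M ∈ GeneratedBy S → N ∈ GeneratedBy S → M +ₘ N ∈ GeneratedBy S
  products  : ∀ {M N} → M ∈ GeneratedBy S → N ∈ GeneratedBy S → M *ₘ N ∈ GeneratedBy S
  multiples : ∀ c {M} → M ∈ GeneratedBy S → c ∙ₘ M ∈ GeneratedBy S
  congruent : ∀ {M N} → M ≈ₘ N → M ∈ GeneratedBy S → N ∈ GeneratedBy S

T : Pred (Mat D) 0ℓ
T = GeneratedBy (λ M → M ≡ A ⊎ M ≡ A*)

θ : ℕ → ℕ → ℚ
θ D i = fromℤ (D ⊖ 2 ℕ.* i)

θ-injective : ∀ D i j → θ D i ≡ θ D j → i ≡ j
θ-injective D i j θi≡θj = ℕ.*-cancelˡ-≡ i j 2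
  (ℤ.+-injective (ℤ.neg-injective (∙-cancelˡ (+ D) (ℤ.- + (2 ℕ.* i)) (ℤ.- + (2 ℕ.* j))
    (trans (ℤ.m-n≡m⊖n D (2 ℕ.* i))
      (trans (cong ℚ.numerator θi≡θj) (sym (ℤ.m-n≡m⊖n D (2 ℕ.* j))))))))
  where open GroupProperties (AbelianGroup.group ℤ.+-0-abelianGroup)

θ-nonZero : ∀ D i j → i ≢ j → ℚ.NonZero (θ D i ℚ.- θ D j)
θ-nonZero D i j i≢j = ℚ.≢-nonZero λ θi-θj≡0 →
  i≢j (θ-injective D i j (x∙y⁻¹≈ε⇒x≈y (θ D i) (θ D j) θi-θj≡0))
  where open GroupProperties ℚ.+-0-group

-- (A - θⱼ I) / (θᵢ - θⱼ); the factor j = i, absent from the product, is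
-- replaced by I.
lagrangeFactor : ℕ → ℕ → Mat D
lagrangeFactor {D} i j with i ℕ.≟ j
... | yes _  = I
... | no i≢j =
  fromℚ ((ℚ.1/ (θ D i ℚ.- θ D j)) {{θ-nonZero D i j i≢j}}) ∙ₘ (A -ₘ fromℚ (θ D j) ∙ₘ I)

E : ℕ → Mat D
E {D} i = ∏ (List.map (lagrangeFactor i) (upTo (suc D)))

E* : ℕ → Mat D
E* i = diagonal (λ y → if does (∂ 𝟎 y ℕ.≟ i) then fromℕ 1 else fromℕ 0)

P₁ P₁⁻¹ : Fin 2 → Fin 2 → ℂ
P₁ 0F 0F = fromℕ 1
P₁ 0F 1F = fromℕ 1
P₁ 1F 0F = - 𝐢
P₁ 1F 1F = 𝐢
P₁⁻¹ 0F 0F = fromℚ ½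
P₁⁻¹ 0F 1F = fromℚ ½ * 𝐢
P₁⁻¹ 1F 0F = fromℚ ½
P₁⁻¹ 1F 1F = fromℚ ½ * - 𝐢

P P⁻¹ : Mat D
P   = P₁ ^⊗
P⁻¹ = P₁⁻¹ ^⊗

private
  module C = CommutativeRing ℂ-commutativeRing
  open import Algebra.Properties.CommutativeSemigroup C.*-commutativeSemigroup using (interchange)
  open import Relation.Binary.Reasoning.Setoid C.setoid

  ∑ˣ-cong : {f g : X D → ℂ} → (∀ y → f y ≈ g y) → ∑ˣ f ≈ ∑ˣ g
  ∑ˣ-cong {zero}  p = p []
  ∑ˣ-cong {suc D} p = C.+-cong (∑ˣ-cong (λ y → p (0F ∷ y)))
    (C.+-congʳ (∑ˣ-cong (λ y → p (1F ∷ y))))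

  ∑ˣ-distribˡ : ∀ c (f : X D → ℂ) → ∑ˣ (λ y → c * f y) ≈ c * ∑ˣ f
  ∑ˣ-distribˡ {zero}  c f = C.refl
  ∑ˣ-distribˡ {suc D} c f = begin
    ∑ˣ (λ y → c * f (0F ∷ y)) + (∑ˣ (λ y → c * f (1F ∷ y)) + C.0#)
      ≈⟨ C.+-cong (∑ˣ-distribˡ c (λ y → f (0F ∷ y)))
           (C.+-cong (∑ˣ-distribˡ c (λ y → f (1F ∷ y))) (C.sym (C.zeroʳ c))) ⟩
    c * f₀ + (c * f₁ + c * C.0#)  ≈⟨ C.+-congˡ (C.distribˡ c f₁ C.0#) ⟨
    c * f₀ + c * (f₁ + C.0#)      ≈⟨ C.distribˡ c f₀ (f₁ + C.0#) ⟨
    c * (f₀ + (f₁ + C.0#))        ∎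
    where
    f₀ = ∑ˣ (λ y → f (0F ∷ y))
    f₁ = ∑ˣ (λ y → f (1F ∷ y))

  -- If M N is the 2 × 2 identity matrix, then so is the product of powers.
  ⊗-inverse : ∀ (M N : Fin 2 → Fin 2 → ℂ) →
    (∀ a b → M a 0F * N 0F b + (M a 1F * N 1F b + C.0#)
               ≈ (if does (a Fin.≟ b) then C.1# else C.0#)) →
    (M ^⊗) *ₘ (N ^⊗) ≈ₘ I {D}
  ⊗-inverse M N MN≈I []      []      = C.*-identityˡ C.1#
  ⊗-inverse M N MN≈I (a ∷ y) (b ∷ z) = begin
    t 0F + (t 1F + C.0#)
      ≈⟨ C.+-cong (t≈ 0F) (C.+-cong (t≈ 1F) (C.sym (C.zeroˡ q))) ⟩
    M a 0F * N 0F b * q + (M a 1F * N 1F b * q + C.0# * q)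
      ≈⟨ C.+-congˡ (C.distribʳ q (M a 1F * N 1F b) C.0#) ⟨
    M a 0F * N 0F b * q + (M a 1F * N 1F b + C.0#) * q
      ≈⟨ C.distribʳ q (M a 0F * N 0F b) (M a 1F * N 1F b + C.0#) ⟨
    (M a 0F * N 0F b + (M a 1F * N 1F b + C.0#)) * q
      ≈⟨ C.*-cong (MN≈I a b) (⊗-inverse M N MN≈I y z) ⟩
    (if does (a Fin.≟ b) then C.1# else C.0#) * I y z
      ≈⟨ I-∷ a b ⟩
    I (a ∷ y) (b ∷ z) ∎
    where
    q = ((M ^⊗) *ₘ (N ^⊗)) y z
    t : Fin 2 → ℂ
    t c = ∑ˣ (λ x → M a c * (M ^⊗) y x * (N c b * (N ^⊗) x z))
    t≈ : ∀ c → t c ≈ M a c * N c b * q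
    t≈ c = C.trans (∑ˣ-cong (λ x → interchange (M a c) ((M ^⊗) y x) (N c b) ((N ^⊗) x z)))
      (∑ˣ-distribˡ (M a c * N c b) (λ x → (M ^⊗) y x * (N ^⊗) x z))
    I-∷ : ∀ a b → (if does (a Fin.≟ b) then C.1# else C.0#) * I y z ≈ I (a ∷ y) (b ∷ z)
    I-∷ 0F 0F = C.*-identityˡ (I y z)
    I-∷ 1F 1F = C.*-identityˡ (I y z)
    I-∷ 0F 1F = C.zeroˡ (I y z)
    I-∷ 1F 0F = C.zeroˡ (I y z)

P-inverseʳ : P *ₘ P⁻¹ ≈ₘ I {D}
P-inverseʳ = ⊗-inverse P₁ P₁⁻¹ λ where
  0F 0F → ≈ᴿ-pointwise (λ _ → refl) , ≈ᴿ-pointwise (λ _ → refl)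
  0F 1F → ≈ᴿ-pointwise (λ _ → refl) , ≈ᴿ-pointwise (λ _ → refl)
  1F 0F → ≈ᴿ-pointwise (λ _ → refl) , ≈ᴿ-pointwise (λ _ → refl)
  1F 1F → ≈ᴿ-pointwise (λ _ → refl) , ≈ᴿ-pointwise (λ _ → refl)

P-inverseˡ : P⁻¹ *ₘ P ≈ₘ I {D}
P-inverseˡ = ⊗-inverse P₁⁻¹ P₁ λ where
  0F 0F → ≈ᴿ-pointwise (λ _ → refl) , ≈ᴿ-pointwise (λ _ → refl)
  0F 1F → ≈ᴿ-pointwise (λ _ → refl) , ≈ᴿ-pointwise (λ _ → refl)
  1F 0F → ≈ᴿ-pointwise (λ _ → refl) , ≈ᴿ-pointwise (λ _ → refl)
  1F 1F → ≈ᴿ-pointwise (λ _ → refl) , ≈ᴿ-pointwise (λ _ → refl)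

Eᵋ : ℕ → Mat D
Eᵋ i = P⁻¹ *ₘ E i *ₘ P

NonZero : Pred (V D) 0ℓ → Set
NonZero W = ∃[ w ] w ∈ W × ¬ (w ≈ᵥ 0ᵥ)

infixr 7 _⟨_⟩

_⟨_⟩ : Mat D → Pred (V D) 0ℓ → Pred (V D) 0ℓ
(M ⟨ W ⟩) v = ∃[ w ] w ∈ W × v ≈ᵥ M ⊛ w

record IsSubspace (W : Pred (V D) 0ℓ) : Set where
  field
    respects     : ∀ {v w} → v ≈ᵥ w → v ∈ W → w ∈ W
    0ᵥ-closed    : 0ᵥ ∈ W
    +ᵥ-closed    : ∀ {v w} → v ∈ W → w ∈ W → v +ᵥ w ∈ W
    ∙ᵥ-closed    : ∀ c {v} → v ∈ W → c ∙ᵥ v ∈ W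

record IsTModule (W : Pred (V D) 0ℓ) : Set where
  field
    isSubspace : IsSubspace W
    T-closed   : ∀ {M} → M ∈ T → ∀ {w} → w ∈ W → M ⊛ w ∈ W

-- Irreducibility is stated in the form "a nonzero submodule of W is W", which
-- unlike "a submodule of W is 0 or W" makes no undecidable choice.
record IsIrreducible (W : Pred (V D) 0ℓ) : Set₁ where
  field
    isTModule   : IsTModule W
    nonZero     : NonZero W
    irreducible : ∀ {U : Pred (V D) 0ℓ} → IsTModule U → U ⊆ W → NonZero U → W ⊆ U

record IsEndpoint {D} (W : Pred (V D) 0ℓ) (r : ℕ) : Set where
  field
    bound    : r ℕ.≤ D
    nonZero  : NonZero (E* r ⟨ W ⟩)
    smallest : ∀ {i} → i ℕ.≤ D → NonZero (E* i ⟨ W ⟩) → r ℕ.≤ i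

-- d + 1 is the number of i in {0, …, D} with E*ᵢ W ≠ 0.
IsDiameter : Pred (V D) 0ℓ → ℕ → Set
IsDiameter {D} W d = ∃[ S ]
  (∀ (i : Fin (suc D)) → i Subset.∈ S ⇔ NonZero (E* (toℕ i) ⟨ W ⟩)) × Subset.∣ S ∣ ≡ suc d

combination : (Fin n → ℂ) → (Fin n → V D) → V D
combination c v y = sum (λ i → c i * v i y)

record IsBasis (W : Pred (V D) 0ℓ) (v : Fin n → V D) : Set where
  field
    belongs     : ∀ i → v i ∈ W
    independent : ∀ c → combination c v ≈ᵥ 0ᵥ → ∀ i → c i ≈ fromℕ 0
    spanning    : ∀ {w} → w ∈ W → ∃[ c ] w ≈ᵥ combination c v

record Represents (W : Pred (V D) 0ℓ) (M : Fin n → Fin n → ℂ) (Y : Mat D)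
                  (v : Fin n → V D) : Set where
  field
    isBasis : IsBasis W v
    columns : ∀ j → Y ⊛ v j ≈ᵥ combination (λ i → M i j) v

B : ∀ d → Fin (suc d) → Fin (suc d) → ℂ
B d i j =
  if does (toℕ i ℕ.≟ suc (toℕ j)) then fromℕ (toℕ i)
  else if does (toℕ j ℕ.≟ suc (toℕ i)) then fromℕ (d ℕ.∸ toℕ i)
  else fromℕ 0

{-# OPTIONS --safe #-}

-- Let (X, Y, Z) be the triple (A, A*, Aᵋ) or one of its permutations. Then [X, Y] = 2sZ and
-- cyclically, where s = 𝐢 or s = - 𝐢, so R = (X + sZ)/2 and L = (X - sZ)/2 have sum X and shift
-- the Y-eigenvalue by -2 and 2. Let u ∈ W be an X-eigenvector for the eigenvalue D - 2r. No larger
-- X-eigenvalue occurs in W, so the X-raising operator (Y + sZ)/2 kills u, whence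
-- Ru = ((D - 2r)u - Yu)/2 and Lu = ((D - 2r)u + Yu)/2. Taking components with respect to the
-- idempotents Gₖ of Y gives
--   R Gₖu = (k + 1 - r) Gₖ₊₁u  and  L Gₖ₊₁u = (D - r - k) Gₖu.
-- Hence Gₖu ≠ 0 exactly for r ≤ k ≤ D - r, and these vectors span a submodule, which is W by
-- irreducibility. The endpoint of W is defined through A* only, so this is first applied with
-- X = A*, which shows that r is also the least eigenvalue index of A and of Aᵋ on W. The
-- symmetry between A, A* and Aᵋ is conjugation by P.
module Submission where

open import Defs
open import Algebra.Bundles using (CommutativeRing)
open import Algebra.Properties.Group using (x∙y⁻¹≈ε⇒x≈y)
import Algebra.Properties.Semiring.Sum as SemiringSum
import Algebra.Solver.Ring as RingSolver
open import Algebra.Solver.Ring.AlmostCommutativeRing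
  using (fromCommutativeRing; _-Raw-AlmostCommutative⟶_)
open import Data.Bool.Base using (if_then_else_)
open import Data.Fin.Base using (Fin; zero; suc; toℕ; fromℕ<)
open import Data.Fin.Patterns using (0F; 1F)
import Data.Fin.Properties as Fin
open import Data.Fin.Subset as Subset using (Subset; inside; outside; ∣_∣)
open import Data.Fin.Subset.Properties using (drop-there)
open import Data.Integer.Base as ℤ using (+_; _⊖_)
import Data.Integer.Properties as ℤ
open import Data.List.Base as List using (upTo; []; _∷_)
import Data.List.Membership.Propositional as List
open import Data.List.Membership.Propositional.Properties using (∈-upTo⁺)
import Data.List.Properties as List
open import Data.List.Relation.Unary.Any using (here; there)
open import Data.Maybe.Base using (map)
open import Data.Nat.Base as ℕ using (ℕ; zero; suc)
import Data.Nat.Properties as ℕ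
open import Data.Product.Base using (∃-syntax; _×_; _,_; proj₁; proj₂)
open import Data.Rational.Base as ℚ using (ℚ; 0ℚ; 1ℚ; ½)
open import Data.Rational.Literals using (fromℤ)
import Data.Rational.Properties as ℚ
open import Data.Rational.Solver using (module +-*-Solver)
import Data.Rational.Unnormalised.Base as ℚᵘ
import Data.Rational.Unnormalised.Properties as ℚᵘ
open import Data.Sum.Base using (inj₁; inj₂)
open import Data.Vec.Base using ([]; _∷_; here; there)
open import Function.Bundles using (Equivalence)
open import Level using (0ℓ)
open import Relation.Binary.Bundles using (Setoid)
open import Relation.Binary.Consequences using (dec⇒weaklyDec)
open import Relation.Binary.PropositionalEquality
  using (_≡_; _≢_; refl; sym; trans; cong; cong₂; subst; ≢-sym)
open import Relation.Nullary using (¬_; Dec; yes; no; does; contradiction)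
open import Relation.Nullary.Decidable using (dec-true; dec-false)
open import Relation.Unary using (Pred; _∈_; _⊆_)

-- Equality of complex numbers is not decidable here, and a number that is not 0 need not have an
-- inverse. So the argument divides only by explicit nonzero rationals, such as the ladder
-- coefficients. A general scalar is cancelled in one place, the proof of linear independence, where
-- the conclusion that a number is 0 is stable under double negation. The three families of
-- idempotents are defined in three ways: as polynomials in `A`, as diagonal matrices, and as
-- conjugates by `P`. Conjugation reduces their spectral properties to the diagonal case, but it
-- does not show that they preserve W, since `P` is not given as an element of `T`. For this each
-- family is also identified with the Lagrange polynomials of its own matrix. Operator identities
-- are equalities of actions on an arbitrary vector, so products become nested actions and need no
-- reassociation.

private
  module C = CommutativeRing ℂ-commutativeRing
  module ℝ-ring = CommutativeRing ℝ-commutativeRing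

  variable
    D n : ℕ

open import Algebra.Properties.CommutativeSemigroup C.*-commutativeSemigroup using (x∙yz≈y∙xz)
open SemiringSum C.semiring using (sum-cong-≋; sum-replicate-zero; ∑-distrib-+; *-distribˡ-sum)
open import Relation.Binary.Reasoning.Setoid C.setoid

-- Complex scalars

fromℚ-+ : ∀ p q → fromℚ (p ℚ.+ q) ≈ fromℚ p + fromℚ q
fromℚ-+ p q = ≈ᴿ-pointwise (λ _ → refl) , ≈ᴿ-pointwise (λ _ → sym (ℚ.+-identityʳ 0ℚ))

fromℚ-* : ∀ p q → fromℚ (p ℚ.* q) ≈ fromℚ p * fromℚ q
fromℚ-* p q = ≈ᴿ-pointwise (λ _ → re≡ p q) , ≈ᴿ-pointwise (λ _ → im≡ p q)
  where
  open +-*-Solver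
  re≡ : ∀ p q → p ℚ.* q ≡ p ℚ.* q ℚ.+ ℚ.- (0ℚ ℚ.* 0ℚ)
  re≡ = solve 2 (λ p q → p :* q := p :* q :+ :- (con 0ℚ :* con 0ℚ)) refl
  im≡ : ∀ p q → 0ℚ ≡ p ℚ.* 0ℚ ℚ.+ 0ℚ ℚ.* q
  im≡ = solve 2 (λ p q → con 0ℚ := p :* con 0ℚ :+ con 0ℚ :* q) refl

fromℚ-neg : ∀ p → fromℚ (ℚ.- p) ≈ - fromℚ p
fromℚ-neg p = ≈ᴿ-pointwise (λ _ → refl) , ≈ᴿ-pointwise (λ _ → refl)

fromℚ-morphism : CommutativeRing.rawRing ℚ.+-*-commutativeRing
  -Raw-AlmostCommutative⟶ fromCommutativeRing ℂ-commutativeRing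
fromℚ-morphism = record
  { ⟦_⟧    = fromℚ
  ; +-homo = fromℚ-+
  ; *-homo = fromℚ-*
  ; -‿homo = fromℚ-neg
  ; 0-homo = C.refl
  ; 1-homo = C.refl
  }

-- Coefficients are rational, so halves are constants of the solver. The numbers `𝐢` and `s` are
-- atoms to it, and the fact that their square is -1 has to be substituted between two calls.
module ℂ-Solver = RingSolver
  (CommutativeRing.rawRing ℚ.+-*-commutativeRing)
  (fromCommutativeRing ℂ-commutativeRing)
  fromℚ-morphism
  (λ p q → map (λ p≡q → C.reflexive (cong fromℚ p≡q)) (dec⇒weaklyDec ℚ._≟_ p q))

𝐢*𝐢 : 𝐢 * 𝐢 ≈ - fromℚ 1ℚ
𝐢*𝐢 = ≈ᴿ-pointwise (λ _ → refl) , ≈ᴿ-pointwise (λ _ → refl)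

-- Addition in ℚ reduces by a gcd, which is stuck on variables. Among the unnormalised rationals
-- both sides have denominator 1, and comparing them only removes factors 1.
fromℤ-+ : ∀ i j → fromℤ (i ℤ.+ j) ≡ fromℤ i ℚ.+ fromℤ j
fromℤ-+ i j = ℚ.toℚᵘ-injective (ℚᵘ.≃-trans
  (ℚᵘ.*≡* (cong (ℤ._* (+ 1)) (sym (cong₂ ℤ._+_ (ℤ.*-identityʳ i) (ℤ.*-identityʳ j)))))
  (ℚᵘ.≃-sym (ℚ.toℚᵘ-homo-+ (fromℤ i) (fromℤ j))))

fromℕ-+ : ∀ m n → fromℕ (m ℕ.+ n) ≈ fromℕ m + fromℕ n
fromℕ-+ m n = C.trans (C.reflexive (cong fromℚ (fromℤ-+ (+ m) (+ n)))) (fromℚ-+ _ _)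

fromℕ-suc : ∀ n → fromℕ (suc n) ≈ fromℚ 1ℚ + fromℕ n
fromℕ-suc = fromℕ-+ 1

fromℤ-neg : ∀ i → fromℤ (ℤ.- i) ≡ ℚ.- fromℤ i
fromℤ-neg (+ zero) = refl
fromℤ-neg (+ suc n) = refl
fromℤ-neg (ℤ.-[1+ n ]) = refl

fromℤ-⊖ : ∀ m n → fromℤ (m ⊖ n) ≡ fromℤ (+ m) ℚ.- fromℤ (+ n)
fromℤ-⊖ m n = trans (cong fromℤ (sym (ℤ.m-n≡m⊖n m n)))
  (trans (fromℤ-+ (+ m) (ℤ.- (+ n))) (cong (fromℤ (+ m) ℚ.+_) (fromℤ-neg (+ n))))

fromℕ-∸ : ∀ m n → n ℕ.≤ m → fromℕ (m ℕ.∸ n) ≈ fromℕ m + - fromℕ n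
fromℕ-∸ m n n≤m = begin
  fromℕ (m ℕ.∸ n) ≈⟨ solve 2 (λ a b → a := (a :+ b) :- b) C.refl (fromℕ (m ℕ.∸ n)) (fromℕ n) ⟩
  (fromℕ (m ℕ.∸ n) + fromℕ n) + - fromℕ n ≈⟨ C.+-congʳ (fromℕ-+ (m ℕ.∸ n) n) ⟨
  fromℕ (m ℕ.∸ n ℕ.+ n) + - fromℕ n ≡⟨ cong (λ k → fromℕ k + - fromℕ n) (ℕ.m∸n+n≡m n≤m) ⟩
  fromℕ m + - fromℕ n ∎
  where open ℂ-Solver

θ-expand : ∀ D k → fromℚ (θ D k) ≈ fromℕ D + - (fromℚ (fromℤ (+ 2)) * fromℕ k)
θ-expand D k = begin
  fromℚ (θ D k) ≡⟨ cong fromℚ (fromℤ-⊖ D (2 ℕ.* k)) ⟩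
  fromℚ (fromℤ (+ D) ℚ.- fromℤ (+ (2 ℕ.* k))) ≈⟨ fromℚ-+ _ _ ⟩
  fromℕ D + fromℚ (ℚ.- fromℤ (+ (2 ℕ.* k))) ≈⟨ C.+-congˡ (fromℚ-neg _) ⟩
  fromℕ D + - fromℕ (k ℕ.+ (k ℕ.+ 0))
    ≈⟨ C.+-congˡ (C.-‿cong (C.trans (fromℕ-+ k (k ℕ.+ 0)) (C.+-congˡ (fromℕ-+ k 0)))) ⟩
  fromℕ D + - (fromℕ k + (fromℕ k + fromℕ 0))
    ≈⟨ solve 2 (λ a b → a :- (b :+ (b :+ con 0ℚ))
        := a :- con (fromℤ (+ 2)) :* b) C.refl (fromℕ D) (fromℕ k) ⟩
  fromℕ D + - (fromℚ (fromℤ (+ 2)) * fromℕ k) ∎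
  where open ℂ-Solver

fromℚ-cancel : ∀ {q} → q ≢ 0ℚ → ∀ {z} → fromℚ q * z ≈ fromℕ 0 → z ≈ fromℕ 0
fromℚ-cancel {q} q≢0 {z} qz≈0 = begin
  z                              ≈⟨ C.*-identityˡ z ⟨
  fromℚ 1ℚ * z                   ≡⟨ cong (λ p → fromℚ p * z) (ℚ.*-inverseˡ q) ⟨
  fromℚ (ℚ.1/ q ℚ.* q) * z       ≈⟨ C.*-congʳ (fromℚ-* (ℚ.1/ q) q) ⟩
  fromℚ (ℚ.1/ q) * fromℚ q * z   ≈⟨ C.*-assoc _ _ _ ⟩
  fromℚ (ℚ.1/ q) * (fromℚ q * z) ≈⟨ C.*-congˡ qz≈0 ⟩
  fromℚ (ℚ.1/ q) * fromℕ 0       ≈⟨ C.zeroʳ _ ⟩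
  fromℕ 0                        ∎
  where instance _ = ℚ.≢-nonZero q≢0

fromℕ-cancel : ∀ {m n} → m ≢ n → ∀ {z} → (fromℕ m + - fromℕ n) * z ≈ fromℕ 0 → z ≈ fromℕ 0
fromℕ-cancel {m} {n} m≢n {z} p = fromℚ-cancel {q = fromℤ (+ m) ℚ.- fromℤ (+ n)}
  (λ e → m≢n (ℤ.+-injective
    (cong ℚ.numerator (x∙y⁻¹≈ε⇒x≈y ℚ.+-0-group (fromℤ (+ m)) (fromℤ (+ n)) e))))
  (C.trans (C.*-congʳ (C.trans (fromℚ-+ _ _) (C.+-congˡ (fromℚ-neg _)))) p)

-- Without Markov's principle ¬ (x ≈ᴿ 0ᴿ) does not make x invertible, but x ≈ᴿ 0ᴿ is the
-- negation of Apart x. This makes equality with 0 stable under double negation.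
Apart : ℝ → Set
Apart x = ∃[ ε ] 0ℚ ℚ.< ε × ∃[ N ] ∀ n → N ℕ.≤ n → ε ℚ.≤ ℚ.∣ seq x n ∣

0ᴿ : ℝ
0ᴿ = fromℚᴿ 0ℚ

private
  q-0 : ∀ q → q ℚ.- 0ℚ ≡ q
  q-0 = ℚ.+-identityʳ

  half< : ∀ {ε} → 0ℚ ℚ.< ε → 0ℚ ℚ.< ½ ℚ.* ε
  half< {ε} ε>0 = ℚ.positive⁻¹ (½ ℚ.* ε) {{ℚ.pos*pos⇒pos ½ ε {{ℚ.positive ε>0}}}}

-- Choose N so that the tail varies by less than ε/2. A term of the tail with absolute value at
-- least ε would keep the whole tail at ε/2 or more, making `x` apart from 0. Comparison of
-- rationals is decidable, so each term is below ε.
¬apart⇒≈0 : ∀ {x} → ¬ Apart x → x ≈ᴿ 0ᴿ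
¬apart⇒≈0 {x} ¬ap = mk (close λ ε ε>0 → go ε ε>0)
  where
  half+half : ∀ ε → ½ ℚ.* ε ℚ.+ ½ ℚ.* ε ≡ ε
  half+half = solve 1 (λ ε → con ½ :* ε :+ con ½ :* ε := ε) refl
    where open +-*-Solver
  split : ∀ a b → (a ℚ.- b) ℚ.+ b ≡ a
  split = solve 2 (λ a b → (a :- b) :+ b := a) refl
    where open +-*-Solver
  go : ∀ ε → 0ℚ ℚ.< ε → ∃[ N ] ∀ m n → N ℕ.≤ m → N ℕ.≤ n → ℚ.∣ seq x m ℚ.- 0ℚ ∣ ℚ.< ε
  go ε ε>0 = let N , p = modulus (cauchy x) δ (half< ε>0) in N , λ m _ N≤m _ → small N p m N≤m
    where
    δ = ½ ℚ.* ε
    small : ∀ N → (∀ m n → N ℕ.≤ m → N ℕ.≤ n → ℚ.∣ seq x m ℚ.- seq x n ∣ ℚ.< δ) →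
            ∀ m → N ℕ.≤ m → ℚ.∣ seq x m ℚ.- 0ℚ ∣ ℚ.< ε
    small N p m N≤m with ℚ.∣ seq x m ∣ ℚ.<? ε
    ... | yes lt = subst (λ z → ℚ.∣ z ∣ ℚ.< ε) (sym (q-0 (seq x m))) lt
    ... | no ≮ε = contradiction (δ , half< ε>0 , N , λ n N≤n → ℚ.≮⇒≥ λ lt → ≮ε
      (ℚ.≤-<-trans
        (subst (λ z → ℚ.∣ z ∣ ℚ.≤ ℚ.∣ seq x m ℚ.- seq x n ∣ ℚ.+ ℚ.∣ seq x n ∣)
          (split (seq x m) (seq x n))
          (ℚ.∣p+q∣≤∣p∣+∣q∣ (seq x m ℚ.- seq x n) (seq x n)))
        (subst (ℚ.∣ seq x m ℚ.- seq x n ∣ ℚ.+ ℚ.∣ seq x n ∣ ℚ.<_) (half+half ε)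
          (ℚ.+-mono-< (p m n N≤m N≤n) lt)))) ¬ap

apart⇒≉0 : ∀ {x} → Apart x → ¬ (x ≈ᴿ 0ᴿ)
apart⇒≉0 {x} (ε , ε>0 , N , ε≤) (mk (close x∼0)) =
  let M , p = x∼0 ε ε>0
      n = N ℕ.+ M
      M≤n = ℕ.m≤n+m M N
  in ℚ.<-irrefl refl (ℚ.<-≤-trans (subst (λ z → ℚ.∣ z ∣ ℚ.< ε) (q-0 (seq x n)) (p n n M≤n M≤n))
    (ε≤ n (ℕ.m≤m+n N M)))

apart-* : ∀ x y → Apart x → Apart y → Apart (x *ᴿ y)
apart-* x y (ε , ε>0 , N , ε≤) (δ , δ>0 , M , δ≤) =
  ε ℚ.* δ , ℚ.positive⁻¹ _ {{ℚ.pos*pos⇒pos ε {{ℚ.positive ε>0}} δ {{ℚ.positive δ>0}}}} , N ℕ.+ M ,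
  λ n ≤n → subst (ε ℚ.* δ ℚ.≤_) (sym (ℚ.∣p*q∣≡∣p∣*∣q∣ (seq x n) (seq y n)))
    (ℚ.≤-trans (ℚ.*-monoʳ-≤-nonNeg δ {{ℚ.nonNegative (ℚ.<⇒≤ δ>0)}} (ε≤ n (ℕ.m+n≤o⇒m≤o N ≤n)))
      (ℚ.*-monoˡ-≤-nonNeg ℚ.∣ seq x n ∣ {{ℚ.nonNegative (ℚ.0≤∣p∣ (seq x n))}}
        (δ≤ n (ℕ.m+n≤o⇒n≤o N ≤n))))

private
  0≤p*p : ∀ p → 0ℚ ℚ.≤ p ℚ.* p
  0≤p*p p with ℚ.≤-total 0ℚ p
  ... | inj₁ 0≤p = ℚ.nonNegative⁻¹ _ {{ℚ.nonNeg*nonNeg⇒nonNeg p {{ℚ.nonNegative 0≤p}} p {{ℚ.nonNegative 0≤p}}}}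
  ... | inj₂ p≤0 = ℚ.nonNegative⁻¹ _ {{ℚ.nonPos*nonPos⇒nonPos p {{ℚ.nonPositive p≤0}} p {{ℚ.nonPositive p≤0}}}}

apart-+-squares : ∀ x y → Apart x → Apart (x *ᴿ x +ᴿ y *ᴿ y)
apart-+-squares x y ap with ε , ε>0 , N , ε≤ ← apart-* x x ap ap =
  ε , ε>0 , N , λ n N≤n → ℚ.≤-trans (ε≤ n N≤n) (abs≤ (seq x n) (seq y n))
  where
  abs≤ : ∀ a b → ℚ.∣ a ℚ.* a ∣ ℚ.≤ ℚ.∣ a ℚ.* a ℚ.+ b ℚ.* b ∣
  abs≤ a b = subst (ℚ._≤ ℚ.∣ a ℚ.* a ℚ.+ b ℚ.* b ∣) (sym (ℚ.0≤p⇒∣p∣≡p (0≤p*p a)))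
    (subst (a ℚ.* a ℚ.≤_) (sym (ℚ.0≤p⇒∣p∣≡p (ℚ.+-mono-≤ (0≤p*p a) (0≤p*p b))))
      (subst (ℚ._≤ a ℚ.* a ℚ.+ b ℚ.* b) (ℚ.+-identityʳ (a ℚ.* a))
        (ℚ.+-monoʳ-≤ (a ℚ.* a) (0≤p*p b))))

-- Negations are stable, and being 0 is the negation of `Apart` in each of the two parts. This
-- permits indirect proofs that an entry or a coefficient vanishes.
≈0-stable : ∀ {z} → ¬ ¬ (z ≈ fromℕ 0) → z ≈ fromℕ 0
≈0-stable {z} ¬¬z≈0 =
  ¬apart⇒≈0 (λ ap → ¬¬z≈0 λ z≈0 → apart⇒≉0 ap (re-≈ z≈0)) ,
  ¬apart⇒≈0 (λ ap → ¬¬z≈0 λ z≈0 → apart⇒≉0 ap (im-≈ z≈0))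

private
  -- Multiplying `z * w` by the conjugate of `z` gives |z|² w; the two components are its real and
  -- imaginary parts.
  ∣z∣²w≈0 : ∀ {z w} → z * w ≈ fromℕ 0 →
    (re z *ᴿ re z +ᴿ im z *ᴿ im z) *ᴿ re w ≈ᴿ 0ᴿ × (re z *ᴿ re z +ᴿ im z *ᴿ im z) *ᴿ im w ≈ᴿ 0ᴿ
  ∣z∣²w≈0 {z} {w} (p , q) =
    ℝ-ring.trans (≈ᴿ-pointwise λ n → re≡ (seq a n) (seq b n) (seq c n) (seq d n)) (vanish a b p q) ,
    ℝ-ring.trans (≈ᴿ-pointwise λ n → im≡ (seq a n) (seq b n) (seq c n) (seq d n))
      (vanish a (-ᴿ b) q p)
    where
    a = re z
    b = im z
    c = re w
    d = im w
    vanish : ∀ x y {s t} → s ≈ᴿ 0ᴿ → t ≈ᴿ 0ᴿ → x *ᴿ s +ᴿ y *ᴿ t ≈ᴿ 0ᴿ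
    vanish x y s≈0 t≈0 = ℝ-ring.trans
      (ℝ-ring.+-cong (ℝ-ring.trans (ℝ-ring.*-congˡ s≈0) (ℝ-ring.zeroʳ x))
      (ℝ-ring.trans (ℝ-ring.*-congˡ t≈0) (ℝ-ring.zeroʳ y))) (ℝ-ring.+-identityˡ ℝ-ring.0#)
    open +-*-Solver
    re≡ : ∀ a b c d → (a ℚ.* a ℚ.+ b ℚ.* b) ℚ.* c ≡
          a ℚ.* (a ℚ.* c ℚ.+ ℚ.- (b ℚ.* d)) ℚ.+ b ℚ.* (a ℚ.* d ℚ.+ b ℚ.* c)
    re≡ = solve 4 (λ a b c d → (a :* a :+ b :* b) :* c :=
      a :* (a :* c :+ :- (b :* d)) :+ b :* (a :* d :+ b :* c)) refl
    im≡ : ∀ a b c d → (a ℚ.* a ℚ.+ b ℚ.* b) ℚ.* d ≡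
          a ℚ.* (a ℚ.* d ℚ.+ b ℚ.* c) ℚ.+ (ℚ.- b) ℚ.* (a ℚ.* c ℚ.+ ℚ.- (b ℚ.* d))
    im≡ = solve 4 (λ a b c d → (a :* a :+ b :* b) :* d :=
      a :* (a :* d :+ b :* c) :+ (:- b) :* (a :* c :+ :- (b :* d))) refl

-- Suppose a part of `w` is apart from 0. Its product with |z|² is 0, so neither part of `z` can be
-- apart from 0, a sum of two squares being at least as large as each. Then `z` would be 0.
no-zero-divisors : ∀ {z w} → z * w ≈ fromℕ 0 → ¬ (z ≈ fromℕ 0) → w ≈ fromℕ 0
no-zero-divisors {z} {w} zw≈0 z≉0 =
  ¬apart⇒≈0 (λ ap → z≉0 (part ap (proj₁ (∣z∣²w≈0 zw≈0)))) ,
  ¬apart⇒≈0 (λ ap → z≉0 (part ap (proj₂ (∣z∣²w≈0 zw≈0))))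
  where
  part : ∀ {c} → Apart c → (re z *ᴿ re z +ᴿ im z *ᴿ im z) *ᴿ c ≈ᴿ 0ᴿ → z ≈ fromℕ 0
  part {c} ap p =
    ¬apart⇒≈0 (λ a# → apart⇒≉0 {_ *ᴿ c}
      (apart-* (re z *ᴿ re z +ᴿ im z *ᴿ im z) c (apart-+-squares (re z) (im z) a#) ap) p) ,
    ¬apart⇒≈0 (λ b# → apart⇒≉0 {_ *ᴿ c}
      (apart-* (im z *ᴿ im z +ᴿ re z *ᴿ re z) c (apart-+-squares (im z) (re z) b#) ap)
      (ℝ-ring.trans (ℝ-ring.*-congʳ (ℝ-ring.+-comm _ _)) p))

-- Vectors and matrices

V-setoid : ℕ → Setoid 0ℓ 0ℓ
V-setoid D = record
  { Carrier = V D
  ; _≈_ = _≈ᵥ_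
  ; isEquivalence = record
    { refl = λ _ → C.refl
    ; sym = λ p y → C.sym (p y)
    ; trans = λ p q y → C.trans (p y) (q y)
    }
  }

module V {D} = Setoid (V-setoid D)

sum-single : (f : Fin n → ℂ) (i : Fin n) → (∀ j → j ≢ i → f j ≈ fromℕ 0) → sum f ≈ f i
sum-single {suc n} f zero p = begin
  f zero + sum (λ j → f (suc j)) ≈⟨ C.+-congˡ (sum-cong-≋ (λ j → p (suc j) λ ())) ⟩
  f zero + sum {n} (λ _ → fromℕ 0) ≈⟨ C.+-congˡ (sum-replicate-zero n) ⟩
  f zero + fromℕ 0 ≈⟨ C.+-identityʳ _ ⟩
  f zero ∎
sum-single f (suc i) p = begin
  f zero + sum (λ j → f (suc j))
    ≈⟨ C.+-cong (p zero λ ())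
        (sum-single (λ j → f (suc j)) i (λ j j≢i → p (suc j) λ e → j≢i (Fin.suc-injective e))) ⟩
  fromℕ 0 + f (suc i) ≈⟨ C.+-identityˡ _ ⟩
  f (suc i) ∎

sum-zero : (f : Fin n → ℂ) → (∀ i → f i ≈ fromℕ 0) → sum f ≈ fromℕ 0
sum-zero {n} f p = C.trans (sum-cong-≋ p) (sum-replicate-zero n)

∑ˣ-cong : {f g : X D → ℂ} → (∀ y → f y ≈ g y) → ∑ˣ f ≈ ∑ˣ g
∑ˣ-cong {zero}  p = p []
∑ˣ-cong {suc D} p = sum-cong-≋ (λ a → ∑ˣ-cong (λ y → p (a ∷ y)))

∑ˣ-* : ∀ c (f : X D → ℂ) → c * ∑ˣ f ≈ ∑ˣ (λ y → c * f y)
∑ˣ-* {zero}  c f = C.refl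
∑ˣ-* {suc D} c f = C.trans (*-distribˡ-sum c (λ a → ∑ˣ (λ y → f (a ∷ y))))
  (sum-cong-≋ (λ a → ∑ˣ-* c (λ y → f (a ∷ y))))

∑ˣ-+ : (f g : X D → ℂ) → ∑ˣ (λ y → f y + g y) ≈ ∑ˣ f + ∑ˣ g
∑ˣ-+ {zero}  f g = C.refl
∑ˣ-+ {suc D} f g = C.trans (sum-cong-≋ (λ a → ∑ˣ-+ (λ y → f (a ∷ y)) (λ y → g (a ∷ y))))
  (∑-distrib-+ (λ a → ∑ˣ (λ y → f (a ∷ y))) (λ a → ∑ˣ (λ y → g (a ∷ y))))

∑ˣ-zero : ∑ˣ {D} (λ _ → fromℕ 0) ≈ fromℕ 0
∑ˣ-zero {zero}  = C.refl
∑ˣ-zero {suc D} = sum-zero {2} (λ _ → ∑ˣ {D} (λ _ → fromℕ 0)) (λ _ → ∑ˣ-zero {D})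

∑ˣ-sum : (f : Fin n → X D → ℂ) → ∑ˣ (λ y → sum (λ i → f i y)) ≈ sum (λ i → ∑ˣ (f i))
∑ˣ-sum {zero}  {D} f = ∑ˣ-zero {D}
∑ˣ-sum {suc n} f = C.trans (∑ˣ-+ (f zero) (λ y → sum (λ i → f (suc i) y)))
  (C.+-congˡ (∑ˣ-sum (λ i → f (suc i))))

∑ˣ-comm : ∀ {D D′} (f : X D → X D′ → ℂ) → ∑ˣ (λ y → ∑ˣ (f y)) ≈ ∑ˣ (λ z → ∑ˣ (λ y → f y z))
∑ˣ-comm {zero}  f = C.refl
∑ˣ-comm {suc D} f = C.trans (sum-cong-≋ (λ a → ∑ˣ-comm (λ y → f (a ∷ y))))
  (C.sym (∑ˣ-sum (λ a z → ∑ˣ (λ y → f (a ∷ y) z))))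

⊛-congˡ : ∀ {M N : Mat D} → M ≈ₘ N → ∀ v → M ⊛ v ≈ᵥ N ⊛ v
⊛-congˡ p v y = ∑ˣ-cong (λ z → C.*-congʳ (p y z))

⊛-congʳ : ∀ (M : Mat D) {v w} → v ≈ᵥ w → M ⊛ v ≈ᵥ M ⊛ w
⊛-congʳ M p y = ∑ˣ-cong (λ z → C.*-congˡ (p z))

⊛-+ : ∀ (M : Mat D) v w → M ⊛ (v +ᵥ w) ≈ᵥ M ⊛ v +ᵥ M ⊛ w
⊛-+ M v w y = C.trans (∑ˣ-cong (λ z → C.distribˡ (M y z) (v z) (w z)))
  (∑ˣ-+ (λ z → M y z * v z) (λ z → M y z * w z))

⊛-∙ : ∀ (M : Mat D) c v → M ⊛ c ∙ᵥ v ≈ᵥ c ∙ᵥ M ⊛ v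
⊛-∙ M c v y = C.trans (∑ˣ-cong (λ z → x∙yz≈y∙xz (M y z) c (v z)))
  (C.sym (∑ˣ-* c (λ z → M y z * v z)))

⊛-0 : ∀ (M : Mat D) {v} → v ≈ᵥ 0ᵥ → M ⊛ v ≈ᵥ 0ᵥ
⊛-0 {D} M v≈0 y = C.trans (∑ˣ-cong (λ z → C.trans (C.*-congˡ (v≈0 z)) (C.zeroʳ (M y z))))
  (∑ˣ-zero {D})

⊛-combination : ∀ (M : Mat D) c (v : Fin n → V D) → M ⊛ combination c v
  ≈ᵥ combination c (λ i → M ⊛ v i)
⊛-combination M c v y = begin
  ∑ˣ (λ z → M y z * sum (λ i → c i * v i z))
    ≈⟨ ∑ˣ-cong (λ z → *-distribˡ-sum (M y z) (λ i → c i * v i z)) ⟩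
  ∑ˣ (λ z → sum (λ i → M y z * (c i * v i z))) ≈⟨ ∑ˣ-sum (λ i z → M y z * (c i * v i z)) ⟩
  sum (λ i → (M ⊛ c i ∙ᵥ v i) y) ≈⟨ sum-cong-≋ (λ i → ⊛-∙ M (c i) (v i) y) ⟩
  sum (λ i → c i * (M ⊛ v i) y) ∎

+ₘ-⊛ : ∀ (M N : Mat D) v → (M +ₘ N) ⊛ v ≈ᵥ M ⊛ v +ᵥ N ⊛ v
+ₘ-⊛ M N v y = C.trans (∑ˣ-cong (λ z → C.distribʳ (v z) (M y z) (N y z)))
  (∑ˣ-+ (λ z → M y z * v z) (λ z → N y z * v z))

∙ₘ-⊛ : ∀ c (M : Mat D) v → (c ∙ₘ M) ⊛ v ≈ᵥ c ∙ᵥ M ⊛ v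
∙ₘ-⊛ c M v y = C.trans (∑ˣ-cong (λ z → C.*-assoc c (M y z) (v z)))
  (C.sym (∑ˣ-* c (λ z → M y z * v z)))

-ₘ-+ₘ : ∀ (M N : Mat D) → M -ₘ N ≈ₘ M +ₘ (- fromℚ 1ℚ) ∙ₘ N
-ₘ-+ₘ M N y z = solve 2 (λ a b → a :- b := a :+ (:- con 1ℚ) :* b) C.refl (M y z) (N y z)
  where open ℂ-Solver

*ₘ-⊛ : ∀ (M N : Mat D) v → (M *ₘ N) ⊛ v ≈ᵥ M ⊛ N ⊛ v
*ₘ-⊛ M N v y = begin
  ∑ˣ (λ z → ∑ˣ (λ x → M y x * N x z) * v z)
    ≈⟨ ∑ˣ-cong (λ z → C.trans (C.*-comm _ (v z)) (C.trans (∑ˣ-* (v z) (λ x → M y x * N x z))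
         (∑ˣ-cong (λ x → C.trans (C.*-comm (v z) _) (C.*-assoc (M y x) (N x z) (v z)))))) ⟩
  ∑ˣ (λ z → ∑ˣ (λ x → M y x * (N x z * v z)))
    ≈⟨ ∑ˣ-comm (λ z x → M y x * (N x z * v z)) ⟩
  ∑ˣ (λ x → ∑ˣ (λ z → M y x * (N x z * v z)))
    ≈⟨ ∑ˣ-cong (λ x → C.sym (∑ˣ-* (M y x) (λ z → N x z * v z))) ⟩
  ∑ˣ (λ x → M y x * ∑ˣ (λ z → N x z * v z)) ∎

infix 9 _↾_
_↾_ : V (suc D) → Fin 2 → V D
(v ↾ a) y = v (a ∷ y)

diagonal-⊛ : ∀ f (v : V D) y → (diagonal f ⊛ v) y ≈ f y * v y
diagonal-⊛ f v [] = C.refl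
diagonal-⊛ {suc D} f v (0F ∷ y) = begin
  ∑ˣ (λ z → diagonal (f ↾ 0F) y z * v (0F ∷ z)) + (∑ˣ {D} (λ z → fromℕ 0 * v (1F ∷ z)) + fromℕ 0)
    ≈⟨ C.+-cong (diagonal-⊛ (f ↾ 0F) (v ↾ 0F) y)
        (C.+-congʳ (C.trans (∑ˣ-cong (λ z → C.zeroˡ (v (1F ∷ z)))) (∑ˣ-zero {D}))) ⟩
  f (0F ∷ y) * v (0F ∷ y) + (fromℕ 0 + fromℕ 0)
    ≈⟨ solve 1 (λ a → a :+ (con 0ℚ :+ con 0ℚ) := a) C.refl _ ⟩
  f (0F ∷ y) * v (0F ∷ y) ∎
  where open ℂ-Solver
diagonal-⊛ {suc D} f v (1F ∷ y) = begin
  ∑ˣ {D} (λ z → fromℕ 0 * v (0F ∷ z)) + (∑ˣ (λ z → diagonal (f ↾ 1F) y z * v (1F ∷ z)) + fromℕ 0)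
    ≈⟨ C.+-cong (C.trans (∑ˣ-cong (λ z → C.zeroˡ (v (0F ∷ z)))) (∑ˣ-zero {D}))
        (C.+-congʳ (diagonal-⊛ (f ↾ 1F) (v ↾ 1F) y)) ⟩
  fromℕ 0 + (f (1F ∷ y) * v (1F ∷ y) + fromℕ 0)
    ≈⟨ solve 1 (λ a → con 0ℚ :+ (a :+ con 0ℚ) := a) C.refl _ ⟩
  f (1F ∷ y) * v (1F ∷ y) ∎
  where open ℂ-Solver

I-⊛ : ∀ (v : V D) → I ⊛ v ≈ᵥ v
I-⊛ v y = C.trans (diagonal-⊛ (λ _ → fromℕ 1) v y) (C.*-identityˡ (v y))

-- Idempotents and ladder operators

2ℚ : ℚ
2ℚ = fromℤ (+ 2)

θᶜ : ℕ → ℕ → ℂ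
θᶜ D k = fromℚ (θ D k)

-- The difference is given as 2(m - n) and not through two values `θᶜ D k`, because lowering an
-- index can produce D + 2, which has no natural index.
eigenvalue-cancel : ∀ {t μ m n} → t + - μ ≈ fromℚ 2ℚ * (fromℕ m + - fromℕ n) → m ≢ n →
  ∀ {z} → t * z ≈ μ * z → z ≈ fromℕ 0
eigenvalue-cancel {t} {μ} {m} {n} t-μ≈ m≢n {z} tz≈μz = fromℕ-cancel m≢n (begin
  (fromℕ m + - fromℕ n) * z
    ≈⟨ solve 2 (λ c z → c :* z := con ½ :* ((con 2ℚ :* c) :* z)) C.refl (fromℕ m + - fromℕ n) z ⟩
  fromℚ ½ * (fromℚ 2ℚ * (fromℕ m + - fromℕ n) * z)
    ≈⟨ C.*-congˡ (C.*-congʳ t-μ≈) ⟨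
  fromℚ ½ * ((t + - μ) * z)
    ≈⟨ solve 3 (λ t μ z → con ½ :* ((t :- μ) :* z) := con ½ :* (t :* z :- μ :* z)) C.refl t μ z ⟩
  fromℚ ½ * (t * z + - (μ * z))
    ≈⟨ C.*-congˡ (C.+-congʳ tz≈μz) ⟩
  fromℚ ½ * (μ * z + - (μ * z))
    ≈⟨ solve 2 (λ μ z → con ½ :* (μ :* z :- μ :* z) := con 0ℚ) C.refl μ z ⟩
  fromℕ 0 ∎)
  where open ℂ-Solver

-- These properties of primitive idempotents survive conjugation and suffice for the ladder
-- argument. The index runs over all naturals, with `vanishes` beyond D, so that a step past the
-- upper end needs no separate bound.
record IsSpectral {D} (Y : Mat D) (F : ℕ → Mat D) : Set where
  field
    eigen     : ∀ k v → Y ⊛ F k ⊛ v ≈ᵥ θᶜ D k ∙ᵥ F k ⊛ v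
    coeigen   : ∀ k v → F k ⊛ Y ⊛ v ≈ᵥ θᶜ D k ∙ᵥ F k ⊛ v
    fixes     : ∀ k {v} → Y ⊛ v ≈ᵥ θᶜ D k ∙ᵥ v → F k ⊛ v ≈ᵥ v
    vanishes  : ∀ {k} → D ℕ.< k → ∀ v → F k ⊛ v ≈ᵥ 0ᵥ
    decompose : ∀ v → v ≈ᵥ combination {suc D} (λ _ → fromℕ 1) (λ k → F (toℕ k) ⊛ v)

  idempotent : ∀ k v → F k ⊛ F k ⊛ v ≈ᵥ F k ⊛ v
  idempotent k v = fixes k (eigen k v)

  vanish : ∀ (M : Mat D) v → (∀ k → M ⊛ F k ⊛ v ≈ᵥ 0ᵥ) → M ⊛ v ≈ᵥ 0ᵥ
  vanish M v p = V.trans (⊛-congʳ M (decompose v))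
    (V.trans (⊛-combination M (λ _ → fromℕ 1) (λ (k : Fin (suc D)) → F (toℕ k) ⊛ v))
      (λ y → sum-zero {suc D} _
        (λ k → C.trans (C.*-congˡ {fromℕ 1} (p (toℕ k) y)) (C.zeroʳ (fromℕ 1)))))

  agree : ∀ (M N : Mat D) v → (∀ k → M ⊛ F k ⊛ v ≈ᵥ N ⊛ F k ⊛ v) → M ⊛ v ≈ᵥ N ⊛ v
  agree M N v p = V.trans (expand M)
    (V.trans (λ y → sum-cong-≋ {suc D} (λ k → C.*-congˡ {fromℕ 1} (p (toℕ k) y)))
      (V.sym (expand N)))
    where
    expand : ∀ M → M ⊛ v ≈ᵥ combination {suc D} (λ _ → fromℕ 1) (λ k → M ⊛ F (toℕ k) ⊛ v)
    expand M = V.trans (⊛-congʳ M (decompose v))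
      (⊛-combination M (λ _ → fromℕ 1) (λ (k : Fin (suc D)) → F (toℕ k) ⊛ v))

  separates : ∀ {v} → (∀ k → F k ⊛ v ≈ᵥ 0ᵥ) → v ≈ᵥ 0ᵥ
  separates {v} p = V.trans (decompose v)
    (λ y → sum-zero {suc D} _
      (λ k → C.trans (C.*-congˡ {fromℕ 1} (p (toℕ k) y)) (C.zeroʳ (fromℕ 1))))

  other-eigenvalue : ∀ j {v μ m n} → Y ⊛ v ≈ᵥ μ ∙ᵥ v → m ≢ n →
    θᶜ D j + - μ ≈ fromℚ 2ℚ * (fromℕ m + - fromℕ n) → F j ⊛ v ≈ᵥ 0ᵥ
  other-eigenvalue j {v} {μ} Yv≈ m≢n θ-μ≈ y = eigenvalue-cancel θ-μ≈ m≢n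
    (C.trans (C.sym (coeigen j v y)) (C.trans (⊛-congʳ (F j) Yv≈ y) (⊛-∙ (F j) μ v y)))

θ-difference : ∀ D j k → θᶜ D j + - θᶜ D k ≈ fromℚ 2ℚ * (fromℕ k + - fromℕ j)
θ-difference D j k = C.trans (C.+-cong (θ-expand D j) (C.-‿cong (θ-expand D k)))
  (solve 3 (λ d j k → (d :- con 2ℚ :* j) :- (d :- con 2ℚ :* k) := con 2ℚ :* (k :- j)) C.refl
    (fromℕ D) (fromℕ j) (fromℕ k))
  where open ℂ-Solver

θ-suc : ∀ D k → θᶜ D (suc k) ≈ θᶜ D k + - fromℚ 2ℚ
θ-suc D k = C.trans (θ-expand D (suc k)) (C.trans (C.+-congˡ (C.-‿cong (C.*-congˡ (fromℕ-suc k))))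
  (C.trans (solve 2 (λ d k → d :- con 2ℚ :* (con 1ℚ :+ k)
    := (d :- con 2ℚ :* k) :- con 2ℚ) C.refl (fromℕ D) (fromℕ k))
    (C.+-congʳ (C.sym (θ-expand D k)))))
  where open ℂ-Solver

-- For `s` equal to `𝐢` these are the commutation relations of the Pauli matrices, a form of sl₂ in
-- which the three generators enter alike. The parameter is left open because exchanging two
-- generators, as in `reflect`, changes its sign.
record IsTriple {D} (s : ℂ) (X Y Z : Mat D) : Set where
  field
    s² : s * s ≈ - fromℚ 1ℚ
    XY : ∀ v → X ⊛ Y ⊛ v ≈ᵥ Y ⊛ X ⊛ v +ᵥ (fromℚ 2ℚ * s) ∙ᵥ Z ⊛ v
    YZ : ∀ v → Y ⊛ Z ⊛ v ≈ᵥ Z ⊛ Y ⊛ v +ᵥ (fromℚ 2ℚ * s) ∙ᵥ X ⊛ v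
    ZX : ∀ v → Z ⊛ X ⊛ v ≈ᵥ X ⊛ Z ⊛ v +ᵥ (fromℚ 2ℚ * s) ∙ᵥ Y ⊛ v

rotate : ∀ {s} {X Y Z : Mat D} → IsTriple s X Y Z → IsTriple s Y Z X
rotate t = record { s² = s² ; XY = YZ ; YZ = ZX ; ZX = XY }
  where open IsTriple t

reflect : ∀ {s} {X Y Z : Mat D} → IsTriple s X Y Z → IsTriple (- s) X Z Y
reflect {s = s} t = record
  { s² = C.trans (solve 1 (λ s → (:- s) :* (:- s) := s :* s) C.refl s) s²
  ; XY = λ v y → flip (ZX v y)
  ; YZ = λ v y → flip (YZ v y)
  ; ZX = λ v y → flip (XY v y)
  }
  where
  open IsTriple t
  open ℂ-Solver
  flip : ∀ {a b c} → a ≈ b + fromℚ 2ℚ * s * c → b ≈ a + fromℚ 2ℚ * - s * c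
  flip {a} {b} {c} p = C.trans
    (solve 3 (λ s b c → b := (b :+ con 2ℚ :* s :* c) :+ con 2ℚ :* (:- s) :* c) C.refl s b c)
    (C.+-congʳ (C.sym p))

-- The names refer to the index k of an eigenvalue D - 2k of the remaining matrix `Y` of a triple:
-- raising k lowers the eigenvalue by 2. As `lowering s` unfolds to `raising (- s)`, statements
-- about `raising` with an arbitrary scalar serve both.
raising lowering : ℂ → Mat D → Mat D → Mat D
raising  s X Z = fromℚ ½ ∙ₘ (X +ₘ s ∙ₘ Z)
lowering s X Z = fromℚ ½ ∙ₘ (X +ₘ (- s) ∙ₘ Z)

raising-⊛ : ∀ s (X Z : Mat D) v → raising s X Z ⊛ v ≈ᵥ fromℚ ½ ∙ᵥ (X ⊛ v +ᵥ s ∙ᵥ Z ⊛ v)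
raising-⊛ s X Z v y = C.trans (∙ₘ-⊛ (fromℚ ½) (X +ₘ s ∙ₘ Z) v y) (C.*-congˡ
  (C.trans (+ₘ-⊛ X (s ∙ₘ Z) v y) (C.+-congˡ (∙ₘ-⊛ s Z v y))))

module Ladder {s} {X Y Z : Mat D} (t : IsTriple s X Y Z) where
  open IsTriple t
  open ℂ-Solver

  R L : Mat D
  R = raising s X Z
  L = lowering s X Z

  R+L : ∀ v → X ⊛ v ≈ᵥ R ⊛ v +ᵥ L ⊛ v
  R+L v y = begin
    a
      ≈⟨ solve 3 (λ a b s → a
          := con ½ :* (a :+ s :* b) :+ con ½ :* (a :+ (:- s) :* b)) C.refl a b s ⟩
    fromℚ ½ * (a + s * b) + fromℚ ½ * (a + - s * b)
      ≈⟨ C.+-cong (raising-⊛ s X Z v y) (raising-⊛ (- s) X Z v y) ⟨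
    (R ⊛ v) y + (L ⊛ v) y ∎
    where
    a = (X ⊛ v) y
    b = (Z ⊛ v) y

  private
    -- e is 1 for R and -1 for L.
    commute : ∀ e c → c ≈ fromℚ e * s → e ℚ.* e ≡ 1ℚ → ∀ v →
      Y ⊛ raising c X Z ⊛ v ≈ᵥ raising c X Z ⊛ Y ⊛ v +ᵥ
        (- (fromℚ 2ℚ * fromℚ e)) ∙ᵥ raising c X Z ⊛ v
    commute e c c≈ ee≡1 v y = begin
      (Y ⊛ raising c X Z ⊛ v) y
        ≈⟨ ⊛-congʳ Y (raising-⊛ c X Z v) y ⟩
      (Y ⊛ fromℚ ½ ∙ᵥ (X ⊛ v +ᵥ c ∙ᵥ Z ⊛ v)) y
        ≈⟨ ⊛-∙ Y (fromℚ ½) (X ⊛ v +ᵥ c ∙ᵥ Z ⊛ v) y ⟩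
      fromℚ ½ * (Y ⊛ (X ⊛ v +ᵥ c ∙ᵥ Z ⊛ v)) y
        ≈⟨ C.*-congˡ (C.trans (⊛-+ Y (X ⊛ v) (c ∙ᵥ Z ⊛ v) y) (C.+-congˡ (⊛-∙ Y c (Z ⊛ v) y))) ⟩
      fromℚ ½ * (p + c * (Y ⊛ Z ⊛ v) y)
        ≈⟨ C.*-congˡ (C.+-congˡ (C.*-cong c≈ (YZ v y))) ⟩
      fromℚ ½ * (p + e′ * s * (q + fromℚ 2ℚ * s * a))
        ≈⟨ solve 6 (λ p e q s a b → con ½ :* (p :+ e :* s :* (q :+ con 2ℚ :* s :* a))
             := con ½ :* (p :+ e :* s :* q) :+ e :* (s :* s) :* a) C.refl p e′ q s a b ⟩
      fromℚ ½ * (p + e′ * s * q) + e′ * (s * s) * a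
        ≈⟨ C.+-congˡ (C.*-congʳ (C.*-congˡ s²)) ⟩
      fromℚ ½ * (p + e′ * s * q) + e′ * (- fromℚ 1ℚ) * a
        ≈⟨ solve 6 (λ p e q s a b → con ½ :* (p :+ e :* s :* q) :+ e :* (:- con 1ℚ) :* a
             := con ½ :* ((p :+ con 2ℚ :* s :* b) :+ e :* s :* q) :+ (:- (con 2ℚ :* e)) :*
               (con ½ :* a) :- con 1ℚ :* s :* b)
             C.refl p e′ q s a b ⟩
      fromℚ ½ * ((p + fromℚ 2ℚ * s * b) + e′ * s * q) + - (fromℚ 2ℚ * e′) * (fromℚ ½ * a) + -
        (fromℚ 1ℚ * s * b)
        ≈⟨ C.+-cong (C.+-congʳ (C.*-congˡ (C.+-congʳ (XY v y)))) (C.-‿cong (C.*-congʳ (C.*-congʳ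
             (C.trans (C.sym (fromℚ-* e e)) (C.reflexive (cong fromℚ ee≡1)))))) ⟨
      fromℚ ½ * (x + e′ * s * q) + - (fromℚ 2ℚ * e′) * (fromℚ ½ * a) + - (e′ * e′ * s * b)
        ≈⟨ solve 6 (λ x e q s a b → con ½ :* (x :+ e :* s :* q) :+ (:- (con 2ℚ :* e)) :*
            (con ½ :* a) :- e :* e :* s :* b
             := con ½ :* (x :+ e :* s :* q) :+ (:- (con 2ℚ :* e)) :* (con ½ :* (a :+ e :* s :* b)))
             C.refl x e′ q s a b ⟩
      fromℚ ½ * (x + e′ * s * q) + - (fromℚ 2ℚ * e′) * (fromℚ ½ * (a + e′ * s * b))
        ≈⟨ C.+-cong (fold (Y ⊛ v)) (C.*-congˡ (fold v)) ⟩
      (raising c X Z ⊛ Y ⊛ v +ᵥ (- (fromℚ 2ℚ * fromℚ e)) ∙ᵥ raising c X Z ⊛ v) y ∎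
      where
      e′ = fromℚ e
      p = (Y ⊛ X ⊛ v) y
      q = (Z ⊛ Y ⊛ v) y
      x = (X ⊛ Y ⊛ v) y
      a = (X ⊛ v) y
      b = (Z ⊛ v) y
      fold : ∀ w → fromℚ ½ * ((X ⊛ w) y + e′ * s * (Z ⊛ w) y) ≈ (raising c X Z ⊛ w) y
      fold w = C.trans (C.*-congˡ (C.+-congˡ (C.*-congʳ (C.sym c≈)))) (C.sym (raising-⊛ c X Z w y))

  R-eigen : ∀ k {v} → Y ⊛ v ≈ᵥ θᶜ D k ∙ᵥ v → Y ⊛ R ⊛ v ≈ᵥ θᶜ D (suc k) ∙ᵥ R ⊛ v
  R-eigen k {v} Yv≈ y = begin
    (Y ⊛ R ⊛ v) y
      ≈⟨ commute 1ℚ s (C.sym (C.*-identityˡ s)) refl v y ⟩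
    (R ⊛ Y ⊛ v) y + - (fromℚ 2ℚ * fromℚ 1ℚ) * (R ⊛ v) y
      ≈⟨ C.+-congʳ (C.trans (⊛-congʳ R Yv≈ y) (⊛-∙ R (θᶜ D k) v y)) ⟩
    θᶜ D k * (R ⊛ v) y + - (fromℚ 2ℚ * fromℚ 1ℚ) * (R ⊛ v) y
      ≈⟨ solve 2 (λ t a → t :* a :+ (:- (con 2ℚ :* con 1ℚ)) :* a
          := (t :- con 2ℚ) :* a) C.refl (θᶜ D k) ((R ⊛ v) y) ⟩
    (θᶜ D k + - fromℚ 2ℚ) * (R ⊛ v) y
      ≈⟨ C.*-congʳ (θ-suc D k) ⟨
    θᶜ D (suc k) * (R ⊛ v) y ∎

  L-eigen : ∀ k {v} → Y ⊛ v ≈ᵥ θᶜ D k ∙ᵥ v → Y ⊛ L ⊛ v ≈ᵥ (θᶜ D k + fromℚ 2ℚ) ∙ᵥ L ⊛ v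
  L-eigen k {v} Yv≈ y = begin
    (Y ⊛ L ⊛ v) y
      ≈⟨ commute (ℚ.- 1ℚ) (- s) (solve 1 (λ s → :- s := con (ℚ.- 1ℚ) :* s) C.refl s) refl v y ⟩
    (L ⊛ Y ⊛ v) y + - (fromℚ 2ℚ * fromℚ (ℚ.- 1ℚ)) * (L ⊛ v) y
      ≈⟨ C.+-congʳ (C.trans (⊛-congʳ L Yv≈ y) (⊛-∙ L (θᶜ D k) v y)) ⟩
    θᶜ D k * (L ⊛ v) y + - (fromℚ 2ℚ * fromℚ (ℚ.- 1ℚ)) * (L ⊛ v) y
      ≈⟨ solve 2 (λ t a → t :* a :+ (:- (con 2ℚ :* con (ℚ.- 1ℚ))) :* a
          := (t :+ con 2ℚ) :* a) C.refl (θᶜ D k) ((L ⊛ v) y) ⟩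
    (θᶜ D k + fromℚ 2ℚ) * (L ⊛ v) y ∎

module Spectrum {Y : Mat D} {F : ℕ → Mat D} (S : IsSpectral Y F) where
  open IsSpectral S

  F-orthogonal : ∀ j k → j ≢ k → ∀ {v} → Y ⊛ v ≈ᵥ θᶜ D k ∙ᵥ v → F j ⊛ v ≈ᵥ 0ᵥ
  F-orthogonal j k j≢k Yv≈ = other-eigenvalue j Yv≈ (≢-sym j≢k) (θ-difference D j k)

  F-orthogonal⁺ : ∀ j k → suc j ≢ k → ∀ {v} → Y ⊛ v ≈ᵥ (θᶜ D k + fromℚ 2ℚ) ∙ᵥ v → F j ⊛ v ≈ᵥ 0ᵥ
  F-orthogonal⁺ j k sj≢k Yv≈ = other-eigenvalue j Yv≈ (≢-sym sj≢k) (begin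
    θᶜ D j + - (θᶜ D k + fromℚ 2ℚ)
      ≈⟨ solve 2 (λ a b → a :- (b :+ con 2ℚ) := (a :- b) :- con 2ℚ) C.refl (θᶜ D j) (θᶜ D k) ⟩
    (θᶜ D j + - θᶜ D k) + - fromℚ 2ℚ ≈⟨ C.+-congʳ (θ-difference D j k) ⟩
    fromℚ 2ℚ * (fromℕ k + - fromℕ j) + - fromℚ 2ℚ
      ≈⟨ solve 2 (λ k j → con 2ℚ :* (k :- j) :- con 2ℚ
          := con 2ℚ :* (k :- (con 1ℚ :+ j))) C.refl (fromℕ k) (fromℕ j) ⟩
    fromℚ 2ℚ * (fromℕ k + - (fromℚ 1ℚ + fromℕ j))
      ≈⟨ C.*-congˡ (C.+-congˡ (C.-‿cong (fromℕ-suc j))) ⟨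
    fromℚ 2ℚ * (fromℕ k + - fromℕ (suc j)) ∎)
    where open ℂ-Solver

module Shift {s} {X Y Z : Mat D} (t : IsTriple s X Y Z) {F : ℕ → Mat D} (S : IsSpectral Y F) where
  open Ladder t public
  open IsSpectral S
  open Spectrum S

  -- Tested on one component `F j ⊛ v` at a time: `R` moves it to the eigenspace of index j + 1,
  -- where `F (suc k)` is the identity if j = k and 0 otherwise.
  F-R : ∀ k v → F (suc k) ⊛ R ⊛ v ≈ᵥ R ⊛ F k ⊛ v
  F-R k v = V.trans (V.sym (*ₘ-⊛ (F (suc k)) R v))
    (V.trans (agree (F (suc k) *ₘ R) (R *ₘ F k) v component) (*ₘ-⊛ R (F k) v))
    where
    component : ∀ j → (F (suc k) *ₘ R) ⊛ F j ⊛ v ≈ᵥ (R *ₘ F k) ⊛ F j ⊛ v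
    component j with j ℕ.≟ k
    ... | yes refl = V.trans (*ₘ-⊛ (F (suc k)) R (F k ⊛ v)) (V.trans
      (fixes (suc k) (R-eigen k (eigen k v)))
      (V.trans (⊛-congʳ R (V.sym (idempotent k v))) (V.sym (*ₘ-⊛ R (F k) (F k ⊛ v)))))
    ... | no j≢k = V.trans (*ₘ-⊛ (F (suc k)) R (F j ⊛ v)) (V.trans
      (F-orthogonal (suc k) (suc j) (λ e → j≢k (sym (ℕ.suc-injective e))) (R-eigen j (eigen j v)))
      (V.trans (V.sym (⊛-0 R (F-orthogonal k j (≢-sym j≢k) (eigen j v))))
        (V.sym (*ₘ-⊛ R (F k) (F j ⊛ v)))))

  F-R-zero : ∀ v → F 0 ⊛ R ⊛ v ≈ᵥ 0ᵥ
  F-R-zero v = V.trans (V.sym (*ₘ-⊛ (F 0) R v)) (vanish (F 0 *ₘ R) v (λ j →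
    V.trans (*ₘ-⊛ (F 0) R (F j ⊛ v)) (F-orthogonal 0 (suc j) (λ ()) (R-eigen j (eigen j v)))))

  F-L : ∀ k v → F k ⊛ L ⊛ v ≈ᵥ L ⊛ F (suc k) ⊛ v
  F-L k v = V.trans (V.sym (*ₘ-⊛ (F k) L v))
    (V.trans (agree (F k *ₘ L) (L *ₘ F (suc k)) v component) (*ₘ-⊛ L (F (suc k)) v))
    where
    L-eigen′ : ∀ w → Y ⊛ L ⊛ F (suc k) ⊛ w ≈ᵥ θᶜ D k ∙ᵥ L ⊛ F (suc k) ⊛ w
    L-eigen′ w y = C.trans (L-eigen (suc k) (eigen (suc k) w) y)
      (C.*-congʳ (C.trans (C.+-congʳ (θ-suc D k))
      (solve 1 (λ a → (a :- con 2ℚ) :+ con 2ℚ := a) C.refl (θᶜ D k))))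
      where open ℂ-Solver
    component : ∀ j → (F k *ₘ L) ⊛ F j ⊛ v ≈ᵥ (L *ₘ F (suc k)) ⊛ F j ⊛ v
    component j with suc k ℕ.≟ j
    ... | yes refl = V.trans (*ₘ-⊛ (F k) L (F (suc k) ⊛ v)) (V.trans
      (fixes k (L-eigen′ v))
      (V.trans (⊛-congʳ L (V.sym (idempotent (suc k) v)))
        (V.sym (*ₘ-⊛ L (F (suc k)) (F (suc k) ⊛ v)))))
    ... | no sk≢j = V.trans (*ₘ-⊛ (F k) L (F j ⊛ v)) (V.trans
      (F-orthogonal⁺ k j sk≢j (L-eigen j (eigen j v)))
      (V.trans (V.sym (⊛-0 L (F-orthogonal (suc k) j sk≢j (eigen j v))))
        (V.sym (*ₘ-⊛ L (F (suc k)) (F j ⊛ v)))))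

  -- The image would have eigenvalue D + 2, which differs from every `θᶜ D j`, so all of its
  -- components are 0.
  L-F-zero : ∀ v → L ⊛ F 0 ⊛ v ≈ᵥ 0ᵥ
  L-F-zero v = separates (λ j → F-orthogonal⁺ j 0 (λ ()) (L-eigen 0 (eigen 0 v)))

-- Modules spanned by the components of one eigenvector

if-yes : ∀ {P : Set} (P? : Dec P) {a b : ℂ} → P → (if does P? then a else b) ≈ a
if-yes P? {a} {b} p = C.reflexive (cong (if_then a else b) (dec-true P? p))

if-no : ∀ {P : Set} (P? : Dec P) {a b : ℂ} → ¬ P → (if does P? then a else b) ≈ b
if-no P? {a} {b} ¬p = C.reflexive (cong (if_then a else b) (dec-false P? ¬p))

-- The distinguished position is a natural that may lie beyond the last summand; `out` then supplies
-- the value 0. The last column of a tridiagonal matrix is thereby treated like any other.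
sum-at : (f : Fin n → ℂ) (k : ℕ) {h : ℂ} → (∀ i → toℕ i ≢ k → f i ≈ fromℕ 0) →
  (∀ i → toℕ i ≡ k → f i ≈ h) → (n ℕ.≤ k → h ≈ fromℕ 0) → sum f ≈ h
sum-at {n} f k {h} off on out with k ℕ.<? n
... | yes k<n = C.trans (sum-single f (fromℕ< k<n) (λ j j≢ → off j λ e →
    j≢ (Fin.toℕ-injective (trans e (sym (Fin.toℕ-fromℕ< k<n))))))
  (on (fromℕ< k<n) (Fin.toℕ-fromℕ< k<n))
... | no k≮n = C.trans (sum-zero f (λ i → off i λ e → k≮n (subst (ℕ._< n) e (Fin.toℕ<n i))))
  (C.sym (out (ℕ.≮⇒≥ k≮n)))

Closed : Mat D → Pred (V D) 0ℓ → Set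
Closed M U = ∀ {v} → v ∈ U → M ⊛ v ∈ U

combination-∈ : ∀ {U : Pred (V D) 0ℓ} → IsSubspace U → ∀ (c : Fin n → ℂ) {v : Fin n → V D} →
  (∀ i → v i ∈ U) → combination c v ∈ U
combination-∈ {n = zero}  S c p = IsSubspace.0ᵥ-closed S
combination-∈ {n = suc n} S c p = IsSubspace.+ᵥ-closed S
  (IsSubspace.∙ᵥ-closed S (c zero) (p zero)) (combination-∈ S (λ i → c (suc i)) (λ i → p (suc i)))

Span : (Fin n → V D) → Pred (V D) 0ℓ
Span {n} v w = ∃[ c ] w ≈ᵥ combination {n} c v

Span-isSubspace : (v : Fin n → V D) → IsSubspace (Span v)
Span-isSubspace {n} v = record
  { respects  = λ w≈w′ (c , p) → c , V.trans (V.sym w≈w′) p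
  ; 0ᵥ-closed = (λ _ → fromℕ 0) , λ y → C.sym
    (sum-zero {n} (λ i → fromℕ 0 * v i y) (λ i → C.zeroˡ (v i y)))
  ; +ᵥ-closed = λ (c , p) (c′ , p′) → (λ i → c i + c′ i) , λ y → C.trans (C.+-cong (p y) (p′ y))
      (C.trans (C.sym (∑-distrib-+ (λ i → c i * v i y) (λ i → c′ i * v i y)))
        (sum-cong-≋ (λ i → C.sym (C.distribʳ (v i y) (c i) (c′ i)))))
  ; ∙ᵥ-closed = λ a (c , p) → (λ i → a * c i) , λ y → C.trans (C.*-congˡ (p y))
      (C.trans (*-distribˡ-sum a (λ i → c i * v i y))
        (sum-cong-≋ (λ i → C.sym (C.*-assoc a (c i) (v i y)))))
  }

Span-∋ : (v : Fin n → V D) → ∀ i → v i ∈ Span v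
Span-∋ v i = δ , λ y → C.sym (C.trans (sum-single (λ j → δ j * v j y) i (off y)) (on y))
  where
  δ : Fin _ → ℂ
  δ j = if does (i Fin.≟ j) then fromℕ 1 else fromℕ 0
  off : ∀ y j → j ≢ i → δ j * v j y ≈ fromℕ 0
  off y j j≢i = C.trans (C.*-congʳ (if-no (i Fin.≟ j) (≢-sym j≢i))) (C.zeroˡ (v j y))
  on : ∀ y → δ i * v i y ≈ v i y
  on y = C.trans (C.*-congʳ (if-yes (i Fin.≟ i) refl)) (C.*-identityˡ (v i y))

Span-closed : (M : Mat D) (v : Fin n → V D) → (∀ i → M ⊛ v i ∈ Span v) → Closed M (Span v)
Span-closed M v p (c , w≈) = IsSubspace.respects (Span-isSubspace v)
  (V.sym (V.trans (⊛-congʳ M w≈) (⊛-combination M c v))) (combination-∈ (Span-isSubspace v) c p)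

-- Since `s * s` is -1, the relation `XY` can be solved for `Z`, which equals -(s/2)(XY - YX).
third-closed : ∀ {s} {X Y Z : Mat D} → IsTriple s X Y Z → ∀ {U} → IsSubspace U →
  Closed X U → Closed Y U → Closed Z U
third-closed {s = s} {X} {Y} {Z} t S X-closed Y-closed {v} v∈U =
  respects (λ y → C.sym (Z≈ y)) (∙ᵥ-closed (- (fromℚ ½ * s))
    (+ᵥ-closed (X-closed (Y-closed v∈U)) (∙ᵥ-closed (- fromℚ 1ℚ) (Y-closed (X-closed v∈U)))))
  where
  open IsSubspace S
  open IsTriple t
  open ℂ-Solver
  Z≈ : Z ⊛ v ≈ᵥ (- (fromℚ ½ * s)) ∙ᵥ (X ⊛ Y ⊛ v +ᵥ (- fromℚ 1ℚ) ∙ᵥ Y ⊛ X ⊛ v)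
  Z≈ y = begin
    z ≈⟨ solve 1 (λ z → z := :- ((:- con 1ℚ) :* z)) C.refl z ⟩
    - (- fromℚ 1ℚ * z) ≈⟨ C.-‿cong (C.*-congʳ s²) ⟨
    - (s * s * z)
      ≈⟨ solve 3 (λ s z q → :- (s :* s :* z)
          := (:- (con ½ :* s)) :* ((q :+ con 2ℚ :* s :* z) :+ (:- con 1ℚ) :* q)) C.refl s z q ⟩
    - (fromℚ ½ * s) * ((q + fromℚ 2ℚ * s * z) + - fromℚ 1ℚ * q) ≈⟨ C.*-congˡ (C.+-congʳ (XY v y)) ⟨
    - (fromℚ ½ * s) * ((X ⊛ Y ⊛ v) y + - fromℚ 1ℚ * q) ∎
    where
    z = (Z ⊛ v) y
    q = (Y ⊛ X ⊛ v) y

-- `T` is generated by `A` and `A*` alone. Naming all three matrices makes the notion symmetric, so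
-- that it can be rotated and reflected together with the triple.
record IsIrreducibleFor {D} (X Y Z : Mat D) (W : Pred (V D) 0ℓ) : Set₁ where
  field
    isSubspace : IsSubspace W
    X-closed   : Closed X W
    Y-closed   : Closed Y W
    Z-closed   : Closed Z W
    minimal    : ∀ {U : Pred (V D) 0ℓ} → IsSubspace U → Closed X U → Closed Y U → Closed Z U →
                 U ⊆ W → NonZero U → W ⊆ U

-- The endpoint enters only as `below`. In this form the conclusion `G-vanishes` of one instance
-- provides the hypothesis of another, in which the former `Y` takes the place of `X`.
module Core {s} {X Y Z : Mat D} (t : IsTriple s X Y Z)
  {F G : ℕ → Mat D} (SX : IsSpectral X F) (SY : IsSpectral Y G)
  {W : Pred (V D) 0ℓ} (W-irr : IsIrreducibleFor X Y Z W) (G-closed : ∀ k → Closed (G k) W)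
  (r : ℕ) (below : ∀ {j} → j ℕ.< r → ∀ {v} → v ∈ W → F j ⊛ v ≈ᵥ 0ᵥ)
  {u : V D} (u∈W : u ∈ W) (Xu≈ : X ⊛ u ≈ᵥ θᶜ D r ∙ᵥ u) (u≉0 : ¬ (u ≈ᵥ 0ᵥ)) where

  open Shift t SY
  open IsIrreducibleFor W-irr
  open ℂ-Solver
  private
    module SX = IsSpectral SX
    module SY = IsSpectral SY
    module FX = Spectrum SX
    module FY = Spectrum SY

  private
    -- Raises X-eigenvalues, hence maps u to 0.
    e : V D
    e = lowering (- s) Y Z ⊛ u

    e≈ : e ≈ᵥ fromℚ ½ ∙ᵥ (Y ⊛ u +ᵥ (- - s) ∙ᵥ Z ⊛ u)
    e≈ = raising-⊛ (- - s) Y Z u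

    e∈W : e ∈ W
    e∈W = respects (V.sym e≈)
      (∙ᵥ-closed (fromℚ ½) (+ᵥ-closed (Y-closed u∈W) (∙ᵥ-closed (- - s) (Z-closed u∈W))))
      where open IsSubspace isSubspace

    -- The eigenvalue of `e` is D - 2(r - 1), so at most the component of index r - 1 could survive,
    -- and that one is 0 by `below`.
    e≈0 : e ≈ᵥ 0ᵥ
    e≈0 = SX.separates λ j → case j
      where
      Xe≈ : X ⊛ e ≈ᵥ (θᶜ D r + fromℚ 2ℚ) ∙ᵥ e
      -- The triple here is (Y, X, Z) with parameter -s, so that `X` is the matrix whose eigenvalue
      -- is shifted. This is the origin of the double negation in `e≈`.
      Xe≈ = Ladder.L-eigen (rotate (rotate (reflect t))) r Xu≈
      case : ∀ j → F j ⊛ e ≈ᵥ 0ᵥ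
      case j with j ℕ.<? r
      ... | yes j<r = below j<r e∈W
      ... | no j≮r = FX.F-orthogonal⁺ j r (λ sj≡r → j≮r (ℕ.≤-reflexive sj≡r)) Xe≈

    -- The vanishing of `e` says Yu + sZu = 0. This eliminates `Z` on `u`, leaving only `u` and Yu,
    -- which `G j` maps to known multiples of `w j`.
    sZu≈ : ∀ y → s * (Z ⊛ u) y ≈ - (Y ⊛ u) y
    sZu≈ y = begin
      s * b
        ≈⟨ solve 3 (λ s a b → s :* b
            := con 2ℚ :* (con ½ :* (a :+ (:- (:- s)) :* b)) :- a) C.refl s a b ⟩
      fromℚ 2ℚ * (fromℚ ½ * (a + - - s * b)) + - a
        ≈⟨ C.+-congʳ (C.*-congˡ (C.trans (C.sym (e≈ y)) (e≈0 y))) ⟩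
      fromℚ 2ℚ * fromℕ 0 + - a ≈⟨ solve 1 (λ a → con 2ℚ :* con 0ℚ :- a := :- a) C.refl a ⟩
      - a ∎
      where
      a = (Y ⊛ u) y
      b = (Z ⊛ u) y

  w : ℕ → V D
  w k = G k ⊛ u

  private
    Ru≈ : R ⊛ u ≈ᵥ fromℚ ½ ∙ᵥ (θᶜ D r ∙ᵥ u +ᵥ (- fromℚ 1ℚ) ∙ᵥ Y ⊛ u)
    Ru≈ y = C.trans (raising-⊛ s X Z u y) (C.*-congˡ (C.+-cong (Xu≈ y)
      (C.trans (sZu≈ y) (solve 1 (λ a → :- a := (:- con 1ℚ) :* a) C.refl ((Y ⊛ u) y)))))

    Lu≈ : L ⊛ u ≈ᵥ fromℚ ½ ∙ᵥ (θᶜ D r ∙ᵥ u +ᵥ fromℚ 1ℚ ∙ᵥ Y ⊛ u)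
    Lu≈ y = C.trans (raising-⊛ (- s) X Z u y) (C.*-congˡ (C.+-cong (Xu≈ y)
      (C.trans (solve 2 (λ s b → (:- s) :* b := :- (s :* b)) C.refl s ((Z ⊛ u) y))
        (C.trans (C.-‿cong (sZu≈ y)) (solve 1 (λ a → :- (:- a)
          := con 1ℚ :* a) C.refl ((Y ⊛ u) y))))))

    -- For `c` equal to -1 and 1 the scalar is half the difference and half the sum of `θᶜ D r` and
    -- `θᶜ D j`, namely j - r and D - r - j. These become the two off-diagonals of `B`.
    project : ∀ j c → G j ⊛ fromℚ ½ ∙ᵥ (θᶜ D r ∙ᵥ u +ᵥ c ∙ᵥ Y ⊛ u)
      ≈ᵥ (fromℚ ½ * (θᶜ D r + c * θᶜ D j)) ∙ᵥ w j
    project j c y = begin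
      (G j ⊛ fromℚ ½ ∙ᵥ (θᶜ D r ∙ᵥ u +ᵥ c ∙ᵥ Y ⊛ u)) y
        ≈⟨ ⊛-∙ (G j) (fromℚ ½) (θᶜ D r ∙ᵥ u +ᵥ c ∙ᵥ Y ⊛ u) y ⟩
      fromℚ ½ * (G j ⊛ (θᶜ D r ∙ᵥ u +ᵥ c ∙ᵥ Y ⊛ u)) y
        ≈⟨ C.*-congˡ (C.trans (⊛-+ (G j) (θᶜ D r ∙ᵥ u) (c ∙ᵥ Y ⊛ u) y)
            (C.+-cong (⊛-∙ (G j) (θᶜ D r) u y)
             (C.trans (⊛-∙ (G j) c (Y ⊛ u) y) (C.*-congˡ (SY.coeigen j u y))))) ⟩
      fromℚ ½ * (θᶜ D r * w j y + c * (θᶜ D j * w j y))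
        ≈⟨ solve 4 (λ a c t b → con ½ :* (a :* b :+ c :* (t :* b))
            := (con ½ :* (a :+ c :* t)) :* b) C.refl
             (θᶜ D r) c (θᶜ D j) (w j y) ⟩
      fromℚ ½ * (θᶜ D r + c * θᶜ D j) * w j y ∎

    GRu : ∀ j → G j ⊛ R ⊛ u ≈ᵥ (fromℕ j + - fromℕ r) ∙ᵥ w j
    GRu j y = C.trans (⊛-congʳ (G j) Ru≈ y) (C.trans (project j (- fromℚ 1ℚ) y) (C.*-congʳ
      (C.trans (C.*-congˡ (C.+-cong (θ-expand D r) (C.*-congˡ (θ-expand D j))))
        (solve 3 (λ d r j → con ½ :* ((d :- con 2ℚ :* r) :+ (:- con 1ℚ) :* (d :- con 2ℚ :* j))
          := j :- r) C.refl
          (fromℕ D) (fromℕ r) (fromℕ j)))))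

    GLu : ∀ j → G j ⊛ L ⊛ u ≈ᵥ (fromℕ D + - fromℕ (r ℕ.+ j)) ∙ᵥ w j
    GLu j y = C.trans (⊛-congʳ (G j) Lu≈ y) (C.trans (project j (fromℚ 1ℚ) y) (C.*-congʳ
      (C.trans (C.*-congˡ (C.+-cong (θ-expand D r) (C.*-congˡ (θ-expand D j))))
        (C.trans (solve 3 (λ d r j → con ½ :* ((d :- con 2ℚ :* r) :+ con 1ℚ :* (d :- con 2ℚ :* j))
          := d :- (r :+ j)) C.refl
          (fromℕ D) (fromℕ r) (fromℕ j)) (C.+-congˡ (C.-‿cong (C.sym (fromℕ-+ r j))))))))

  R-w : ∀ k → R ⊛ w k ≈ᵥ (fromℕ (suc k) + - fromℕ r) ∙ᵥ w (suc k)
  R-w k = V.trans (V.sym (F-R k u)) (GRu (suc k))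

  L-w : ∀ k → L ⊛ w (suc k) ≈ᵥ (fromℕ D + - fromℕ (r ℕ.+ k)) ∙ᵥ w k
  L-w k = V.trans (V.sym (F-L k u)) (GLu k)

  private
    -- Vanishing passes along an edge wherever the ladder coefficient is nonzero. The upward
    -- coefficient is 0 only from r - 1 to r; the downward one, in `step-down`, only from D - r + 1
    -- to D - r.
    step-up : ∀ k → suc k ≢ r → w k ≈ᵥ 0ᵥ → w (suc k) ≈ᵥ 0ᵥ
    step-up k sk≢r wk≈0 y = fromℕ-cancel sk≢r (C.trans (C.sym (R-w k y)) (⊛-0 R wk≈0 y))

    step-down : ∀ k → D ≢ r ℕ.+ k → w (suc k) ≈ᵥ 0ᵥ → w k ≈ᵥ 0ᵥ
    step-down k D≢r+k wsk≈0 y = fromℕ-cancel D≢r+k (C.trans (C.sym (L-w k y)) (⊛-0 L wsk≈0 y))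

  -- The image of `R` has no component of index 0, which makes r times `w 0` vanish. The zero then
  -- climbs up to the edge into r.
  w-low : ∀ k → k ℕ.< r → w k ≈ᵥ 0ᵥ
  w-low zero 0<r y = fromℕ-cancel (ℕ.<⇒≢ 0<r) (C.trans (C.sym (GRu 0 y)) (F-R-zero u y))
  w-low (suc k) sk<r = step-up k (ℕ.<⇒≢ sk<r) (w-low k (ℕ.<-trans (ℕ.n<1+n k) sk<r))

  -- Zeros beyond D descend as far as D - r + 1. The counter of `descend` measures how far `k` may
  -- still be from an index beyond D.
  w-high : ∀ k → D ℕ.< r ℕ.+ k → w k ≈ᵥ 0ᵥ
  w-high k = descend (suc D) k (ℕ.m≤m+n (suc D) k)
    where
    descend : ∀ m k → D ℕ.< m ℕ.+ k → D ℕ.< r ℕ.+ k → w k ≈ᵥ 0ᵥ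
    descend zero    k D<k   _     = SY.vanishes D<k u
    descend (suc m) k D<m+k D<r+k = step-down k (ℕ.<⇒≢ D<r+k)
      (descend m (suc k) (subst (D ℕ.<_) (sym (ℕ.+-suc m k)) D<m+k)
        (ℕ.<-≤-trans D<r+k (ℕ.+-monoʳ-≤ r (ℕ.n≤1+n k))))

  -- The exceptional edge into r lies below k and the one down to D - r lies above it. So a zero at
  -- k would spread to every index, and `u` would be 0.
  w-nonZero : ∀ k → r ℕ.≤ k → r ℕ.+ k ℕ.≤ D → ¬ (w k ≈ᵥ 0ᵥ)
  w-nonZero k r≤k r+k≤D wk≈0 = u≉0 (SY.separates all)
    where
    up : ∀ m → w (m ℕ.+ k) ≈ᵥ 0ᵥ
    up zero    = wk≈0
    up (suc m) = step-up (m ℕ.+ k) (λ e → ℕ.<⇒≢ (ℕ.s≤s (ℕ.≤-trans r≤k (ℕ.m≤n+m k m))) (sym e))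
      (up m)
    down : ∀ m j → m ℕ.+ j ≡ k → w j ≈ᵥ 0ᵥ
    down zero    j refl = wk≈0
    down (suc m) j m+j≡k = step-down j
      (λ e → ℕ.<⇒≢ (ℕ.<-≤-trans (ℕ.+-monoʳ-< r (subst (j ℕ.<_) m+j≡k (ℕ.s≤s (ℕ.m≤n+m j m)))) r+k≤D)
        (sym e))
      (down m (suc j) (trans (ℕ.+-suc m j) m+j≡k))
    all : ∀ j → w j ≈ᵥ 0ᵥ
    all j with ℕ.≤-total j k
    ... | inj₁ j≤k = down (k ℕ.∸ j) j (ℕ.m∸n+n≡m j≤k)
    ... | inj₂ k≤j = subst (λ i → w i ≈ᵥ 0ᵥ) (ℕ.m∸n+n≡m k≤j) (up (j ℕ.∸ k))

  -- Otherwise the ranges of `w-low` and `w-high` would together cover all indices.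
  r+r≤D : r ℕ.+ r ℕ.≤ D
  r+r≤D with r ℕ.+ r ℕ.≤? D
  ... | yes p = p
  ... | no p = contradiction (SY.separates all) u≉0
    where
    all : ∀ j → w j ≈ᵥ 0ᵥ
    all j with j ℕ.<? r
    ... | yes j<r = w-low j j<r
    ... | no j≮r = w-high j (ℕ.<-≤-trans (ℕ.≰⇒> p) (ℕ.+-monoʳ-≤ r (ℕ.≮⇒≥ j≮r)))

  -- An equation ties `d` to D because the module serves both for D - 2r, computed by subtraction,
  -- and for the diameter, which is obtained by counting.
  module WithDiameter (d : ℕ) (r+r+d≡D : r ℕ.+ (r ℕ.+ d) ≡ D) where

    b : Fin (suc d) → V D
    b i = w (r ℕ.+ toℕ i)

    private
      b-nonZero : ∀ i → ¬ (b i ≈ᵥ 0ᵥ)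
      b-nonZero i = w-nonZero (r ℕ.+ toℕ i) (ℕ.m≤m+n r (toℕ i))
        (subst (r ℕ.+ (r ℕ.+ toℕ i) ℕ.≤_) r+r+d≡D
          (ℕ.+-monoʳ-≤ r (ℕ.+-monoʳ-≤ r (ℕ.s≤s⁻¹ (Fin.toℕ<n i)))))

      raised : ∀ k → R ⊛ w (r ℕ.+ k) ≈ᵥ fromℕ (suc k) ∙ᵥ w (r ℕ.+ suc k)
      raised k y = begin
        (R ⊛ w (r ℕ.+ k)) y ≈⟨ R-w (r ℕ.+ k) y ⟩
        (fromℕ (suc (r ℕ.+ k)) + - fromℕ r) * w (suc (r ℕ.+ k)) y
          ≡⟨ cong (λ j → (fromℕ j + - fromℕ r) * w j y) (ℕ.+-suc r k) ⟨
        (fromℕ (r ℕ.+ suc k) + - fromℕ r) * w (r ℕ.+ suc k) y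
          ≈⟨ C.*-congʳ (C.+-congʳ (fromℕ-+ r (suc k))) ⟩
        ((fromℕ r + fromℕ (suc k)) + - fromℕ r) * w (r ℕ.+ suc k) y
          ≈⟨ C.*-congʳ (solve 2 (λ r k → (r :+ k) :- r := k) C.refl (fromℕ r) (fromℕ (suc k))) ⟩
        fromℕ (suc k) * w (r ℕ.+ suc k) y ∎

      lowered : ∀ k → k ℕ.≤ d → L ⊛ w (r ℕ.+ suc k) ≈ᵥ fromℕ (d ℕ.∸ k) ∙ᵥ w (r ℕ.+ k)
      lowered k k≤d y = begin
        (L ⊛ w (r ℕ.+ suc k)) y ≡⟨ cong (λ j → (L ⊛ w j) y) (ℕ.+-suc r k) ⟩
        (L ⊛ w (suc (r ℕ.+ k))) y ≈⟨ L-w (r ℕ.+ k) y ⟩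
        (fromℕ D + - fromℕ (r ℕ.+ (r ℕ.+ k))) * w (r ℕ.+ k) y
          ≡⟨ cong (λ j → (fromℕ j + - fromℕ (r ℕ.+ (r ℕ.+ k))) * w (r ℕ.+ k) y) r+r+d≡D ⟨
        (fromℕ (r ℕ.+ (r ℕ.+ d)) + - fromℕ (r ℕ.+ (r ℕ.+ k))) * w (r ℕ.+ k) y
          ≈⟨ C.*-congʳ (C.+-cong (split d) (C.-‿cong (split k))) ⟩
        ((fromℕ r + (fromℕ r + fromℕ d)) + - (fromℕ r + (fromℕ r + fromℕ k))) * w (r ℕ.+ k) y
          ≈⟨ C.*-congʳ (solve 3 (λ r d k → (r :+ (r :+ d)) :- (r :+ (r :+ k)) := d :- k) C.refl
               (fromℕ r) (fromℕ d) (fromℕ k)) ⟩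
        (fromℕ d + - fromℕ k) * w (r ℕ.+ k) y ≈⟨ C.*-congʳ (fromℕ-∸ d k k≤d) ⟨
        fromℕ (d ℕ.∸ k) * w (r ℕ.+ k) y ∎
        where
        split : ∀ k → fromℕ (r ℕ.+ (r ℕ.+ k)) ≈ fromℕ r + (fromℕ r + fromℕ k)
        split k = C.trans (fromℕ-+ r (r ℕ.+ k)) (C.+-congˡ (fromℕ-+ r k))

      -- For positive r the image is a multiple of `w` at r - 1, which is 0 by `w-low`. For r = 0
      -- there is no such vector, and the bound D on the eigenvalues stops the ladder.
      L-bottom : L ⊛ w r ≈ᵥ 0ᵥ
      L-bottom = bottom r refl
        where
        bottom : ∀ k → k ≡ r → L ⊛ w k ≈ᵥ 0ᵥ
        bottom zero    _    = L-F-zero u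
        bottom (suc k) sk≡r y = C.trans (L-w k y)
          (C.trans (C.*-congˡ (w-low k (ℕ.≤-reflexive sk≡r) y)) (C.zeroʳ _))

    module _ (j : Fin (suc d)) (y : Defs.X D) where
      private
        J = toℕ j

        -- Column j of the matrices of `R` and `L` with respect to `b`.
        below-diagonal above-diagonal : Fin (suc d) → ℂ
        below-diagonal i = if does (toℕ i ℕ.≟ suc J) then fromℕ (toℕ i) else fromℕ 0
        above-diagonal i = if does (J ℕ.≟ suc (toℕ i)) then fromℕ (d ℕ.∸ toℕ i) else fromℕ 0

        B-split : ∀ i → B d i j ≈ below-diagonal i + above-diagonal i
        B-split i with toℕ i ℕ.≟ suc J
        ... | yes p = C.trans (if-yes (toℕ i ℕ.≟ suc J) p) (C.sym (C.trans
          (C.+-cong (if-yes (toℕ i ℕ.≟ suc J) p) (if-no (J ℕ.≟ suc (toℕ i))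
            (λ q → ℕ.<⇒≢ (ℕ.m≤n⇒m≤1+n ℕ.≤-refl) (trans q (cong suc p)))))
          (C.+-identityʳ (fromℕ (toℕ i)))))
        ... | no ¬p = C.trans (if-no (toℕ i ℕ.≟ suc J) ¬p) (C.sym (C.trans
          (C.+-congʳ (if-no (toℕ i ℕ.≟ suc J) ¬p)) (C.+-identityˡ (above-diagonal i))))

        sum-below : sum (λ i → below-diagonal i * b i y) ≈ (R ⊛ b j) y
        sum-below = C.trans (sum-at _ (suc J) off on out) (C.sym (raised J y))
          where
          off : ∀ i → toℕ i ≢ suc J → below-diagonal i * b i y ≈ fromℕ 0
          off i i≢ = C.trans (C.*-congʳ (if-no (toℕ i ℕ.≟ suc J) i≢)) (C.zeroˡ (b i y))
          on : ∀ i → toℕ i ≡ suc J → below-diagonal i * b i y ≈ fromℕ (suc J) * w (r ℕ.+ suc J) y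
          on i i≡ = C.trans (C.*-congʳ (if-yes (toℕ i ℕ.≟ suc J) i≡))
            (C.reflexive (cong (λ k → fromℕ k * w (r ℕ.+ k) y) i≡))
          -- In the last column the missing row is d + 1. Its vector has index D - r + 1, just past
          -- the range, and is 0.
          out : suc d ℕ.≤ suc J → fromℕ (suc J) * w (r ℕ.+ suc J) y ≈ fromℕ 0
          out d≤J = C.trans (C.*-congˡ (w-high (r ℕ.+ suc J)
            (subst (ℕ._< r ℕ.+ (r ℕ.+ suc J)) r+r+d≡D (ℕ.+-monoʳ-< r (ℕ.+-monoʳ-< r d≤J))) y))
              (C.zeroʳ _)

        sum-above : sum (λ i → above-diagonal i * b i y) ≈ (L ⊛ b j) y
        sum-above = go J refl
          where
          go : ∀ k → k ≡ J → sum (λ i → above-diagonal i * b i y) ≈ (L ⊛ w (r ℕ.+ k)) y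
          go zero 0≡J = C.trans (sum-zero _ zeros) (C.trans (C.sym (L-bottom y))
            (C.reflexive (cong (λ k → (L ⊛ w k) y) (sym (ℕ.+-identityʳ r)))))
            where
            zeros : ∀ i → above-diagonal i * b i y ≈ fromℕ 0
            zeros i = C.trans (C.*-congʳ (if-no (J ℕ.≟ suc (toℕ i)) (λ p → ℕ.0≢1+n (trans 0≡J p))))
              (C.zeroˡ (b i y))
          go (suc k) sk≡J = C.trans
            (sum-at _ k off on (λ d<k → contradiction (ℕ.<⇒≤ d<k) (ℕ.<⇒≱ sk≤d)))
              (C.sym (lowered k (ℕ.<⇒≤ sk≤d) y))
            where
            sk≤d : suc k ℕ.≤ d
            sk≤d = subst (ℕ._≤ d) (sym sk≡J) (ℕ.s≤s⁻¹ (Fin.toℕ<n j))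
            off : ∀ i → toℕ i ≢ k → above-diagonal i * b i y ≈ fromℕ 0
            off i i≢ = C.trans (C.*-congʳ (if-no (J ℕ.≟ suc (toℕ i))
              (λ p → i≢ (sym (ℕ.suc-injective (trans sk≡J p)))))) (C.zeroˡ (b i y))
            on : ∀ i → toℕ i ≡ k → above-diagonal i * b i y ≈ fromℕ (d ℕ.∸ k) * w (r ℕ.+ k) y
            on i i≡ = C.trans (C.*-congʳ
              (if-yes (J ℕ.≟ suc (toℕ i)) (trans (sym sk≡J) (cong suc (sym i≡)))))
              (C.reflexive (cong (λ k → fromℕ (d ℕ.∸ k) * w (r ℕ.+ k) y) i≡))

      column : (X ⊛ b j) y ≈ combination (λ i → B d i j) b y
      column = begin
        (X ⊛ b j) y ≈⟨ R+L (b j) y ⟩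
        (R ⊛ b j) y + (L ⊛ b j) y ≈⟨ C.+-cong sum-below sum-above ⟨
        sum (λ i → below-diagonal i * b i y) + sum (λ i → above-diagonal i * b i y)
          ≈⟨ ∑-distrib-+ (λ i → below-diagonal i * b i y) (λ i → above-diagonal i * b i y) ⟨
        sum (λ i → below-diagonal i * b i y + above-diagonal i * b i y)
          ≈⟨ sum-cong-≋ (λ i → C.trans (C.*-congʳ (B-split i))
              (C.distribʳ (b i y) (below-diagonal i) (above-diagonal i))) ⟨
        combination (λ i → B d i j) b y ∎

    b∈W : ∀ i → b i ∈ W
    b∈W i = G-closed (r ℕ.+ toℕ i) u∈W

    private
      -- Applying the idempotent of index r + i isolates `c i` times `b i`. Of `b i` it is only
      -- known that it is not 0, so the argument runs backwards: a nonzero `c i` would force `b i`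
      -- to be 0.
      independent : ∀ c → combination c b ≈ᵥ 0ᵥ → ∀ i → c i ≈ fromℕ 0
      independent c comb≈0 i = ≈0-stable λ ci≉0 → b-nonZero i λ y → no-zero-divisors (cb≈0 y) ci≉0
        where
        Gi = G (r ℕ.+ toℕ i)
        off : ∀ y j → j ≢ i → c j * (Gi ⊛ b j) y ≈ fromℕ 0
        off y j j≢i = C.trans (C.*-congˡ (FY.F-orthogonal (r ℕ.+ toℕ i) (r ℕ.+ toℕ j)
          (λ e → j≢i (sym (Fin.toℕ-injective (ℕ.+-cancelˡ-≡ r _ _ e))))
            (SY.eigen (r ℕ.+ toℕ j) u) y)) (C.zeroʳ _)
        cb≈0 : ∀ y → c i * b i y ≈ fromℕ 0
        cb≈0 y = begin
          c i * b i y ≈⟨ C.*-congˡ (SY.idempotent (r ℕ.+ toℕ i) u y) ⟨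
          c i * (Gi ⊛ b i) y ≈⟨ sum-single (λ j → c j * (Gi ⊛ b j) y) i (off y) ⟨
          combination c (λ j → Gi ⊛ b j) y ≈⟨ ⊛-combination Gi c b y ⟨
          (Gi ⊛ combination c b) y ≈⟨ ⊛-0 Gi comb≈0 y ⟩
          fromℕ 0 ∎

      X-Span : Closed X (Span b)
      X-Span = Span-closed X b (λ j → (λ i → B d i j) , column j)

      Y-Span : Closed Y (Span b)
      Y-Span = Span-closed Y b
        (λ j → respects (V.sym (SY.eigen (r ℕ.+ toℕ j) u))
          (∙ᵥ-closed (θᶜ D (r ℕ.+ toℕ j)) (Span-∋ b j)))
        where open IsSubspace (Span-isSubspace b)

      Span⊆W : Span b ⊆ W
      Span⊆W (c , v≈) = IsSubspace.respects isSubspace (V.sym v≈) (combination-∈ isSubspace c b∈W)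

      spanning : W ⊆ Span b
      spanning = minimal {U = Span b} (Span-isSubspace b) X-Span Y-Span
        (third-closed t {U = Span b} (Span-isSubspace b) X-Span Y-Span) Span⊆W
          (b zero , Span-∋ b zero , b-nonZero zero)

    represents : Represents W (B d) X b
    represents = record
      { isBasis = record { belongs = b∈W ; independent = independent ; spanning = spanning }
      ; columns = λ j y → column j y
      }

    -- A basis of `Y`-eigenvectors exhibits every index of `Y` on W. In this way the bound r passes
    -- from one matrix to another, and the diameter can be counted.
    G-vanishes : ∀ k → (∀ (i : Fin (suc d)) → k ≢ r ℕ.+ toℕ i) → ∀ {v} → v ∈ W → G k ⊛ v ≈ᵥ 0ᵥ
    G-vanishes k k≢ {v} v∈W = on-span (spanning v∈W)
      where
      on-span : Span b v → G k ⊛ v ≈ᵥ 0ᵥ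
      on-span (c , v≈) = V.trans (⊛-congʳ (G k) v≈) (V.trans (⊛-combination (G k) c b)
        (λ y → sum-zero (λ i → c i * (G k ⊛ b i) y) (λ i → C.trans
          (C.*-congˡ (FY.F-orthogonal k (r ℕ.+ toℕ i) (k≢ i) (SY.eigen (r ℕ.+ toℕ i) u) y))
            (C.zeroʳ (c i)))))

-- The cube

-- M acts as a sum over the D coordinates of one 2 × 2 monomial matrix, with
-- entry ω a in position (a, π a).
record IsLocal (ω : Fin 2 → ℂ) (π : Fin 2 → Fin 2) (M : ∀ {D} → Mat D) : Set where
  field
    nil  : ∀ v → (M {0} ⊛ v) [] ≈ fromℕ 0
    cons : ∀ {D} v a (y : X D) → (M ⊛ v) (a ∷ y) ≈ ω a * v (π a ∷ y) + (M ⊛ v ↾ a) y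

opposite : Fin 2 → Fin 2
opposite 0F = 1F
opposite 1F = 0F

sign : Fin 2 → ℂ
sign 0F = fromℚ 1ℚ
sign 1F = fromℚ (ℚ.- 1ℚ)

phase : Fin 2 → ℂ
phase 0F = 𝐢
phase 1F = - 𝐢

A-isLocal : IsLocal (λ _ → fromℚ 1ℚ) opposite A
A-isLocal = record { nil = λ v → C.zeroˡ (v []) ; cons = cons }
  where
  open ℂ-Solver
  -- A neighbour across the first coordinate agrees in all others, so the corresponding block of `A`
  -- is the identity.
  same-vertex : ∀ {D} (y z : X D) →
    (if does (#differences y z ℕ.≟ 0) then fromℕ 1 else fromℕ 0) ≈ I y z
  same-vertex []       []       = C.refl
  same-vertex (0F ∷ y) (0F ∷ z) = same-vertex y z
  same-vertex (1F ∷ y) (1F ∷ z) = same-vertex y z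
  same-vertex (0F ∷ y) (1F ∷ z) = C.refl
  same-vertex (1F ∷ y) (0F ∷ z) = C.refl
  crossing : ∀ {D} (v : V D) y →
    ∑ˣ (λ z → (if does (#differences y z ℕ.≟ 0) then fromℕ 1 else fromℕ 0) * v z) ≈ v y
  crossing v y = C.trans (∑ˣ-cong (λ z → C.*-congʳ (same-vertex y z))) (I-⊛ v y)
  cons : ∀ {D} v a (y : X D) → (A ⊛ v) (a ∷ y) ≈ fromℚ 1ℚ * v (opposite a ∷ y) + (A ⊛ v ↾ a) y
  cons v 0F y = C.trans (C.+-congˡ (C.+-congʳ (crossing (v ↾ 1F) y)))
    (solve 2 (λ a b → a :+ (b :+ con 0ℚ) := con 1ℚ :* b :+ a) C.refl ((A ⊛ v ↾ 0F) y) (v (1F ∷ y)))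
  cons v 1F y = C.trans (C.+-congʳ (crossing (v ↾ 0F) y))
    (solve 2 (λ a b → b :+ (a :+ con 0ℚ) := con 1ℚ :* b :+ a) C.refl ((A ⊛ v ↾ 1F) y) (v (0F ∷ y)))

A*-⊛ : ∀ (v : V D) y → (A* ⊛ v) y ≈ θᶜ D (∂ 𝟎 y) * v y
A*-⊛ {D} v y = diagonal-⊛ (λ y → θᶜ D (∂ 𝟎 y)) v y

E*-⊛ : ∀ k (v : V D) y → (E* k ⊛ v) y ≈ (if does (∂ 𝟎 y ℕ.≟ k) then fromℕ 1 else fromℕ 0) * v y
E*-⊛ k v y = diagonal-⊛ (λ y → if does (∂ 𝟎 y ℕ.≟ k) then fromℕ 1 else fromℕ 0) v y

-- D - 2∂ is a sum over the coordinates, with 1 for each coordinate 0 and -1 for each coordinate 1.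
A*-isLocal : IsLocal sign (λ a → a) A*
A*-isLocal = record { nil = λ v → C.zeroˡ (v []) ; cons = cons }
  where
  open ℂ-Solver
  dimension : ∀ D k → θᶜ (suc D) k ≈ θᶜ D k + fromℚ 1ℚ
  dimension D k = C.trans (θ-expand (suc D) k) (C.trans (C.+-congʳ (fromℕ-suc D))
    (C.trans (solve 2 (λ d k → (con 1ℚ :+ d) :- con 2ℚ :* k
      := (d :- con 2ℚ :* k) :+ con 1ℚ) C.refl (fromℕ D) (fromℕ k))
      (C.+-congʳ (C.sym (θ-expand D k)))))
  split : ∀ {D} a (y : X D) → θᶜ (suc D) (∂ 𝟎 (a ∷ y)) ≈ θᶜ D (∂ 𝟎 y) + sign a
  split {D} 0F y = dimension D (∂ 𝟎 y)
  split {D} 1F y = C.trans (dimension D (suc (∂ 𝟎 y))) (C.trans (C.+-congʳ (θ-suc D (∂ 𝟎 y)))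
    (solve 1 (λ t → (t :- con 2ℚ) :+ con 1ℚ := t :+ con (ℚ.- 1ℚ)) C.refl (θᶜ D (∂ 𝟎 y))))
  cons : ∀ {D} v a (y : X D) → (A* ⊛ v) (a ∷ y) ≈ sign a * v (a ∷ y) + (A* ⊛ v ↾ a) y
  cons {D} v a y = begin
    (A* ⊛ v) (a ∷ y) ≈⟨ A*-⊛ v (a ∷ y) ⟩
    θᶜ (suc D) (∂ 𝟎 (a ∷ y)) * v (a ∷ y) ≈⟨ C.*-congʳ (split a y) ⟩
    (θᶜ D (∂ 𝟎 y) + sign a) * v (a ∷ y)
      ≈⟨ solve 3 (λ t s b → (t :+ s) :* b := s :* b :+ t :* b) C.refl
      (θᶜ D (∂ 𝟎 y)) (sign a) (v (a ∷ y)) ⟩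
    sign a * v (a ∷ y) + θᶜ D (∂ 𝟎 y) * v (a ∷ y) ≈⟨ C.+-congˡ (A*-⊛ (v ↾ a) y) ⟨
    sign a * v (a ∷ y) + (A* ⊛ v ↾ a) y ∎

Aᵋ-⊛ : ∀ (v : V D) y → (Aᵋ ⊛ v) y ≈ (- 𝐢 * fromℚ ½) * ((A ⊛ A* ⊛ v) y + - (A* ⊛ A ⊛ v) y)
Aᵋ-⊛ v y = begin
  (Aᵋ ⊛ v) y ≈⟨ ∙ₘ-⊛ (- 𝐢 * fromℚ ½) (A *ₘ A* -ₘ A* *ₘ A) v y ⟩
  (- 𝐢 * fromℚ ½) * ((A *ₘ A* -ₘ A* *ₘ A) ⊛ v) y
    ≈⟨ C.*-congˡ (C.trans (⊛-congˡ (-ₘ-+ₘ (A *ₘ A*) (A* *ₘ A)) v y)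
         (C.trans (+ₘ-⊛ (A *ₘ A*) ((- fromℚ 1ℚ) ∙ₘ (A* *ₘ A)) v y) (C.+-cong (*ₘ-⊛ A A* v y)
           (C.trans (∙ₘ-⊛ (- fromℚ 1ℚ) (A* *ₘ A) v y) (C.*-congˡ (*ₘ-⊛ A* A v y)))))) ⟩
  (- 𝐢 * fromℚ ½) * ((A ⊛ A* ⊛ v) y + - fromℚ 1ℚ * (A* ⊛ A ⊛ v) y)
    ≈⟨ C.*-congˡ (solve 2 (λ a b → a :+ (:- con 1ℚ) :* b
        := a :- b) C.refl ((A ⊛ A* ⊛ v) y) ((A* ⊛ A ⊛ v) y)) ⟩
  (- 𝐢 * fromℚ ½) * ((A ⊛ A* ⊛ v) y + - (A* ⊛ A ⊛ v) y) ∎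
  where open ℂ-Solver

-- Terms of `A` and `A*` at different coordinates commute, so the commutator is again a sum over
-- single coordinates; `weight` computes its entry at one of them.
Aᵋ-isLocal : IsLocal phase opposite Aᵋ
Aᵋ-isLocal = record { nil = nil ; cons = cons }
  where
  module A = IsLocal A-isLocal
  module A* = IsLocal A*-isLocal
  open ℂ-Solver
  nil : ∀ v → (Aᵋ {0} ⊛ v) [] ≈ fromℕ 0
  nil v = C.trans (Aᵋ-⊛ v [])
    (C.trans (C.*-congˡ (C.+-cong (A.nil (A* ⊛ v)) (C.-‿cong (A*.nil (A ⊛ v)))))
    (solve 1 (λ c → c :* (con 0ℚ :- con 0ℚ) := con 0ℚ) C.refl (- 𝐢 * fromℚ ½)))
  weight : ∀ a → (- 𝐢 * fromℚ ½) * (sign (opposite a) + - sign a) ≈ phase a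
  weight 0F = solve 1 (λ i → (:- i :* con ½) :* (con (ℚ.- 1ℚ) :- con 1ℚ) := i) C.refl 𝐢
  weight 1F = solve 1 (λ i → (:- i :* con ½) :* (con 1ℚ :- con (ℚ.- 1ℚ)) := :- i) C.refl 𝐢
  cons : ∀ {D} v a (y : X D) → (Aᵋ ⊛ v) (a ∷ y) ≈ phase a * v (opposite a ∷ y) + (Aᵋ ⊛ v ↾ a) y
  cons v a y = begin
    (Aᵋ ⊛ v) (a ∷ y) ≈⟨ Aᵋ-⊛ v (a ∷ y) ⟩
    c * ((A ⊛ A* ⊛ v) (a ∷ y) + - (A* ⊛ A ⊛ v) (a ∷ y)) ≈⟨ C.*-congˡ (C.+-cong AA* (C.-‿cong A*A)) ⟩
    c * ((fromℚ 1ℚ * (s′ * x + p) + (s * q + f)) + - (s * (fromℚ 1ℚ * x + q) + (fromℚ 1ℚ * p + g)))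
      ≈⟨ solve 8 (λ c s s′ x p q f g →
           c :* ((con 1ℚ :* (s′ :* x :+ p) :+ (s :* q :+ f)) :-
             (s :* (con 1ℚ :* x :+ q) :+ (con 1ℚ :* p :+ g)))
             := (c :* (s′ :- s)) :* x :+ c :* (f :- g)) C.refl c s s′ x p q f g ⟩
    (c * (s′ + - s)) * x + c * (f + - g)
      ≈⟨ C.+-cong (C.*-congʳ (weight a)) (C.sym (Aᵋ-⊛ (v ↾ a) y)) ⟩
    phase a * x + (Aᵋ ⊛ v ↾ a) y ∎
    where
    c = - 𝐢 * fromℚ ½
    s = sign a
    s′ = sign (opposite a)
    x = v (opposite a ∷ y)
    p = (A* ⊛ v ↾ opposite a) y
    q = (A ⊛ v ↾ a) y
    f = (A ⊛ A* ⊛ v ↾ a) y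
    g = (A* ⊛ A ⊛ v ↾ a) y
    AA* : (A ⊛ A* ⊛ v) (a ∷ y) ≈ fromℚ 1ℚ * (s′ * x + p) + (s * q + f)
    AA* = C.trans (A.cons (A* ⊛ v) a y) (C.+-cong (C.*-congˡ (A*.cons v (opposite a) y))
      (C.trans (⊛-congʳ A (A*.cons v a) y) (C.trans (⊛-+ A (s ∙ᵥ v ↾ a) (A* ⊛ v ↾ a) y)
        (C.+-congʳ (⊛-∙ A s (v ↾ a) y)))))
    A*A : (A* ⊛ A ⊛ v) (a ∷ y) ≈ s * (fromℚ 1ℚ * x + q) + (fromℚ 1ℚ * p + g)
    A*A = C.trans (A*.cons (A ⊛ v) a y) (C.+-cong (C.*-congˡ (A.cons v a y))
      (C.trans (⊛-congʳ A* (A.cons v a) y)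
        (C.trans (⊛-+ A* (fromℚ 1ℚ ∙ᵥ v ↾ opposite a) (A ⊛ v ↾ a) y)
        (C.+-congʳ (⊛-∙ A* (fromℚ 1ℚ) (v ↾ opposite a) y)))))

-- Kronecker powers and conjugation by `P`

⊗-cons : ∀ (m : Fin 2 → Fin 2 → ℂ) v a (y : X D) →
  ((m ^⊗) ⊛ v) (a ∷ y) ≈ m a 0F * ((m ^⊗) ⊛ v ↾ 0F) y + m a 1F * ((m ^⊗) ⊛ v ↾ 1F) y
⊗-cons m v a y = C.trans (C.+-cong (factor 0F) (C.+-congʳ (factor 1F)))
    (solve 2 (λ a b → a :+ (b :+ con 0ℚ) := a :+ b) C.refl _ _)
  where
  open ℂ-Solver
  factor : ∀ b → ∑ˣ (λ z → (m a b * (m ^⊗) y z) * v (b ∷ z)) ≈ m a b * ((m ^⊗) ⊛ v ↾ b) y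
  factor b = C.trans (∑ˣ-cong (λ z → C.*-assoc (m a b) ((m ^⊗) y z) (v (b ∷ z))))
    (C.sym (∑ˣ-* (m a b) (λ z → (m ^⊗) y z * v (b ∷ z))))

-- A Kronecker power applies the same 2 × 2 matrix to each coordinate, so induction on the
-- coordinates reduces everything to one identity between 2 × 2 matrices.
⊗-intertwines : ∀ {ω ω′ π π′} {M M′ : ∀ {D} → Mat D} (m : Fin 2 → Fin 2 → ℂ) →
  IsLocal ω π M → IsLocal ω′ π′ M′ →
  (∀ a (x : Fin 2 → ℂ) → ω a * (m (π a) 0F * x 0F + m (π a) 1F * x 1F)
     ≈ m a 0F * (ω′ 0F * x (π′ 0F)) + m a 1F * (ω′ 1F * x (π′ 1F))) →
  ∀ {D} (v : V D) → M ⊛ (m ^⊗) ⊛ v ≈ᵥ (m ^⊗) ⊛ M′ ⊛ v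
⊗-intertwines {ω} {ω′} {π} {π′} {M} {M′} m ML M′L local = go
  where
  module M = IsLocal ML
  module M′ = IsLocal M′L
  open ℂ-Solver
  go : ∀ {D} (v : V D) → M ⊛ (m ^⊗) ⊛ v ≈ᵥ (m ^⊗) ⊛ M′ ⊛ v
  go v [] = C.trans (M.nil ((m ^⊗) ⊛ v)) (C.sym (C.trans (C.*-identityˡ _) (M′.nil v)))
  go v (a ∷ y) = begin
    (M ⊛ (m ^⊗) ⊛ v) (a ∷ y) ≈⟨ M.cons ((m ^⊗) ⊛ v) a y ⟩
    ω a * ((m ^⊗) ⊛ v) (π a ∷ y) + (M ⊛ ((m ^⊗) ⊛ v) ↾ a) y
      ≈⟨ C.+-cong (C.*-congˡ (⊗-cons m v (π a) y)) (C.trans (⊛-congʳ M (⊗-cons m v a) y)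
           (C.trans (⊛-+ M (m a 0F ∙ᵥ (m ^⊗) ⊛ v ↾ 0F) (m a 1F ∙ᵥ (m ^⊗) ⊛ v ↾ 1F) y)
             (C.+-cong (⊛-∙ M (m a 0F) ((m ^⊗) ⊛ v ↾ 0F) y)
               (⊛-∙ M (m a 1F) ((m ^⊗) ⊛ v ↾ 1F) y)))) ⟩
    ω a * (m (π a) 0F * x 0F + m (π a) 1F * x 1F) +
      (m a 0F * (M ⊛ (m ^⊗) ⊛ v ↾ 0F) y + m a 1F * (M ⊛ (m ^⊗) ⊛ v ↾ 1F) y)
      ≈⟨ C.+-cong (local a x) (C.+-cong (C.*-congˡ (go (v ↾ 0F) y)) (C.*-congˡ (go (v ↾ 1F) y))) ⟩
    (m a 0F * (ω′ 0F * x (π′ 0F)) + m a 1F * (ω′ 1F * x (π′ 1F))) +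
      (m a 0F * ((m ^⊗) ⊛ M′ ⊛ v ↾ 0F) y + m a 1F * ((m ^⊗) ⊛ M′ ⊛ v ↾ 1F) y)
      ≈⟨ solve 6 (λ m₀ m₁ s t p q → (m₀ :* s :+ m₁ :* t) :+ (m₀ :* p :+ m₁ :* q)
          := m₀ :* (s :+ p) :+ m₁ :* (t :+ q)) C.refl
           (m a 0F) (m a 1F) _ _ _ _ ⟩
    m a 0F * (ω′ 0F * x (π′ 0F) + ((m ^⊗) ⊛ M′ ⊛ v ↾ 0F) y) + m a 1F *
      (ω′ 1F * x (π′ 1F) + ((m ^⊗) ⊛ M′ ⊛ v ↾ 1F) y)
      ≈⟨ C.+-cong (C.*-congˡ (image 0F)) (C.*-congˡ (image 1F)) ⟨
    m a 0F * ((m ^⊗) ⊛ (M′ ⊛ v) ↾ 0F) y + m a 1F * ((m ^⊗) ⊛ (M′ ⊛ v) ↾ 1F) y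
      ≈⟨ ⊗-cons m (M′ ⊛ v) a y ⟨
    ((m ^⊗) ⊛ M′ ⊛ v) (a ∷ y) ∎
    where
    x : Fin 2 → ℂ
    x b = ((m ^⊗) ⊛ v ↾ b) y
    image : ∀ b → ((m ^⊗) ⊛ (M′ ⊛ v) ↾ b) y ≈ ω′ b * x (π′ b) + ((m ^⊗) ⊛ M′ ⊛ v ↾ b) y
    image b = C.trans (⊛-congʳ (m ^⊗) (M′.cons v b) y)
      (C.trans (⊛-+ (m ^⊗) (ω′ b ∙ᵥ v ↾ π′ b) (M′ ⊛ v ↾ b) y)
        (C.+-congʳ (⊛-∙ (m ^⊗) (ω′ b) (v ↾ π′ b) y)))

𝐢𝐢z : ∀ z → 𝐢 * 𝐢 * z ≈ - z
𝐢𝐢z z = C.trans (C.*-congʳ 𝐢*𝐢) (solve 1 (λ z → (:- con 1ℚ) :* z := :- z) C.refl z)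
  where open ℂ-Solver

-- The columns of `P₁⁻¹` are eigenvectors of the coordinate flip for 1 and -1. Together with the
-- next two lemmas, conjugation by `P` carries `A` to `A*`, `A*` to `Aᵋ` and `Aᵋ` to `A`.
A-P⁻¹ : ∀ (v : V D) → A ⊛ P⁻¹ ⊛ v ≈ᵥ P⁻¹ ⊛ A* ⊛ v
A-P⁻¹ = ⊗-intertwines P₁⁻¹ A-isLocal A*-isLocal local
  where
  open ℂ-Solver
  local : ∀ a (x : Fin 2 → ℂ) →
    fromℚ 1ℚ * (P₁⁻¹ (opposite a) 0F * x 0F + P₁⁻¹ (opposite a) 1F * x 1F)
     ≈ P₁⁻¹ a 0F * (sign 0F * x 0F) + P₁⁻¹ a 1F * (sign 1F * x 1F)
  local 0F x = solve 3 (λ i p q → con 1ℚ :* (con ½ :* p :+ (con ½ :* (:- i)) :* q)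
    := con ½ :* (con 1ℚ :* p) :+ (con ½ :* i) :* (con (ℚ.- 1ℚ) :* q)) C.refl 𝐢 (x 0F) (x 1F)
  local 1F x = solve 3 (λ i p q → con 1ℚ :* (con ½ :* p :+ (con ½ :* i) :* q)
    := con ½ :* (con 1ℚ :* p) :+ (con ½ :* (:- i)) :* (con (ℚ.- 1ℚ) :* q)) C.refl 𝐢 (x 0F) (x 1F)

Aᵋ-P⁻¹ : ∀ (v : V D) → Aᵋ ⊛ P⁻¹ ⊛ v ≈ᵥ P⁻¹ ⊛ A ⊛ v
Aᵋ-P⁻¹ = ⊗-intertwines P₁⁻¹ Aᵋ-isLocal A-isLocal local
  where
  open ℂ-Solver
  local : ∀ a (x : Fin 2 → ℂ) →
    phase a * (P₁⁻¹ (opposite a) 0F * x 0F + P₁⁻¹ (opposite a) 1F * x 1F)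
     ≈ P₁⁻¹ a 0F * (fromℚ 1ℚ * x 1F) + P₁⁻¹ a 1F * (fromℚ 1ℚ * x 0F)
  local 0F x = begin
    𝐢 * (fromℚ ½ * x 0F + fromℚ ½ * - 𝐢 * x 1F)
      ≈⟨ solve 3 (λ i p q → i :* (con ½ :* p :+ (con ½ :* (:- i)) :* q)
          := con ½ :* (i :* p :- i :* i :* q)) C.refl 𝐢 (x 0F) (x 1F) ⟩
    fromℚ ½ * (𝐢 * x 0F + - (𝐢 * 𝐢 * x 1F)) ≈⟨ C.*-congˡ (C.+-congˡ (C.-‿cong (𝐢𝐢z (x 1F)))) ⟩
    fromℚ ½ * (𝐢 * x 0F + - (- x 1F))
      ≈⟨ solve 3 (λ i p q → con ½ :* (i :* p :- (:- q))
          := con ½ :* (con 1ℚ :* q) :+ (con ½ :* i) :* (con 1ℚ :* p)) C.refl 𝐢 (x 0F) (x 1F) ⟩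
    fromℚ ½ * (fromℚ 1ℚ * x 1F) + fromℚ ½ * 𝐢 * (fromℚ 1ℚ * x 0F) ∎
  local 1F x = begin
    - 𝐢 * (fromℚ ½ * x 0F + fromℚ ½ * 𝐢 * x 1F)
      ≈⟨ solve 3 (λ i p q → :- i :* (con ½ :* p :+ (con ½ :* i) :* q)
          := con ½ :* (:- (i :* p) :- i :* i :* q)) C.refl 𝐢 (x 0F) (x 1F) ⟩
    fromℚ ½ * (- (𝐢 * x 0F) + - (𝐢 * 𝐢 * x 1F)) ≈⟨ C.*-congˡ (C.+-congˡ (C.-‿cong (𝐢𝐢z (x 1F)))) ⟩
    fromℚ ½ * (- (𝐢 * x 0F) + - (- x 1F))
      ≈⟨ solve 3 (λ i p q → con ½ :* (:- (i :* p) :- (:- q))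
          := con ½ :* (con 1ℚ :* q) :+ (con ½ :* (:- i)) :* (con 1ℚ :* p)) C.refl 𝐢 (x 0F) (x 1F) ⟩
    fromℚ ½ * (fromℚ 1ℚ * x 1F) + fromℚ ½ * - 𝐢 * (fromℚ 1ℚ * x 0F) ∎

A*-P⁻¹ : ∀ (v : V D) → A* ⊛ P⁻¹ ⊛ v ≈ᵥ P⁻¹ ⊛ Aᵋ ⊛ v
A*-P⁻¹ = ⊗-intertwines P₁⁻¹ A*-isLocal Aᵋ-isLocal local
  where
  open ℂ-Solver
  local : ∀ a (x : Fin 2 → ℂ) → sign a * (P₁⁻¹ a 0F * x 0F + P₁⁻¹ a 1F * x 1F)
     ≈ P₁⁻¹ a 0F * (𝐢 * x 1F) + P₁⁻¹ a 1F * (- 𝐢 * x 0F)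
  local 0F x = begin
    fromℚ 1ℚ * (fromℚ ½ * x 0F + fromℚ ½ * 𝐢 * x 1F)
      ≈⟨ solve 3 (λ i p q → con 1ℚ :* (con ½ :* p :+ (con ½ :* i) :* q)
          := con ½ :* (i :* q :- (:- p))) C.refl 𝐢 (x 0F) (x 1F) ⟩
    fromℚ ½ * (𝐢 * x 1F + - (- x 0F)) ≈⟨ C.*-congˡ (C.+-congˡ (C.-‿cong (𝐢𝐢z (x 0F)))) ⟨
    fromℚ ½ * (𝐢 * x 1F + - (𝐢 * 𝐢 * x 0F))
      ≈⟨ solve 3 (λ i p q → con ½ :* (i :* q :- i :* i :* p)
          := con ½ :* (i :* q) :+ (con ½ :* i) :* ((:- i) :* p)) C.refl 𝐢 (x 0F) (x 1F) ⟩
    fromℚ ½ * (𝐢 * x 1F) + fromℚ ½ * 𝐢 * (- 𝐢 * x 0F) ∎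
  local 1F x = begin
    fromℚ (ℚ.- 1ℚ) * (fromℚ ½ * x 0F + fromℚ ½ * - 𝐢 * x 1F)
      ≈⟨ solve 3 (λ i p q → con (ℚ.- 1ℚ) :* (con ½ :* p :+ (con ½ :* (:- i)) :* q)
          := con ½ :* (i :* q :+ (:- p))) C.refl 𝐢 (x 0F) (x 1F) ⟩
    fromℚ ½ * (𝐢 * x 1F + - x 0F) ≈⟨ C.*-congˡ (C.+-congˡ (𝐢𝐢z (x 0F))) ⟨
    fromℚ ½ * (𝐢 * x 1F + 𝐢 * 𝐢 * x 0F)
      ≈⟨ solve 3 (λ i p q → con ½ :* (i :* q :+ i :* i :* p)
          := con ½ :* (i :* q) :+ (con ½ :* (:- i)) :* ((:- i) :* p)) C.refl 𝐢 (x 0F) (x 1F) ⟩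
    fromℚ ½ * (𝐢 * x 1F) + fromℚ ½ * - 𝐢 * (- 𝐢 * x 0F) ∎

P⁻¹-P : ∀ (v : V D) → P⁻¹ ⊛ P ⊛ v ≈ᵥ v
P⁻¹-P v = V.trans (V.sym (*ₘ-⊛ P⁻¹ P v)) (V.trans (⊛-congˡ P-inverseˡ v) (I-⊛ v))

P-P⁻¹ : ∀ (v : V D) → P ⊛ P⁻¹ ⊛ v ≈ᵥ v
P-P⁻¹ v = V.trans (V.sym (*ₘ-⊛ P P⁻¹ v)) (V.trans (⊛-congˡ P-inverseʳ v) (I-⊛ v))

Intertwined : Mat D → Mat D → Set
Intertwined {D} M M′ = ∀ (v : V D) → M ⊛ P⁻¹ ⊛ v ≈ᵥ P⁻¹ ⊛ M′ ⊛ v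

commutator-transport : ∀ {X Y Z X′ Y′ Z′ : Mat D} c → Intertwined X′ X → Intertwined Y′ Y →
  Intertwined Z′ Z →
  (∀ v → X ⊛ Y ⊛ v ≈ᵥ Y ⊛ X ⊛ v +ᵥ c ∙ᵥ Z ⊛ v) →
  ∀ v → X′ ⊛ Y′ ⊛ v ≈ᵥ Y′ ⊛ X′ ⊛ v +ᵥ c ∙ᵥ Z′ ⊛ v
commutator-transport {X = X} {Y} {Z} {X′} {Y′} {Z′} c pX pY pZ XY v y = begin
  (X′ ⊛ Y′ ⊛ v) y ≈⟨ product pX pY y ⟩
  (P⁻¹ ⊛ X ⊛ Y ⊛ w) y ≈⟨ ⊛-congʳ P⁻¹ (XY w) y ⟩
  (P⁻¹ ⊛ (Y ⊛ X ⊛ w +ᵥ c ∙ᵥ Z ⊛ w)) y ≈⟨ ⊛-+ P⁻¹ (Y ⊛ X ⊛ w) (c ∙ᵥ Z ⊛ w) y ⟩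
  (P⁻¹ ⊛ Y ⊛ X ⊛ w) y + (P⁻¹ ⊛ c ∙ᵥ Z ⊛ w) y
    ≈⟨ C.+-cong (C.sym (product pY pX y))
        (C.trans (⊛-∙ P⁻¹ c (Z ⊛ w) y) (C.*-congˡ (C.sym (single pZ y)))) ⟩
  (Y′ ⊛ X′ ⊛ v) y + c * (Z′ ⊛ v) y ∎
  where
  w = P ⊛ v
  single : ∀ {M M′} → Intertwined M′ M → M′ ⊛ v ≈ᵥ P⁻¹ ⊛ M ⊛ w
  single {M} {M′} p = V.trans (⊛-congʳ M′ (V.sym (P⁻¹-P v))) (p w)
  product : ∀ {M M′ N N′} → Intertwined M′ M → Intertwined N′ N → M′ ⊛ N′ ⊛ v ≈ᵥ P⁻¹ ⊛ M ⊛ N ⊛ w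
  product {M′ = M′} {N} p q = V.trans (⊛-congʳ M′ (single q)) (p (N ⊛ w))

-- Only `XY` is computed: it is the definition of `Aᵋ` solved for the commutator. Conjugation
-- permutes the three matrices cyclically and carries it to `ZX` and then to `YZ`.
A-triple : IsTriple 𝐢 A A* (Aᵋ {D})
A-triple {D} = record { s² = 𝐢*𝐢 ; XY = XY ; YZ = YZ ; ZX = ZX }
  where
  open ℂ-Solver
  XY : ∀ (v : V D) → A ⊛ A* ⊛ v ≈ᵥ A* ⊛ A ⊛ v +ᵥ (fromℚ 2ℚ * 𝐢) ∙ᵥ Aᵋ ⊛ v
  XY v y = begin
    p ≈⟨ solve 2 (λ p q → p := q :- (:- (p :- q))) C.refl p q ⟩
    q + - (- (p + - q)) ≈⟨ C.+-congˡ (C.-‿cong (𝐢𝐢z (p + - q))) ⟨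
    q + - (𝐢 * 𝐢 * (p + - q))
      ≈⟨ solve 3 (λ p q i → q :- i :* i :* (p :- q)
          := q :+ con 2ℚ :* i :* (((:- i) :* con ½) :* (p :- q))) C.refl p q 𝐢 ⟩
    q + fromℚ 2ℚ * 𝐢 * ((- 𝐢 * fromℚ ½) * (p + - q)) ≈⟨ C.+-congˡ (C.*-congˡ (Aᵋ-⊛ v y)) ⟨
    q + fromℚ 2ℚ * 𝐢 * (Aᵋ ⊛ v) y ∎
    where
    p = (A ⊛ A* ⊛ v) y
    q = (A* ⊛ A ⊛ v) y
  ZX : ∀ (v : V D) → Aᵋ ⊛ A ⊛ v ≈ᵥ A ⊛ Aᵋ ⊛ v +ᵥ (fromℚ 2ℚ * 𝐢) ∙ᵥ A* ⊛ v
  ZX = commutator-transport (fromℚ 2ℚ * 𝐢) Aᵋ-P⁻¹ A-P⁻¹ A*-P⁻¹ XY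
  YZ : ∀ (v : V D) → A* ⊛ Aᵋ ⊛ v ≈ᵥ Aᵋ ⊛ A* ⊛ v +ᵥ (fromℚ 2ℚ * 𝐢) ∙ᵥ A ⊛ v
  YZ = commutator-transport (fromℚ 2ℚ * 𝐢) A*-P⁻¹ Aᵋ-P⁻¹ A-P⁻¹ ZX

-- The three families of idempotents

∂𝟎≤D : (y : X D) → ∂ 𝟎 y ℕ.≤ D
∂𝟎≤D []       = ℕ.z≤n
∂𝟎≤D (0F ∷ y) = ℕ.m≤n⇒m≤1+n (∂𝟎≤D y)
∂𝟎≤D (1F ∷ y) = ℕ.s≤s (∂𝟎≤D y)

module _ {k : ℕ} (v : V D) (y : X D) where
  E*-on : ∂ 𝟎 y ≡ k → (E* k ⊛ v) y ≈ v y
  E*-on p = C.trans (E*-⊛ k v y)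
    (C.trans (C.*-congʳ (if-yes (∂ 𝟎 y ℕ.≟ k) p)) (C.*-identityˡ (v y)))

  E*-off : ∂ 𝟎 y ≢ k → (E* k ⊛ v) y ≈ fromℕ 0
  E*-off p = C.trans (E*-⊛ k v y) (C.trans (C.*-congʳ (if-no (∂ 𝟎 y ℕ.≟ k) p)) (C.zeroˡ (v y)))

A*-spectral : IsSpectral (A* {D}) E*
A*-spectral {D} = record
  { eigen     = eigen
  ; coeigen   = λ k v y → C.trans (commute k v y) (eigen k v y)
  ; fixes     = fixes
  ; vanishes  = λ {k} D<k v y → E*-off {k = k} v y (ℕ.<⇒≢ (ℕ.≤-<-trans (∂𝟎≤D y) D<k))
  ; decompose = decompose
  }
  where
  eigen : ∀ k v → A* ⊛ E* k ⊛ v ≈ᵥ θᶜ D k ∙ᵥ E* k ⊛ v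
  eigen k v y with ∂ 𝟎 y ℕ.≟ k
  ... | yes p = C.trans (A*-⊛ (E* k ⊛ v) y) (C.*-congʳ (C.reflexive (cong (θᶜ D) p)))
  ... | no p = C.trans (A*-⊛ (E* k ⊛ v) y)
    (C.trans (vanish (θᶜ D (∂ 𝟎 y))) (C.sym (vanish (θᶜ D k))))
    where
    vanish : ∀ c → c * (E* k ⊛ v) y ≈ fromℕ 0
    vanish c = C.trans (C.*-congˡ (E*-off v y p)) (C.zeroʳ c)
  commute : ∀ k v → E* k ⊛ A* ⊛ v ≈ᵥ A* ⊛ E* k ⊛ v
  commute k v y = begin
    (E* k ⊛ A* ⊛ v) y ≈⟨ E*-⊛ k (A* ⊛ v) y ⟩
    e * (A* ⊛ v) y ≈⟨ C.*-congˡ (A*-⊛ v y) ⟩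
    e * (t * v y) ≈⟨ solve 3 (λ e t a → e :* (t :* a) := t :* (e :* a)) C.refl e t (v y) ⟩
    t * (e * v y) ≈⟨ C.*-congˡ (E*-⊛ k v y) ⟨
    t * (E* k ⊛ v) y ≈⟨ A*-⊛ (E* k ⊛ v) y ⟨
    (A* ⊛ E* k ⊛ v) y ∎
    where
    open ℂ-Solver
    e = if does (∂ 𝟎 y ℕ.≟ k) then fromℕ 1 else fromℕ 0
    t = θᶜ D (∂ 𝟎 y)
  fixes : ∀ k {v} → A* ⊛ v ≈ᵥ θᶜ D k ∙ᵥ v → E* k ⊛ v ≈ᵥ v
  fixes k {v} A*v≈ y with ∂ 𝟎 y ℕ.≟ k
  ... | yes p = E*-on v y p
  ... | no p = C.trans (E*-off v y p) (C.sym (eigenvalue-cancel (θ-difference D (∂ 𝟎 y) k) (≢-sym p)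
    (C.trans (C.sym (A*-⊛ v y)) (A*v≈ y))))
  decompose : ∀ v → v ≈ᵥ combination {suc D} (λ _ → fromℕ 1) (λ k → E* (toℕ k) ⊛ v)
  decompose v y = C.sym (sum-at {suc D} (λ k → fromℕ 1 * (E* (toℕ k) ⊛ v) y) (∂ 𝟎 y)
    (λ k k≢ → C.trans (C.*-congˡ {fromℕ 1} (E*-off v y (≢-sym k≢))) (C.zeroʳ (fromℕ 1)))
    (λ k k≡ → C.trans (C.*-congˡ {fromℕ 1} (E*-on v y (sym k≡))) (C.*-identityˡ (v y)))
    (λ D<∂ → contradiction (∂𝟎≤D y) (ℕ.<⇒≱ D<∂)))

spectral-transport : ∀ {Y Y′ : Mat D} {F F′ : ℕ → Mat D} → Intertwined Y′ Y →
  (∀ k v → F′ k ⊛ v ≈ᵥ P⁻¹ ⊛ F k ⊛ P ⊛ v) → IsSpectral Y F → IsSpectral Y′ F′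
spectral-transport {D} {Y} {Y′} {F} {F′} pY pF S = record
  { eigen     = λ k v → V.trans (⊛-congʳ Y′ (pF k v)) (V.trans (pY (F k ⊛ P ⊛ v))
      (V.trans (⊛-congʳ P⁻¹ (S.eigen k (P ⊛ v))) (scaled k v)))
  ; coeigen   = λ k v → V.trans (pF k (Y′ ⊛ v)) (V.trans (⊛-congʳ P⁻¹ (V.trans
      (⊛-congʳ (F k) (PY v)) (S.coeigen k (P ⊛ v)))) (scaled k v))
  ; fixes     = λ k {v} Y′v≈ → V.trans (pF k v) (V.trans (⊛-congʳ P⁻¹ (S.fixes k
      (V.trans (V.sym (PY v)) (V.trans (⊛-congʳ P Y′v≈) (⊛-∙ P (θᶜ D k) v))))) (P⁻¹-P v))
  ; vanishes  = λ {k} D<k v → V.trans (pF k v) (⊛-0 P⁻¹ (S.vanishes D<k (P ⊛ v)))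
  ; decompose = λ v → V.trans (V.sym (P⁻¹-P v)) (V.trans (⊛-congʳ P⁻¹ (S.decompose (P ⊛ v)))
      (V.trans (⊛-combination P⁻¹ (λ _ → fromℕ 1) (λ (k : Fin (suc D)) → F (toℕ k) ⊛ P ⊛ v))
        (λ y → sum-cong-≋ {suc D} (λ k → C.*-congˡ {fromℕ 1} (C.sym (pF (toℕ k) v y))))))
  }
  where
  module S = IsSpectral S
  scaled : ∀ k v → P⁻¹ ⊛ θᶜ D k ∙ᵥ F k ⊛ P ⊛ v ≈ᵥ θᶜ D k ∙ᵥ F′ k ⊛ v
  scaled k v y = C.trans (⊛-∙ P⁻¹ (θᶜ D k) (F k ⊛ P ⊛ v) y) (C.*-congˡ (C.sym (pF k v y)))
  PY : ∀ v → P ⊛ Y′ ⊛ v ≈ᵥ Y ⊛ P ⊛ v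
  PY v = V.trans (⊛-congʳ P (⊛-congʳ Y′ (V.sym (P⁻¹-P v))))
    (V.trans (⊛-congʳ P (pY (P ⊛ v))) (P-P⁻¹ (Y ⊛ P ⊛ v)))

-- With the matrix as a parameter, the polynomial that defines `E` can be carried between the three
-- matrices and, for each of them, seen to lie in `T`.
factor : Mat D → ℕ → ℕ → Mat D
factor {D} Y i j with i ℕ.≟ j
... | yes _  = I
... | no i≢j = fromℚ ((ℚ.1/ (θ D i ℚ.- θ D j)) {{θ-nonZero D i j i≢j}}) ∙ₘ (Y -ₘ θᶜ D j ∙ₘ I)

lagrange : Mat D → ℕ → Mat D
lagrange {D} Y i = ∏ (List.map (factor Y i) (upTo (suc D)))

lagrange-A : ∀ i → E i ≡ lagrange (A {D}) i
lagrange-A {D} i = cong ∏ (List.map-cong same (upTo (suc D)))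
  where
  same : ∀ j → lagrangeFactor i j ≡ factor A i j
  same j with i ℕ.≟ j
  ... | yes _ = refl
  ... | no _ = refl

affine-⊛ : ∀ c t (Y : Mat D) v → (c ∙ₘ (Y -ₘ t ∙ₘ I)) ⊛ v ≈ᵥ c ∙ᵥ (Y ⊛ v +ᵥ (- t) ∙ᵥ v)
affine-⊛ c t Y v y = C.trans (∙ₘ-⊛ c (Y -ₘ t ∙ₘ I) v y) (C.*-congˡ
  (C.trans (⊛-congˡ (-ₘ-+ₘ Y (t ∙ₘ I)) v y) (C.trans (+ₘ-⊛ Y ((- fromℚ 1ℚ) ∙ₘ (t ∙ₘ I)) v y)
    (C.+-congˡ (C.trans (∙ₘ-⊛ (- fromℚ 1ℚ) (t ∙ₘ I) v y) (C.trans (C.*-congˡ (∙ₘ-⊛ t I v y))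
      (C.trans (C.*-congˡ (C.*-congˡ (I-⊛ v y)))
        (solve 2 (λ t a → (:- con 1ℚ) :* (t :* a) := (:- t) :* a) C.refl t (v y)))))))))
  where open ℂ-Solver

lagrange-intertwined : ∀ {Y Y′ : Mat D} → Intertwined Y′ Y → ∀ i →
  Intertwined (lagrange Y′ i) (lagrange Y i)
lagrange-intertwined {D} {Y} {Y′} p i = chain (upTo (suc D))
  where
  affine : ∀ c t → Intertwined (c ∙ₘ (Y′ -ₘ t ∙ₘ I)) (c ∙ₘ (Y -ₘ t ∙ₘ I))
  affine c t v y = begin
    ((c ∙ₘ (Y′ -ₘ t ∙ₘ I)) ⊛ P⁻¹ ⊛ v) y ≈⟨ affine-⊛ c t Y′ (P⁻¹ ⊛ v) y ⟩
    c * ((Y′ ⊛ P⁻¹ ⊛ v) y + - t * (P⁻¹ ⊛ v) y)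
      ≈⟨ C.*-congˡ (C.+-cong (p v y) (C.sym (⊛-∙ P⁻¹ (- t) v y))) ⟩
    c * ((P⁻¹ ⊛ Y ⊛ v) y + (P⁻¹ ⊛ (- t) ∙ᵥ v) y) ≈⟨ C.*-congˡ (⊛-+ P⁻¹ (Y ⊛ v) ((- t) ∙ᵥ v) y) ⟨
    c * (P⁻¹ ⊛ (Y ⊛ v +ᵥ (- t) ∙ᵥ v)) y ≈⟨ ⊛-∙ P⁻¹ c (Y ⊛ v +ᵥ (- t) ∙ᵥ v) y ⟨
    (P⁻¹ ⊛ c ∙ᵥ (Y ⊛ v +ᵥ (- t) ∙ᵥ v)) y ≈⟨ ⊛-congʳ P⁻¹ (affine-⊛ c t Y v) y ⟨
    (P⁻¹ ⊛ (c ∙ₘ (Y -ₘ t ∙ₘ I)) ⊛ v) y ∎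
  unit-intertwined : Intertwined {D} I I
  unit-intertwined v = V.trans (I-⊛ (P⁻¹ ⊛ v)) (⊛-congʳ P⁻¹ (V.sym (I-⊛ v)))
  factors : ∀ j → Intertwined (factor Y′ i j) (factor Y i j)
  factors j with i ℕ.≟ j
  ... | yes _ = unit-intertwined
  ... | no i≢j = affine (fromℚ ((ℚ.1/ (θ D i ℚ.- θ D j)) {{θ-nonZero D i j i≢j}})) (θᶜ D j)
  chain : ∀ js → Intertwined (∏ (List.map (factor Y′ i) js)) (∏ (List.map (factor Y i) js))
  chain [] = unit-intertwined
  chain (j ∷ js) v = V.trans (*ₘ-⊛ M′ N′ (P⁻¹ ⊛ v)) (V.trans (⊛-congʳ M′ (chain js v))
    (V.trans (factors j (N ⊛ v)) (⊛-congʳ P⁻¹ (V.sym (*ₘ-⊛ M N v)))))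
    where
    M′ = factor Y′ i j
    N′ = ∏ (List.map (factor Y′ i) js)
    M = factor Y i j
    N = ∏ (List.map (factor Y i) js)

-- In row `y` the matrix `A*` is the scalar θ of index `∂ 𝟎 y`. If this index is i, all factors are
-- 1 there. Otherwise the factor of that index is 0, and it does occur because the distance is at
-- most D.
lagrange-A* : ∀ i (v : V D) → lagrange A* i ⊛ v ≈ᵥ E* i ⊛ v
lagrange-A* {D} i v y with ∂ 𝟎 y ℕ.≟ i
... | yes refl = C.trans (fixed (upTo (suc D))) (C.sym (E*-on v y refl))
  where
  open ℂ-Solver
  factor-fixed : ∀ j w → (factor A* i j ⊛ w) y ≈ w y
  factor-fixed j w with i ℕ.≟ j
  ... | yes _ = I-⊛ w y
  ... | no i≢j = begin
    ((c ∙ₘ (A* -ₘ θᶜ D j ∙ₘ I)) ⊛ w) y ≈⟨ affine-⊛ c (θᶜ D j) A* w y ⟩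
    c * ((A* ⊛ w) y + - θᶜ D j * w y) ≈⟨ C.*-congˡ (C.+-congʳ (A*-⊛ w y)) ⟩
    c * (θᶜ D i * w y + - θᶜ D j * w y)
      ≈⟨ solve 4 (λ c s t a → c :* (s :* a :+ (:- t) :* a)
          := (c :* (s :- t)) :* a) C.refl c (θᶜ D i) (θᶜ D j) (w y) ⟩
    c * (θᶜ D i + - θᶜ D j) * w y
      ≈⟨ C.*-congʳ (C.*-congˡ
          (C.trans (fromℚ-+ (θ D i) (ℚ.- θ D j)) (C.+-congˡ (fromℚ-neg (θ D j))))) ⟨
    c * fromℚ q * w y ≈⟨ C.*-congʳ (fromℚ-* (ℚ.1/ q) q) ⟨
    fromℚ (ℚ.1/ q ℚ.* q) * w y ≡⟨ cong (λ p → fromℚ p * w y) (ℚ.*-inverseˡ q) ⟩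
    fromℚ 1ℚ * w y ≈⟨ C.*-identityˡ (w y) ⟩
    w y ∎
    where
    q = θ D i ℚ.- θ D j
    instance _ = θ-nonZero D i j i≢j
    c = fromℚ (ℚ.1/ q)
  fixed : ∀ js → (∏ (List.map (factor A* i) js) ⊛ v) y ≈ v y
  fixed [] = I-⊛ v y
  fixed (j ∷ js) = C.trans (*ₘ-⊛ (factor A* i j) N v y)
    (C.trans (factor-fixed j (N ⊛ v)) (fixed js))
    where N = ∏ (List.map (factor A* i) js)
... | no ∂≢i = C.trans (killed (∈-upTo⁺ (ℕ.s≤s (∂𝟎≤D y)))) (C.sym (E*-off v y ∂≢i))
  where
  open ℂ-Solver
  factor-kills : ∀ w → (factor A* i (∂ 𝟎 y) ⊛ w) y ≈ fromℕ 0
  factor-kills w with i ℕ.≟ ∂ 𝟎 y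
  ... | yes i≡∂ = contradiction (sym i≡∂) ∂≢i
  ... | no i≢∂ = C.trans (affine-⊛ c t A* w y) (C.trans (C.*-congˡ (C.+-congʳ (A*-⊛ w y)))
      (solve 3 (λ c t a → c :* (t :* a :+ (:- t) :* a) := con 0ℚ) C.refl c t (w y)))
    where
    t = θᶜ D (∂ 𝟎 y)
    c = fromℚ ((ℚ.1/ (θ D i ℚ.- θ D (∂ 𝟎 y))) {{θ-nonZero D i (∂ 𝟎 y) i≢∂}})
  factor-local : ∀ j w → w y ≈ fromℕ 0 → (factor A* i j ⊛ w) y ≈ fromℕ 0
  factor-local j w wy≈0 with i ℕ.≟ j
  ... | yes _ = C.trans (I-⊛ w y) wy≈0
  ... | no i≢j = C.trans (affine-⊛ c (θᶜ D j) A* w y) (C.trans (C.*-congˡ (C.+-cong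
        (C.trans (A*-⊛ w y) (C.*-congˡ wy≈0)) (C.*-congˡ wy≈0)))
      (solve 3 (λ c s t → c :* (s :* con 0ℚ :+ t :* con 0ℚ)
        := con 0ℚ) C.refl c (θᶜ D (∂ 𝟎 y)) (- θᶜ D j)))
    where
    c = fromℚ ((ℚ.1/ (θ D i ℚ.- θ D j)) {{θ-nonZero D i j i≢j}})
  killed : ∀ {js} → ∂ 𝟎 y List.∈ js → (∏ (List.map (factor A* i) js) ⊛ v) y ≈ fromℕ 0
  killed {js = j ∷ js} (here refl) = C.trans (*ₘ-⊛ (factor A* i j) N v y) (factor-kills (N ⊛ v))
    where N = ∏ (List.map (factor A* i) js)
  killed {js = j ∷ js} (there p) = C.trans (*ₘ-⊛ (factor A* i j) N v y)
    (factor-local j (N ⊛ v) (killed p))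
    where N = ∏ (List.map (factor A* i) js)

E-conjugate : ∀ k (v : V D) → E k ⊛ v ≈ᵥ P⁻¹ ⊛ E* k ⊛ P ⊛ v
E-conjugate k v = V.trans (λ y → C.reflexive (cong (λ M → (M ⊛ v) y) (lagrange-A k)))
  (V.trans (⊛-congʳ (lagrange A k) (V.sym (P⁻¹-P v)))
    (V.trans (lagrange-intertwined A-P⁻¹ k (P ⊛ v))
    (⊛-congʳ P⁻¹ (lagrange-A* k (P ⊛ v)))))

Eᵋ-conjugate : ∀ k (v : V D) → Eᵋ k ⊛ v ≈ᵥ P⁻¹ ⊛ E k ⊛ P ⊛ v
Eᵋ-conjugate k v = V.trans (*ₘ-⊛ (P⁻¹ *ₘ E k) P v) (*ₘ-⊛ P⁻¹ (E k) (P ⊛ v))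

-- Defined by conjugation, `Eᵋ` is not visibly an element of `T`; as a polynomial in `Aᵋ` it maps W
-- into itself.
lagrange-Aᵋ : ∀ k (v : V D) → Eᵋ k ⊛ v ≈ᵥ lagrange Aᵋ k ⊛ v
lagrange-Aᵋ k v = V.trans (Eᵋ-conjugate k v) (V.trans
  (⊛-congʳ P⁻¹ (λ y → C.reflexive (cong (λ M → (M ⊛ P ⊛ v) y) (lagrange-A k))))
  (V.trans (V.sym (lagrange-intertwined Aᵋ-P⁻¹ k (P ⊛ v))) (⊛-congʳ (lagrange Aᵋ k) (P⁻¹-P v))))

A-spectral : IsSpectral (A {D}) E
A-spectral = spectral-transport A-P⁻¹ E-conjugate A*-spectral

Aᵋ-spectral : IsSpectral (Aᵋ {D}) Eᵋ
Aᵋ-spectral = spectral-transport Aᵋ-P⁻¹ Eᵋ-conjugate A-spectral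

-- The Terwilliger algebra

rotate-irreducible : ∀ {X Y Z : Mat D} {W} → IsIrreducibleFor X Y Z W → IsIrreducibleFor Y Z X W
rotate-irreducible i = record
  { isSubspace = isSubspace ; X-closed = Y-closed ; Y-closed = Z-closed ; Z-closed = X-closed
  ; minimal = λ S Y Z X → minimal S X Y Z }
  where open IsIrreducibleFor i

reflect-irreducible : ∀ {X Y Z : Mat D} {W} → IsIrreducibleFor X Y Z W → IsIrreducibleFor X Z Y W
reflect-irreducible i = record
  { isSubspace = isSubspace ; X-closed = X-closed ; Y-closed = Z-closed ; Z-closed = Y-closed
  ; minimal = λ S X Z Y → minimal S X Y Z }
  where open IsIrreducibleFor i

A∈T : A {D} ∈ T
A∈T = generator (inj₁ refl)

A*∈T : A* {D} ∈ T
A*∈T = generator (inj₂ refl)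

-ₘ∈T : ∀ {M N : Mat D} → M ∈ T → N ∈ T → M -ₘ N ∈ T
-ₘ∈T {M = M} {N} M∈T N∈T =
  congruent (λ y z → C.sym (-ₘ-+ₘ M N y z)) (sums M∈T (multiples (- fromℚ 1ℚ) N∈T))

Aᵋ∈T : Aᵋ {D} ∈ T
Aᵋ∈T = multiples _ (-ₘ∈T (products A∈T A*∈T) (products A*∈T A∈T))

lagrange∈T : ∀ {Y : Mat D} → Y ∈ T → ∀ i → lagrange Y i ∈ T
lagrange∈T {D} {Y} Y∈T i = product (upTo (suc D))
  where
  factor∈T : ∀ j → factor Y i j ∈ T
  factor∈T j with i ℕ.≟ j
  ... | yes _ = unit
  ... | no _ = multiples _ (-ₘ∈T Y∈T (multiples (θᶜ D j) unit))
  product : ∀ js → ∏ (List.map (factor Y i) js) ∈ T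
  product []       = unit
  product (j ∷ js) = products (factor∈T j) (product js)

isTModule : ∀ {U : Pred (V D) 0ℓ} → IsSubspace U → Closed A U → Closed A* U → IsTModule U
isTModule {U = U} S A-closed A*-closed = record { isSubspace = S ; T-closed = closed }
  where
  open IsSubspace S
  closed : ∀ {M} → M ∈ T → ∀ {w} → w ∈ U → M ⊛ w ∈ U
  closed (generator (inj₁ refl)) = A-closed
  closed (generator (inj₂ refl)) = A*-closed
  closed unit {w} w∈U = respects (V.sym (I-⊛ w)) w∈U
  closed (sums {M} {N} p q) {w} w∈U = respects (V.sym (+ₘ-⊛ M N w))
    (+ᵥ-closed (closed p w∈U) (closed q w∈U))
  closed (products {M} {N} p q) {w} w∈U = respects (V.sym (*ₘ-⊛ M N w)) (closed p (closed q w∈U))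
  closed (multiples c {M} p) {w} w∈U = respects (V.sym (∙ₘ-⊛ c M w)) (∙ᵥ-closed c (closed p w∈U))
  closed (congruent M≈N p) {w} w∈U = respects (⊛-congˡ M≈N w) (closed p w∈U)

-- Along the bits of `S`, the first r are outside, the next m inside and the rest outside; any other
-- bit contradicts `bounds` or `members`.
∣S∣≡length : ∀ (S : Subset n) r m → r ℕ.+ m ℕ.≤ n →
  (∀ i → i Subset.∈ S → r ℕ.≤ toℕ i × toℕ i ℕ.< r ℕ.+ m) →
  (∀ i → r ℕ.≤ toℕ i → toℕ i ℕ.< r ℕ.+ m → i Subset.∈ S) → ∣ S ∣ ≡ m
∣S∣≡length [] zero zero _ _ _ = refl
∣S∣≡length (inside ∷ S) (suc r) m r+m≤n bounds members with () ← proj₁ (bounds zero here)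
∣S∣≡length (outside ∷ S) (suc r) m r+m≤n bounds members = ∣S∣≡length S r m (ℕ.s≤s⁻¹ r+m≤n)
  (λ i i∈S → let p , q = bounds (suc i) (there i∈S) in ℕ.s≤s⁻¹ p , ℕ.s≤s⁻¹ q)
  (λ i p q → drop-there (members (suc i) (ℕ.s≤s p) (ℕ.s≤s q)))
∣S∣≡length (inside ∷ S) zero zero _ bounds members with () ← proj₂ (bounds zero here)
∣S∣≡length (outside ∷ S) zero zero _ bounds members = ∣S∣≡length S zero zero ℕ.z≤n
  (λ i i∈S → contradiction (proj₂ (bounds (suc i) (there i∈S))) λ ()) (λ i _ ())
∣S∣≡length (outside ∷ S) zero (suc m) _ bounds members with () ← members zero ℕ.z≤n (ℕ.s≤s ℕ.z≤n)
∣S∣≡length (inside ∷ S) zero (suc m) m≤n bounds members = cong suc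
  (∣S∣≡length S zero m (ℕ.s≤s⁻¹ m≤n)
  (λ i i∈S → ℕ.z≤n , ℕ.s≤s⁻¹ (proj₂ (bounds (suc i) (there i∈S))))
  (λ i _ q → drop-there (members (suc i) ℕ.z≤n (ℕ.s≤s q))))

-- The endpoint, the diameter and the six bases

module Main {D} (W : Pred (V D) 0ℓ) (W-irr : IsIrreducible W) (r d : ℕ)
  (endpoint : IsEndpoint W r) (diameter : IsDiameter W d) where

  open IsIrreducible W-irr using (irreducible) renaming (isTModule to W-isTModule)
  open IsTModule W-isTModule using (T-closed) renaming (isSubspace to W-isSubspace)
  open IsSubspace W-isSubspace
  open IsEndpoint endpoint using (bound; smallest)

  W-irreducible : IsIrreducibleFor A A* Aᵋ W
  W-irreducible = record
    { isSubspace = W-isSubspace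
    ; X-closed = T-closed A∈T
    ; Y-closed = T-closed A*∈T
    ; Z-closed = T-closed Aᵋ∈T
    ; minimal = λ S A-closed A*-closed _ → irreducible (isTModule S A-closed A*-closed)
    }

  E-closed : ∀ k → Closed (E k) W
  E-closed k {v} v∈W = respects (λ y → C.reflexive (cong (λ M → (M ⊛ v) y) (sym (lagrange-A k))))
    (T-closed (lagrange∈T A∈T k) v∈W)

  E*-closed : ∀ k → Closed (E* k) W
  E*-closed k {v} v∈W = respects (lagrange-A* k v) (T-closed (lagrange∈T A*∈T k) v∈W)

  Eᵋ-closed : ∀ k → Closed (Eᵋ k) W
  Eᵋ-closed k {v} v∈W = respects (V.sym (lagrange-Aᵋ k v)) (T-closed (lagrange∈T Aᵋ∈T k) v∈W)

  -- `smallest` speaks of nonzero vectors, so vanishing is first obtained under a double negation,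
  -- which is removed entry by entry.
  E*-below : ∀ {j} → j ℕ.< r → ∀ {v} → v ∈ W → E* j ⊛ v ≈ᵥ 0ᵥ
  E*-below {j} j<r {v} v∈W y = ≈0-stable λ ≉0 → ℕ.<⇒≱ j<r (smallest (ℕ.≤-trans (ℕ.<⇒≤ j<r) bound)
    (E* j ⊛ v , (v , v∈W , V.refl) , λ ≈0 → ≉0 (≈0 y)))

  module Eigenvector {Y : Mat D} {F : ℕ → Mat D} (S : IsSpectral Y F)
    (F-closed : ∀ k → Closed (F k) W) {v : V D} (v∈FW : v ∈ F r ⟨ W ⟩) where
    v∈W : v ∈ W
    v∈W = let w , w∈W , v≈ = v∈FW in respects (V.sym v≈) (F-closed r w∈W)

    Yv≈ : Y ⊛ v ≈ᵥ θᶜ D r ∙ᵥ v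
    Yv≈ = let w , w∈W , v≈ = v∈FW in V.trans (⊛-congʳ Y v≈)
      (V.trans (IsSpectral.eigen S r w) (λ y → C.*-congˡ (C.sym (v≈ y))))

  module Cases (u u* uᵋ : V D)
    (u∈  : u  ∈ E r ⟨ W ⟩)  (u≉0  : ¬ (u  ≈ᵥ 0ᵥ))
    (u*∈ : u* ∈ E* r ⟨ W ⟩) (u*≉0 : ¬ (u* ≈ᵥ 0ᵥ))
    (uᵋ∈ : uᵋ ∈ Eᵋ r ⟨ W ⟩) (uᵋ≉0 : ¬ (uᵋ ≈ᵥ 0ᵥ)) where

    module U* = Eigenvector A*-spectral E*-closed u*∈
    module U  = Eigenvector A-spectral E-closed u∈
    module Uᵋ = Eigenvector Aᵋ-spectral Eᵋ-closed uᵋ∈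

    module A*-Eᵋ = Core (rotate A-triple) A*-spectral Aᵋ-spectral
      (rotate-irreducible W-irreducible) Eᵋ-closed r E*-below U*.v∈W U*.Yv≈ u*≉0
    module A*-E = Core (reflect (rotate A-triple)) A*-spectral A-spectral
      (reflect-irreducible (rotate-irreducible W-irreducible)) E-closed r E*-below U*.v∈W U*.Yv≈ u*≉0

    d₀ : ℕ
    d₀ = D ℕ.∸ (r ℕ.+ r)

    r+r+d₀≡D : r ℕ.+ (r ℕ.+ d₀) ≡ D
    r+r+d₀≡D = trans (sym (ℕ.+-assoc r r d₀)) (ℕ.m+[n∸m]≡n A*-E.r+r≤D)

    E-below : ∀ {j} → j ℕ.< r → ∀ {v} → v ∈ W → E j ⊛ v ≈ᵥ 0ᵥ
    E-below {j} j<r = A*-E.WithDiameter.G-vanishes d₀ r+r+d₀≡D j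
      (λ i → ℕ.<⇒≢ (ℕ.<-≤-trans j<r (ℕ.m≤m+n r (toℕ i))))

    Eᵋ-below : ∀ {j} → j ℕ.< r → ∀ {v} → v ∈ W → Eᵋ j ⊛ v ≈ᵥ 0ᵥ
    Eᵋ-below {j} j<r = A*-Eᵋ.WithDiameter.G-vanishes d₀ r+r+d₀≡D j
      (λ i → ℕ.<⇒≢ (ℕ.<-≤-trans j<r (ℕ.m≤m+n r (toℕ i))))

    module A-E* = Core A-triple A-spectral A*-spectral
      W-irreducible E*-closed r E-below U.v∈W U.Yv≈ u≉0
    module A-Eᵋ = Core (reflect A-triple) A-spectral Aᵋ-spectral
      (reflect-irreducible W-irreducible) Eᵋ-closed r E-below U.v∈W U.Yv≈ u≉0
    module Aᵋ-E = Core (rotate (rotate A-triple)) Aᵋ-spectral A-spectral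
      (rotate-irreducible (rotate-irreducible W-irreducible)) E-closed r Eᵋ-below Uᵋ.v∈W Uᵋ.Yv≈ uᵋ≉0
    module Aᵋ-E* = Core (reflect (rotate (rotate A-triple))) Aᵋ-spectral A*-spectral
      (reflect-irreducible (rotate-irreducible (rotate-irreducible W-irreducible))) E*-closed r
      Eᵋ-below Uᵋ.v∈W Uᵋ.Yv≈ uᵋ≉0

    -- The indices of `A*` on W are counted in a basis of `A*`-eigenvectors, which comes from `A-E*`
    -- and not from the instances with `A*` in the role of `X`. They are those from r to r + d₀.
    d₀≡d : d₀ ≡ d
    d₀≡d = let S , S⇔ , ∣S∣≡ = diameter in ℕ.suc-injective (trans (sym (∣S∣≡length S r (suc d₀)
        (subst (ℕ._≤ suc D) (sym (ℕ.+-suc r d₀))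
          (ℕ.s≤s (subst (r ℕ.+ d₀ ℕ.≤_) r+r+d₀≡D (ℕ.m≤n+m (r ℕ.+ d₀) r))))
        (λ i i∈S → bounds i (Equivalence.to (S⇔ i) i∈S))
        (λ i r≤i i<r+d → Equivalence.from (S⇔ i) (member i r≤i i<r+d)))) ∣S∣≡)
      where
      bounds : ∀ i → NonZero (E* (toℕ i) ⟨ W ⟩) → r ℕ.≤ toℕ i × toℕ i ℕ.< r ℕ.+ suc d₀
      bounds i (v , (w , w∈W , v≈) , v≉0) with r ℕ.≤? toℕ i | toℕ i ℕ.<? r ℕ.+ suc d₀
      ... | yes p | yes q = p , q
      ... | no p  | _     = contradiction (V.trans v≈ (E*-below (ℕ.≰⇒> p) w∈W)) v≉0
      ... | _     | no q  = contradiction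
        (V.trans v≈ (A-E*.WithDiameter.G-vanishes d₀ r+r+d₀≡D (toℕ i)
        (λ j e → q (subst (ℕ._< r ℕ.+ suc d₀) (sym e) (ℕ.+-monoʳ-< r (Fin.toℕ<n j)))) w∈W)) v≉0
      member : ∀ (i : Fin (suc D)) → r ℕ.≤ toℕ i → toℕ i ℕ.< r ℕ.+ suc d₀ →
        NonZero (E* (toℕ i) ⟨ W ⟩)
      member i r≤i i<r+d = A-E*.w (toℕ i) , (u , U.v∈W , V.refl) , A-E*.w-nonZero (toℕ i) r≤i
        (subst (r ℕ.+ toℕ i ℕ.≤_) r+r+d₀≡D
          (ℕ.+-monoʳ-≤ r (ℕ.s≤s⁻¹ (subst (toℕ i ℕ.<_) (ℕ.+-suc r d₀) i<r+d))))

    r+r+d≡D : r ℕ.+ (r ℕ.+ d) ≡ D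
    r+r+d≡D = trans (cong (λ k → r ℕ.+ (r ℕ.+ k)) (sym d₀≡d)) r+r+d₀≡D

theorem10p2 : (D : ℕ) .{{_ : ℕ.NonZero D}}
    (W : Pred (V D) 0ℓ) → IsIrreducible W →
    (r d : ℕ) → IsEndpoint W r → IsDiameter W d →
    (u u* uᵋ : V D) →
    u  ∈ E r ⟨ W ⟩  → ¬ (u  ≈ᵥ 0ᵥ) →
    u* ∈ E* r ⟨ W ⟩ → ¬ (u* ≈ᵥ 0ᵥ) →
    uᵋ ∈ Eᵋ r ⟨ W ⟩ → ¬ (uᵋ ≈ᵥ 0ᵥ) →
    (Represents W (B d) A  (λ i → E* (r ℕ.+ toℕ i) ⊛ u)  ×
    Represents W (B d) A  (λ i → Eᵋ (r ℕ.+ toℕ i) ⊛ u))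
    × (Represents W (B d) A* (λ i → Eᵋ (r ℕ.+ toℕ i) ⊛ u*) ×
    Represents W (B d) A* (λ i → E  (r ℕ.+ toℕ i) ⊛ u*))
    × (Represents W (B d) Aᵋ (λ i → E  (r ℕ.+ toℕ i) ⊛ uᵋ) ×
    Represents W (B d) Aᵋ (λ i → E* (r ℕ.+ toℕ i) ⊛ uᵋ))
theorem10p2 D W W-irr r d endpoint diameter u u* uᵋ u∈ u≉0 u*∈ u*≉0 uᵋ∈ uᵋ≉0 =
  (A-E*.WithDiameter.represents d r+r+d≡D , A-Eᵋ.WithDiameter.represents d r+r+d≡D) ,
  (A*-Eᵋ.WithDiameter.represents d r+r+d≡D , A*-E.WithDiameter.represents d r+r+d≡D) ,
  (Aᵋ-E.WithDiameter.represents d r+r+d≡D , Aᵋ-E*.WithDiameter.represents d r+r+d≡D)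
  where
  open Main W W-irr r d endpoint diameter
  open Cases u u* uᵋ u∈ u≉0 u*∈ u*≉0 uᵋ∈ uᵋ≉0
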